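{- Let $\Delta^-=\{[a:b:c:d]\in\mathbb{RP}^3\mid \Delta_3(a,b,c,d)<0\}$ be the set of (scaling classes of) real cubics with exactly one real root, where $\Delta_3$ is the discriminant of the binary cubic $ax^3+bx^2y+cxy^2+dy^3$, and let $\mathcal{R}(\Delta^-)=\{\{r,z,\overline z\}\mid r\in\mathbb{RP}^1,\ z\in\mathbb{C}\setminus\mathbb{R}\}$ be the set of their root-sets. Each of these spaces admits a natural $\mathrm{PSL}(2;\mathbb{R})$ action: on $\Delta^-$, $A\cdot[f]=[f\circ A^{ -1}]$ (precomposing the cubic form with a linear transformation), and on $\mathcal{R}(\Delta^-)$, $A\cdot\{r,z,\overline z\}=\{A.r,A.z,A.\overline z\}$ (applying the Möbius transformation to each root). Equipped with these actions, each of these spaces is isomorphic to the unit tangent bundle $\mathrm{UT}\mathbb{H}^2$ of the hyperbolic plane with its natural $\mathrm{PSL}(2;\mathbb{R})$ action.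
   Context: Roots of binary cubic forms are taken in $\mathbb{CP}^1=\mathbb{C}\cup\{\infty\}$, with $[x:y]=[z:1]$ corresponding to $z\in\mathbb{C}$ and $[1:0]$ to $\infty$; $\mathbb{RP}^1=\mathbb{R}\cup\{\infty\}\subset\mathbb{CP}^1$. $\Delta_3(a,b,c,d)=b^2c^2-4ac^3-4b^3d-27a^2d^2+18abcd$. $\Delta^-$ has the topology of a subset of $\mathbb{RP}^3$; $\mathcal{R}(\Delta^-)$ has the topology of a subset of the symmetric power $\mathrm{SP}^3(\mathbb{CP}^1)=(\mathbb{CP}^1)^3/S_3$. $\mathrm{UT}\mathbb{H}^2=\{(p,v)\mid p\in\mathbb{H}^2,\ v\in T_p\mathbb{H}^2,\ \|v\|=1\}$, where $\mathbb{H}^2$ is the upper half plane with metric $(dx^2+dy^2)/y^2$, and $\mathrm{PSL}(2;\mathbb{R})$ acts on $\mathrm{UT}\mathbb{H}^2$ by the differential of its action on $\mathbb{H}^2$ by Möbius isometries. Spaces with $\mathrm{PSL}(2;\mathbb{R})$ actions are "isomorphic" (as geometries in the sense of Klein) if there is a $\mathrm{PSL}(2;\mathbb{R})$-equivariant homeomorphism between them. -}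

module Defs where

open import Level using (0ℓ)
open import Algebra.Bundles using (CommutativeRing; Group)
import Algebra.Properties.Group as GroupProperties
open import Data.Empty using (⊥-elim)
open import Data.Fin.Base using (Fin; zero; suc)
open import Data.Fin.Patterns using (0F; 1F; 2F; 3F; 4F; 5F; 6F; 7F)
import Data.Fin.Permutation as Perm
open import Data.Nat.Base using (ℕ; suc)
open import Data.Product.Base using (Σ; Σ-syntax; ∃; _×_; _,_; proj₁; proj₂)
open import Data.Product.Relation.Binary.Pointwise.NonDependent using (×-setoid)
open import Data.Sum.Base using (_⊎_; inj₁; inj₂)
open import Data.Unit.Base using (⊤; tt)
open import Data.Vec.Base using (Vec; lookup) renaming ([] to []ᵛ; _∷_ to _∷ᵛ_)
open import Data.Vec.Functional using (Vector; []; _∷_)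
import Data.Vec.Functional.Relation.Binary.Equality.Setoid as VecEq
open import Function.Base using (_∘_)
open import Function.Bundles using (Inverse; _⇔_; mk⇔; Equivalence)
open import Relation.Binary.Bundles using (Setoid)
open import Relation.Binary.Core using (Rel; _⇒_)
open import Relation.Binary.Definitions using (_Respects_; tri<; tri≈; tri>)
open import Relation.Binary.Structures using (IsEquivalence; IsStrictTotalOrder)
import Relation.Binary.Construct.On as On
import Relation.Binary.Construct.StrictToNonStrict as NonStrict
import Relation.Binary.PropositionalEquality as ≡
open import Relation.Nullary using (¬_)
open import Relation.Unary using (Pred; _∩_; ⋃; _≐_)


module IntegerSolver (R : CommutativeRing 0ℓ 0ℓ) where
  open CommutativeRing R
  open import Algebra.Solver.Ring.AlmostCommutativeRing
    using (_-Raw-AlmostCommutative⟶_; fromCommutativeRing)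
  open import Algebra.Properties.Ring ring
    using (-0#≈0#; -‿+-comm; -‿involutive; -‿distribˡ-*; -‿distribʳ-*)
  open import Algebra.Properties.Semiring.Mult semiring
    using (×-homo-+; ×1-homo-*)
  open import Algebra.Properties.Semiring.Mult.TCOptimised semiring
    using () renaming (×ᵤ≈× to ×ᵤ≈×′)
  open import Algebra.Definitions.RawMonoid +-rawMonoid using (_×′_)
  open import Algebra.Definitions.RawMonoid +-rawMonoid using () renaming (_×_ to _⨯_)
  open import Data.Nat.Base as ℕ using (zero)
  open import Data.Integer.Base as ℤ using (ℤ; +_; -[1+_]; _⊖_)
  import Data.Integer.Properties as ℤₚ
  open import Data.Maybe.Base using (Maybe; just; nothing)
  open import Relation.Nullary.Decidable using (yes; no)
  import Relation.Binary.PropositionalEquality as ≡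
  open import Relation.Binary.Reasoning.Setoid setoid

  ⟦_⟧ : ℤ → Carrier
  ⟦ + n ⟧      = n ×′ 1#
  ⟦ -[1+ n ] ⟧ = - (suc n ×′ 1#)

  private
    ⟦_⟧ᵘ : ℤ → Carrier
    ⟦ + n ⟧ᵘ      = n ⨯ 1#
    ⟦ -[1+ n ] ⟧ᵘ = - (suc n ⨯ 1#)

    conv : ∀ i → ⟦ i ⟧ ≈ ⟦ i ⟧ᵘ
    conv (+ n)    = sym (×ᵤ≈×′ n 1#)
    conv -[1+ n ] = -‿cong (sym (×ᵤ≈×′ (suc n) 1#))

    cancel : ∀ x y z → (x + y) + - (x + z) ≈ y + - z
    cancel x y z = begin
      (x + y) + - (x + z)    ≈⟨ +-congˡ (-‿+-comm x z) ⟨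
      (x + y) + (- x + - z)  ≈⟨ +-congʳ (+-comm x y) ⟩
      (y + x) + (- x + - z)  ≈⟨ +-assoc y x _ ⟩
      y + (x + (- x + - z))  ≈⟨ +-congˡ (+-assoc x (- x) (- z)) ⟨
      y + ((x + - x) + - z)  ≈⟨ +-congˡ (+-congʳ (-‿inverseʳ x)) ⟩
      y + (0# + - z)         ≈⟨ +-congˡ (+-identityˡ _) ⟩
      y + - z                ∎

    ⊖-homo : ∀ m n → ⟦ m ⊖ n ⟧ᵘ ≈ m ⨯ 1# + - (n ⨯ 1#)
    ⊖-homo m zero = sym (trans (+-congˡ -0#≈0#) (+-identityʳ _))
    ⊖-homo zero (suc n) = sym (+-identityˡ _)
    ⊖-homo (suc m) (suc n) rewrite ℤₚ.[1+m]⊖[1+n]≡m⊖n m n =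
      trans (⊖-homo m n) (sym (cancel 1# (m ⨯ 1#) (n ⨯ 1#)))

    neg-homo : ∀ i → ⟦ ℤ.- i ⟧ᵘ ≈ - ⟦ i ⟧ᵘ
    neg-homo (+ zero)  = sym -0#≈0#
    neg-homo (+ suc n) = refl
    neg-homo -[1+ n ]  = sym (-‿involutive _)

    +-homoᵘ : ∀ i j → ⟦ i ℤ.+ j ⟧ᵘ ≈ ⟦ i ⟧ᵘ + ⟦ j ⟧ᵘ
    +-homoᵘ (+ m)    (+ n)    = ×-homo-+ 1# m n
    +-homoᵘ (+ m)    -[1+ n ] = ⊖-homo m (suc n)
    +-homoᵘ -[1+ m ] (+ n)    = trans (⊖-homo n (suc m)) (+-comm _ _)
    +-homoᵘ -[1+ m ] -[1+ n ] = begin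
      - (suc (suc (m ℕ.+ n)) ⨯ 1#)         ≈⟨ -‿cong (+-congˡ (sym (×-homo-+ 1# (suc m) n))) ⟨
      - (1# + (suc m ⨯ 1# + n ⨯ 1#))       ≈⟨ -‿cong (+-congˡ (+-comm _ _)) ⟩
      - (1# + (n ⨯ 1# + suc m ⨯ 1#))       ≈⟨ -‿cong (+-assoc _ _ _) ⟨
      - (suc n ⨯ 1# + suc m ⨯ 1#)          ≈⟨ -‿+-comm _ _ ⟨
      - (suc n ⨯ 1#) + - (suc m ⨯ 1#)      ≈⟨ +-comm _ _ ⟩
      - (suc m ⨯ 1#) + - (suc n ⨯ 1#)      ∎

    *-homoᵘ : ∀ i j → ⟦ i ℤ.* j ⟧ᵘ ≈ ⟦ i ⟧ᵘ * ⟦ j ⟧ᵘ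
    *-homoᵘ (+ m) (+ n) rewrite ≡.sym (ℤₚ.pos-* m n) = ×1-homo-* m n
    *-homoᵘ (+ m) -[1+ n ]
      rewrite ≡.sym (ℤₚ.neg-distribʳ-* (+ m) (+ suc n)) | ≡.sym (ℤₚ.pos-* m (suc n)) =
      trans (neg-homo (+ (m ℕ.* suc n))) (trans (-‿cong (×1-homo-* m (suc n))) (-‿distribʳ-* _ _))
    *-homoᵘ -[1+ m ] (+ n)
      rewrite ≡.sym (ℤₚ.neg-distribˡ-* (+ suc m) (+ n)) | ≡.sym (ℤₚ.pos-* (suc m) n) =
      trans (neg-homo (+ (suc m ℕ.* n))) (trans (-‿cong (×1-homo-* (suc m) n)) (-‿distribˡ-* _ _))
    *-homoᵘ -[1+ m ] -[1+ n ] = begin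
      (suc m ℕ.* suc n) ⨯ 1#              ≈⟨ ×1-homo-* (suc m) (suc n) ⟩
      suc m ⨯ 1# * suc n ⨯ 1#             ≈⟨ -‿involutive _ ⟨
      - - (suc m ⨯ 1# * suc n ⨯ 1#)       ≈⟨ -‿cong (-‿distribʳ-* _ _) ⟩
      - (suc m ⨯ 1# * - (suc n ⨯ 1#))     ≈⟨ -‿distribˡ-* _ _ ⟩
      - (suc m ⨯ 1#) * - (suc n ⨯ 1#)     ∎

    morphism : ℤ.+-*-rawRing -Raw-AlmostCommutative⟶ fromCommutativeRing R
    morphism = record
      { ⟦_⟧    = ⟦_⟧
      ; +-homo = λ i j → trans (conv (i ℤ.+ j)) (trans (+-homoᵘ i j) (sym (+-cong (conv i) (conv j))))
      ; *-homo = λ i j → trans (conv (i ℤ.* j)) (trans (*-homoᵘ i j) (sym (*-cong (conv i) (conv j))))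
      ; -‿homo = λ i → trans (conv (ℤ.- i)) (trans (neg-homo i) (sym (-‿cong (conv i))))
      ; 0-homo = refl
      ; 1-homo = refl
      }

    _coeff≟_ : ∀ i j → Maybe (⟦ i ⟧ ≈ ⟦ j ⟧)
    i coeff≟ j with i ℤₚ.≟ j
    ... | yes ≡.refl = just refl
    ... | no _       = nothing

  open import Algebra.Solver.Ring ℤ.+-*-rawRing (fromCommutativeRing R) morphism _coeff≟_ public
    using (Polynomial; op; [+]; [*]; var; con; _:+_; _:*_; _:-_; :-_; _:^_; _:×_; _:=_; solve)
    renaming (⟦_⟧ to ⟦_⟧ₚ)


-- Open is large because openness in a product or a subspace quantifies over
-- subsets.
record Topology (S : Setoid 0ℓ 0ℓ) : Set₂ where
  open Setoid S
  field
    Open         : Pred Carrier 0ℓ → Set₁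
    open-resp-≈  : ∀ {U} → Open U → U Respects _≈_
    open-resp-≐  : ∀ {U V} → U ≐ V → Open U → Open V
    open-⊤       : Open (λ _ → ⊤)
    open-∩       : ∀ {U V} → Open U → Open V → Open (U ∩ V)
    open-⋃       : (I : Set) (U : I → Pred Carrier 0ℓ) →
                   (∀ i → Open (U i)) → Open (⋃ I U)

open Topology using (Open)

Continuous : ∀ {S T} → Topology S → Topology T →
             (Setoid.Carrier S → Setoid.Carrier T) → Set₁
Continuous σ τ f = ∀ {V} → Open τ V → Open σ (V ∘ f)

subsetoid : (S : Setoid 0ℓ 0ℓ) → Pred (Setoid.Carrier S) 0ℓ → Setoid 0ℓ 0ℓ
subsetoid S P = On.setoid S (proj₁ {B = P})

subspaceTopology : (S : Setoid 0ℓ 0ℓ) → Topology S → (P : Pred (Setoid.Carrier S) 0ℓ) →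
                   Topology (subsetoid S P)
subspaceTopology S τ P = record
  { Open        = λ U → Σ[ V ∈ Pred (Setoid.Carrier S) 0ℓ ]
                        (Open τ V × ∀ p → U p ⇔ V (proj₁ p))
  ; open-resp-≈ = λ (V , oV , e) {p} {q} p≈q u →
      from (e q) (T.open-resp-≈ oV p≈q (to (e p) u))
  ; open-resp-≐ = λ (f , g) (V , oV , e) →
      V , oV , λ p → mk⇔ (to (e p) ∘ g) (f ∘ from (e p))
  ; open-⊤      = (λ _ → ⊤) , T.open-⊤ , λ _ → mk⇔ _ _
  ; open-∩      = λ (V , oV , e) (V′ , oV′ , e′) → V ∩ V′ , T.open-∩ oV oV′ , λ p →
      mk⇔ (λ (u , u′) → to (e p) u , to (e′ p) u′)
          (λ (v , v′) → from (e p) v , from (e′ p) v′)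
  ; open-⋃      = λ I U o → ⋃ I (λ i → proj₁ (o i)) ,
      T.open-⋃ I (λ i → proj₁ (o i)) (λ i → proj₁ (proj₂ (o i))) , λ p →
      mk⇔ (λ (i , u) → i , to (proj₂ (proj₂ (o i)) p) u)
          (λ (i , v) → i , from (proj₂ (proj₂ (o i)) p) v)
  }
  where
  module T = Topology τ
  open Equivalence using (to; from)

record Congruence (S : Setoid 0ℓ 0ℓ) : Set₁ where
  open Setoid S using (Carrier; _≈_)
  field
    _∼_           : Rel Carrier 0ℓ
    isEquivalence : IsEquivalence _∼_
    ≈⇒∼           : _≈_ ⇒ _∼_

quotientSetoid : (S : Setoid 0ℓ 0ℓ) → Congruence S → Setoid 0ℓ 0ℓ
quotientSetoid S C = record { isEquivalence = Congruence.isEquivalence C }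

-- A subset of the quotient is a saturated subset of S; its preimage under the
-- projection is that same subset.
quotientTopology : ∀ {S} → Topology S → (C : Congruence S) →
                   Topology (quotientSetoid S C)
quotientTopology τ C = record
  { Open        = λ U → (U Respects _∼_) × Open τ U
  ; open-resp-≈ = proj₁
  ; open-resp-≐ = λ (f , g) (r , o) →
      (λ x∼y v → f (r x∼y (g v))) , T.open-resp-≐ (f , g) o
  ; open-⊤      = _ , T.open-⊤
  ; open-∩      = λ (r , o) (r′ , o′) →
      (λ x∼y (u , u′) → r x∼y u , r′ x∼y u′) , T.open-∩ o o′
  ; open-⋃      = λ I U o →
      (λ x∼y (i , u) → i , proj₁ (o i) x∼y u) , T.open-⋃ I U (proj₂ ∘ o)
  }
  where
  module T = Topology τ
  open Congruence C

productTopology : ∀ {S T} → Topology S → Topology T → Topology (×-setoid S T)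
productTopology {S} {T} σ τ = record
  { Open        = λ W → ∀ {x y} → W (x , y) →
      Σ[ U ∈ Pred (Setoid.Carrier S) 0ℓ ] Σ[ V ∈ Pred (Setoid.Carrier T) 0ℓ ]
      (Open σ U × Open τ V × U x × V y × (∀ {x′ y′} → U x′ → V y′ → W (x′ , y′)))
  ; open-resp-≈ = λ o (x≈ , y≈) w → case (o w) x≈ y≈
  ; open-resp-≐ = λ (f , g) o w → let (U , V , oU , oV , u , v , i) = o (g w) in
      U , V , oU , oV , u , v , λ u′ v′ → f (i u′ v′)
  ; open-⊤      = λ _ → _ , _ , S.open-⊤ , T.open-⊤ , _
  ; open-∩      = λ o o′ (w , w′) →
      let (U  , V  , oU  , oV  , u  , v  , i ) = o w
          (U′ , V′ , oU′ , oV′ , u′ , v′ , i′) = o′ w′ in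
      U ∩ U′ , V ∩ V′ , S.open-∩ oU oU′ , T.open-∩ oV oV′ , (u , u′) , (v , v′) ,
      λ (a , a′) (b , b′) → i a b , i′ a′ b′
  ; open-⋃      = λ I W o (j , w) → let (U , V , oU , oV , u , v , i) = o j w in
      U , V , oU , oV , u , v , λ a b → j , i a b
  }
  where
  module S = Topology σ
  module T = Topology τ
  case : ∀ {W : Pred _ 0ℓ} {x y x′ y′} →
    (Σ[ U ∈ Pred (Setoid.Carrier S) 0ℓ ] Σ[ V ∈ Pred (Setoid.Carrier T) 0ℓ ]
      (Open σ U × Open τ V × U x × V y × (∀ {x′ y′} → U x′ → V y′ → W (x′ , y′)))) →
    Setoid._≈_ S x x′ → Setoid._≈_ T y y′ → W (x′ , y′)
  case (U , V , oU , oV , u , v , i) x≈ y≈ =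
    i (S.open-resp-≈ oU x≈ u) (T.open-resp-≈ oV y≈ v)

powerSetoid : Setoid 0ℓ 0ℓ → ℕ → Setoid 0ℓ 0ℓ
powerSetoid S n = VecEq.≋-setoid S n

powerTopology : ∀ {S} → Topology S → (n : ℕ) → Topology (powerSetoid S n)
powerTopology {S} τ n = record
  { Open        = λ W → ∀ {x} → W x →
      Σ[ U ∈ (Fin n → Pred (Setoid.Carrier S) 0ℓ) ]
      ((∀ i → Open τ (U i)) × (∀ i → U i (x i)) × (∀ {y} → (∀ i → U i (y i)) → W y))
  ; open-resp-≈ = λ o x≈ w → let (U , oU , u , sub) = o w in
      sub (λ i → T.open-resp-≈ (oU i) (x≈ i) (u i))
  ; open-resp-≐ = λ (f , g) o w → let (U , oU , u , sub) = o (g w) in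
      U , oU , u , λ u′ → f (sub u′)
  ; open-⊤      = λ _ → (λ _ _ → ⊤) , (λ _ → T.open-⊤) , _
  ; open-∩      = λ o o′ (w , w′) →
      let (U  , oU  , u  , sub ) = o w
          (U′ , oU′ , u′ , sub′) = o′ w′ in
      (λ i → U i ∩ U′ i) , (λ i → T.open-∩ (oU i) (oU′ i)) , (λ i → u i , u′ i) ,
      λ a → sub (proj₁ ∘ a) , sub′ (proj₂ ∘ a)
  ; open-⋃      = λ I W o (j , w) → let (U , oU , u , sub) = o j w in
      U , oU , u , λ a → j , sub a
  }
  where module T = Topology τ

symmetricCongruence : (S : Setoid 0ℓ 0ℓ) (n : ℕ) → Congruence (powerSetoid S n)
symmetricCongruence S n = record
  { _∼_           = λ x y → ∃ λ (π : Perm.Permutation′ n) → ∀ i → x i ≈ y (π Perm.⟨$⟩ʳ i)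
  ; isEquivalence = record
    { refl  = Perm.id , λ _ → refl
    ; sym   = λ {x} {y} (π , e) → Perm.flip π , λ i →
        trans (reflexive (≡.cong y (≡.sym (Perm.inverseʳ π)))) (sym (e (π Perm.⟨$⟩ˡ i)))
    ; trans = λ (π , e) (ρ , e′) → π Perm.∘ₚ ρ , λ i → trans (e i) (e′ (π Perm.⟨$⟩ʳ i))
    }
  ; ≈⇒∼           = λ e → Perm.id , e
  }
  where open Setoid S

SP-setoid : ℕ → Setoid 0ℓ 0ℓ → Setoid 0ℓ 0ℓ
SP-setoid n S = quotientSetoid (powerSetoid S n) (symmetricCongruence S n)

SP-topology : ∀ n S → Topology S → Topology (SP-setoid n S)
SP-topology n S τ = quotientTopology (powerTopology τ n) (symmetricCongruence S n)


record Action (G : Group 0ℓ 0ℓ) (S : Setoid 0ℓ 0ℓ) : Set where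
  private
    module G = Group G
  open Setoid S
  infixr 7 _·_
  field
    _·_        : G.Carrier → Carrier → Carrier
    ·-cong     : ∀ {g h x y} → g G.≈ h → x ≈ y → g · x ≈ h · y
    ·-identity : ∀ x → G.ε · x ≈ x
    ·-assoc    : ∀ g h x → (g G.∙ h) · x ≈ g · h · x

record GSpace (G : Group 0ℓ 0ℓ) : Set₂ where
  field
    setoid   : Setoid 0ℓ 0ℓ
    topology : Topology setoid
    action   : Action G setoid
  open Setoid setoid public
  open Action action public

infix 4 _≅_
record _≅_ {G : Group 0ℓ 0ℓ} (X Y : GSpace G) : Set₁ where
  private
    module X = GSpace X
    module Y = GSpace Y
  field
    bijection       : Inverse X.setoid Y.setoid
  open Inverse bijection public using (to; from)
  field
    to-continuous   : Continuous X.topology Y.topology to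
    from-continuous : Continuous Y.topology X.topology from
    to-equivariant  : ∀ g x → to (g X.· x) Y.≈ g Y.· to x


record Field : Set₁ where
  field
    commutativeRing : CommutativeRing 0ℓ 0ℓ
  open CommutativeRing commutativeRing public
  field
    1≉0     : 1# ≉ 0#
    inverse : ∀ x → x ≉ 0# → ∃ λ y → x * y ≈ 1#

  inv : ∀ x → x ≉ 0# → Carrier
  inv x x≉0 = proj₁ (inverse x x≉0)

  *-invʳ : ∀ x (x≉0 : x ≉ 0#) → x * inv x x≉0 ≈ 1#
  *-invʳ x x≉0 = proj₂ (inverse x x≉0)

module FieldProperties (F : Field) where
  open Field F
  open IntegerSolver commutativeRing
  open import Relation.Binary.Reasoning.Setoid setoid

  *-cancelˡ : ∀ {x y z} → x ≉ 0# → x * y ≈ x * z → y ≈ z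
  *-cancelˡ {x} {y} {z} x≉0 e = begin
    y                      ≈⟨ *-identityˡ y ⟨
    1# * y                 ≈⟨ *-congʳ (*-invʳ x x≉0) ⟨
    x * inv x x≉0 * y      ≈⟨ shuffle x (inv x x≉0) y ⟩
    inv x x≉0 * (x * y)    ≈⟨ *-congˡ e ⟩
    inv x x≉0 * (x * z)    ≈⟨ shuffle x (inv x x≉0) z ⟨
    x * inv x x≉0 * z      ≈⟨ *-congʳ (*-invʳ x x≉0) ⟩
    1# * z                 ≈⟨ *-identityˡ z ⟩
    z                      ∎
    where
    shuffle : ∀ a b c → a * b * c ≈ b * (a * c)
    shuffle = solve 3 (λ a b c → a :* b :* c := b :* (a :* c)) refl

  *-nonzero : ∀ {x y} → x ≉ 0# → y ≉ 0# → x * y ≉ 0#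
  *-nonzero x≉0 y≉0 xy≈0 = y≉0 (*-cancelˡ x≉0 (trans xy≈0 (sym (zeroʳ _))))

  unit-nonzero : ∀ {x y} → x * y ≈ 1# → x ≉ 0#
  unit-nonzero xy≈1 x≈0 = 1≉0 (trans (sym xy≈1) (trans (*-congʳ x≈0) (zeroˡ _)))

  inv-unique : ∀ {x y} (x≉0 : x ≉ 0#) → x * y ≈ 1# → y ≈ inv x x≉0
  inv-unique {x} x≉0 e = *-cancelˡ x≉0 (trans e (sym (*-invʳ x x≉0)))

record SL₂ (F : Field) : Set where
  open Field F
  field
    a b c d : Carrier
    det≈1   : a * d - b * c ≈ 1#

module _ (F : Field) where
  open Field F
  open FieldProperties F
  open IntegerSolver commutativeRing
  open import Data.Integer.Base using (+_)
  open import Relation.Binary.Reasoning.Setoid setoid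

  IsSign : Pred Carrier 0ℓ
  IsSign u = u ≈ 1# ⊎ u ≈ - 1#

  private
    sign² : ∀ {u} → IsSign u → u * u ≈ 1#
    sign² (inj₁ e) = trans (*-cong e e) (*-identityˡ 1#)
    sign² (inj₂ e) = trans (*-cong e e)
      (solve 0 ((:- con (+ 1)) :* (:- con (+ 1)) := con (+ 1)) refl)

    sign-* : ∀ {u v} → IsSign u → IsSign v → IsSign (u * v)
    sign-* (inj₁ e) (inj₁ f) = inj₁ (trans (*-cong e f) (*-identityˡ _))
    sign-* (inj₁ e) (inj₂ f) = inj₂ (trans (*-cong e f) (*-identityˡ _))
    sign-* (inj₂ e) (inj₁ f) = inj₂ (trans (*-cong e f) (*-identityʳ _))
    sign-* (inj₂ e) (inj₂ f) = inj₁ (trans (*-cong e f) (sign² (inj₂ refl)))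

  sign-nonzero : ∀ {u} → IsSign u → u ≉ 0#
  sign-nonzero s = unit-nonzero (sign² s)

  infix 4 _≈±_
  record _≈±_ (M N : SL₂ F) : Set where
    private
      module M = SL₂ M
      module N = SL₂ N
    field
      u      : Carrier
      isSign : IsSign u
      a≈     : M.a ≈ u * N.a
      b≈     : M.b ≈ u * N.b
      c≈     : M.c ≈ u * N.c
      d≈     : M.d ≈ u * N.d

  -- Opaque, so that comparing matrices never unfolds these proofs.
  opaque
    det-* : ∀ {a b c d a′ b′ c′ d′} → a * d - b * c ≈ 1# → a′ * d′ - b′ * c′ ≈ 1# →
      (a * a′ + b * c′) * (c * b′ + d * d′) - (a * b′ + b * d′) * (c * a′ + d * c′) ≈ 1#
    det-* {a} {b} {c} {d} {a′} {b′} {c′} {d′} e e′ = trans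
      (solve 8 (λ a b c d a′ b′ c′ d′ →
        (a :* a′ :+ b :* c′) :* (c :* b′ :+ d :* d′) :- (a :* b′ :+ b :* d′) :* (c :* a′ :+ d :* c′)
        := (a :* d :- b :* c) :* (a′ :* d′ :- b′ :* c′)) refl a b c d a′ b′ c′ d′)
      (trans (*-cong e e′) (*-identityˡ 1#))

    det-I : 1# * 1# - 0# * 0# ≈ 1#
    det-I = solve 0 (con (+ 1) :* con (+ 1) :- con (+ 0) :* con (+ 0) := con (+ 1)) refl

    det-⁻¹ : ∀ {a b c d} → a * d - b * c ≈ 1# → d * a - (- b) * (- c) ≈ 1#
    det-⁻¹ {a} {b} {c} {d} e = trans
      (solve 4 (λ a b c d → d :* a :- (:- b) :* (:- c) := a :* d :- b :* c) refl a b c d) e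

  infixl 7 _*₂_
  _*₂_ : SL₂ F → SL₂ F → SL₂ F
  M *₂ N = record
    { a = M.a * N.a + M.b * N.c
    ; b = M.a * N.b + M.b * N.d
    ; c = M.c * N.a + M.d * N.c
    ; d = M.c * N.b + M.d * N.d
    ; det≈1 = det-* M.det≈1 N.det≈1
    }
    where
    module M = SL₂ M
    module N = SL₂ N

  I₂ : SL₂ F
  I₂ = record { a = 1# ; b = 0# ; c = 0# ; d = 1# ; det≈1 = det-I }

  infix 8 _⁻¹₂
  _⁻¹₂ : SL₂ F → SL₂ F
  M ⁻¹₂ = record { a = d ; b = - b ; c = - c ; d = a ; det≈1 = det-⁻¹ det≈1 }
    where open SL₂ M

  private
    entrywise : ∀ {M N : SL₂ F} →
      SL₂.a M ≈ SL₂.a N → SL₂.b M ≈ SL₂.b N → SL₂.c M ≈ SL₂.c N → SL₂.d M ≈ SL₂.d N → M ≈± N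
    entrywise a≈ b≈ c≈ d≈ = record
      { u = 1# ; isSign = inj₁ refl
      ; a≈ = 1* a≈ ; b≈ = 1* b≈ ; c≈ = 1* c≈ ; d≈ = 1* d≈ }
      where
      1* : ∀ {x y} → x ≈ y → x ≈ 1# * y
      1* e = trans e (sym (*-identityˡ _))

    sum2 : ∀ u v p q r s {x y z w} →
      x ≈ u * p → y ≈ v * q → z ≈ u * r → w ≈ v * s →
      x * y + z * w ≈ (u * v) * (p * q + r * s)
    sum2 u v p q r s ex ey ez ew = trans (+-cong (*-cong ex ey) (*-cong ez ew))
      (solve 6 (λ u v p q r s → (u :* p) :* (v :* q) :+ (u :* r) :* (v :* s)
                 := (u :* v) :* (p :* q :+ r :* s)) refl u v p q r s)

    det-inverse : ∀ (M : SL₂ F) → let open SL₂ M in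
      (a * d + b * - c ≈ 1#) × (a * - b + b * a ≈ 0#) × (c * d + d * - c ≈ 0#) × (c * - b + d * a ≈ 1#)
    det-inverse M =
        trans (solve 4 (λ a b c d → a :* d :+ b :* :- c := a :* d :- b :* c) refl a b c d) det≈1
      , solve 2 (λ a b → a :* :- b :+ b :* a := con (+ 0)) refl a b
      , solve 2 (λ c d → c :* d :+ d :* :- c := con (+ 0)) refl c d
      , trans (solve 4 (λ a b c d → c :* :- b :+ d :* a := a :* d :- b :* c) refl a b c d) det≈1
      where open SL₂ M

    inverseʳ-± : ∀ M → M *₂ M ⁻¹₂ ≈± I₂
    inverseʳ-± M = let (p , q , r , s) = det-inverse M in entrywise p q r s

    inverseˡ-± : ∀ M → M ⁻¹₂ *₂ M ≈± I₂
    inverseˡ-± M = let (p , q , r , s) = det-inverse (M ⁻¹₂) in entrywise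
      (trans (+-congˡ (*-congˡ (sym (dbl (SL₂.c M))))) p)
      (swap (SL₂.b M) (SL₂.d M))
      (swap′ (SL₂.a M) (SL₂.c M))
      (trans (+-congʳ (*-congˡ (sym (dbl (SL₂.b M))))) s)
      where
      dbl : ∀ x → - - x ≈ x
      dbl = solve 1 (λ x → :- :- x := x) refl
      swap : ∀ b d → d * b + (- b) * d ≈ 0#
      swap = solve 2 (λ b d → d :* b :+ (:- b) :* d := con (+ 0)) refl
      swap′ : ∀ a c → (- c) * a + a * c ≈ 0#
      swap′ = solve 2 (λ a c → (:- c) :* a :+ a :* c := con (+ 0)) refl

    neg-scale : ∀ {x u y} → x ≈ u * y → - x ≈ u * - y
    neg-scale {x} {u} {y} e =
      trans (-‿cong e) (solve 2 (λ u y → :- (u :* y) := u :* :- y) refl u y)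

    assoc₂ : ∀ a b a′ b′ c′ d′ a″ c″ →
      (a * a′ + b * c′) * a″ + (a * b′ + b * d′) * c″ ≈
      a * (a′ * a″ + b′ * c″) + b * (c′ * a″ + d′ * c″)
    assoc₂ = solve 8 (λ a b a′ b′ c′ d′ a″ c″ →
      (a :* a′ :+ b :* c′) :* a″ :+ (a :* b′ :+ b :* d′) :* c″ :=
      a :* (a′ :* a″ :+ b′ :* c″) :+ b :* (c′ :* a″ :+ d′ :* c″)) refl

    1x+0y : ∀ x y → 1# * x + 0# * y ≈ x
    1x+0y = solve 2 (λ x y → con (+ 1) :* x :+ con (+ 0) :* y := x) refl
    0x+1y : ∀ x y → 0# * x + 1# * y ≈ y
    0x+1y = solve 2 (λ x y → con (+ 0) :* x :+ con (+ 1) :* y := y) refl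
    x1+y0 : ∀ x y → x * 1# + y * 0# ≈ x
    x1+y0 = solve 2 (λ x y → x :* con (+ 1) :+ y :* con (+ 0) := x) refl
    x0+y1 : ∀ x y → x * 0# + y * 1# ≈ y
    x0+y1 = solve 2 (λ x y → x :* con (+ 0) :+ y :* con (+ 1) := y) refl

  -- The setoid equality is equality up to sign, so this is SL₂(F)/{±I}.
  PSL₂ : Group 0ℓ 0ℓ
  PSL₂ = record
    { Carrier = SL₂ F
    ; _≈_     = _≈±_
    ; _∙_     = _*₂_
    ; ε       = I₂
    ; _⁻¹     = _⁻¹₂
    ; isGroup = record
      { isMonoid = record
        { isSemigroup = record
          { isMagma = record
            { isEquivalence = record
              { refl  = entrywise refl refl refl refl
              ; sym   = λ e → let open _≈±_ e in record
                { u = u ; isSign = isSign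
                ; a≈ = flip isSign a≈ ; b≈ = flip isSign b≈
                ; c≈ = flip isSign c≈ ; d≈ = flip isSign d≈ }
              ; trans = λ e f →
                let module E = _≈±_ e
                    module G = _≈±_ f
                in record
                { u = E.u * G.u ; isSign = sign-* E.isSign G.isSign
                ; a≈ = chain E.a≈ G.a≈ ; b≈ = chain E.b≈ G.b≈
                ; c≈ = chain E.c≈ G.c≈ ; d≈ = chain E.d≈ G.d≈ }
              }
            ; ∙-cong = λ e f →
              let module E = _≈±_ e
                  module G = _≈±_ f
              in record
              { u = E.u * G.u ; isSign = sign-* E.isSign G.isSign
              ; a≈ = sum2 _ _ _ _ _ _ E.a≈ G.a≈ E.b≈ G.c≈
              ; b≈ = sum2 _ _ _ _ _ _ E.a≈ G.b≈ E.b≈ G.d≈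
              ; c≈ = sum2 _ _ _ _ _ _ E.c≈ G.a≈ E.d≈ G.c≈
              ; d≈ = sum2 _ _ _ _ _ _ E.c≈ G.b≈ E.d≈ G.d≈ }
            }
          ; assoc = λ M N P →
              let module M = SL₂ M
                  module N = SL₂ N
                  module P = SL₂ P
              in
              entrywise (assoc₂ M.a M.b N.a N.b N.c N.d P.a P.c)
                        (assoc₂ M.a M.b N.a N.b N.c N.d P.b P.d)
                        (assoc₂ M.c M.d N.a N.b N.c N.d P.a P.c)
                        (assoc₂ M.c M.d N.a N.b N.c N.d P.b P.d)
          }
        ; identity = (λ M → let open SL₂ M in
                       entrywise (1x+0y a c) (1x+0y b d) (0x+1y a c) (0x+1y b d))
                   , (λ M → let open SL₂ M in
                       entrywise (x1+y0 a b) (x0+y1 a b) (x1+y0 c d) (x0+y1 c d))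
        }
      ; inverse = inverseˡ-± , inverseʳ-±
      ; ⁻¹-cong = λ e → let open _≈±_ e in record
          { u = u ; isSign = isSign
          ; a≈ = d≈ ; b≈ = neg-scale b≈ ; c≈ = neg-scale c≈ ; d≈ = a≈ }
      }
    }
    where
    flip : ∀ {u x y} → IsSign u → x ≈ u * y → y ≈ u * x
    flip {u} {x} {y} s e = begin
      y            ≈⟨ *-identityˡ y ⟨
      1# * y       ≈⟨ *-congʳ (sign² s) ⟨
      u * u * y    ≈⟨ *-assoc u u y ⟩
      u * (u * y)  ≈⟨ *-congˡ e ⟨
      u * x        ∎
    chain : ∀ {u v x y z} → x ≈ u * y → y ≈ v * z → x ≈ (u * v) * z
    chain e f = trans e (trans (*-congˡ f) (sym (*-assoc _ _ _)))

  module _ (n : ℕ) where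

    NonzeroVector : Pred (Vector Carrier (suc n)) 0ℓ
    NonzeroVector v = ¬ (∀ i → v i ≈ 0#)

    nonzeroSetoid : Setoid 0ℓ 0ℓ
    nonzeroSetoid = subsetoid (powerSetoid setoid (suc n)) NonzeroVector

    scaling : Congruence nonzeroSetoid
    scaling = record
      { _∼_           = λ v w → ∃ λ t → t ≉ 0# × ∀ i → proj₁ v i ≈ t * proj₁ w i
      ; isEquivalence = record
        { refl  = 1# , 1≉0 , λ _ → sym (*-identityˡ _)
        ; sym   = λ {v} {w} (t , t≉0 , e) → inv t t≉0 ,
            unit-nonzero (trans (*-comm _ _) (*-invʳ t t≉0)) , λ i → *-cancelˡ t≉0 (begin
              t * proj₁ w i                ≈⟨ e i ⟨
              proj₁ v i                    ≈⟨ *-identityˡ _ ⟨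
              1# * proj₁ v i               ≈⟨ *-congʳ (*-invʳ t t≉0) ⟨
              t * inv t t≉0 * proj₁ v i    ≈⟨ *-assoc _ _ _ ⟩
              t * (inv t t≉0 * proj₁ v i)  ∎)
        ; trans = λ (t , t≉0 , e) (s , s≉0 , f) → t * s , *-nonzero t≉0 s≉0 ,
            λ i → trans (e i) (trans (*-congˡ (f i)) (sym (*-assoc _ _ _)))
        }
      ; ≈⇒∼           = λ e → 1# , 1≉0 , λ i → trans (e i) (sym (*-identityˡ _))
      }

    ℙ : Setoid 0ℓ 0ℓ
    ℙ = quotientSetoid nonzeroSetoid scaling

    ℙ-topology : Topology setoid → Topology ℙ
    ℙ-topology τ =
      quotientTopology
        (subspaceTopology (powerSetoid setoid (suc n)) (powerTopology τ (suc n)) NonzeroVector)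
        scaling

  ℙ¹ : Set
  ℙ¹ = Setoid.Carrier (ℙ 1)

  affine : Carrier → ℙ¹
  affine z = (z ∷ 1# ∷ []) , λ e → 1≉0 (e 1F)

  private
    recover₀ : ∀ a b c d x y → d * (a * x + b * y) - b * (c * x + d * y) ≈ (a * d - b * c) * x
    recover₀ = solve 6 (λ a b c d x y →
      d :* (a :* x :+ b :* y) :- b :* (c :* x :+ d :* y) := (a :* d :- b :* c) :* x) refl
    recover₁ : ∀ a b c d x y → a * (c * x + d * y) - c * (a * x + b * y) ≈ (a * d - b * c) * y
    recover₁ = solve 6 (λ a b c d x y →
      a :* (c :* x :+ d :* y) :- c :* (a :* x :+ b :* y) := (a :* d :- b :* c) :* y) refl

    combination-zero : ∀ {p q x y} → x ≈ 0# → y ≈ 0# → p * x - q * y ≈ 0#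
    combination-zero {p} {q} ex ey = trans (+-cong (*-congˡ ex) (-‿cong (*-congˡ ey)))
      (solve 2 (λ p q → p :* con (+ 0) :- q :* con (+ 0) := con (+ 0)) refl p q)

  linear-injective : ∀ (M : SL₂ F) {x y} → let open SL₂ M in
    a * x + b * y ≈ 0# → c * x + d * y ≈ 0# → (x ≈ 0#) × (y ≈ 0#)
  linear-injective M {x} {y} e f =
      trans (1* x) (trans (sym (recover₀ a b c d x y)) (combination-zero e f))
    , trans (1* y) (trans (sym (recover₁ a b c d x y)) (combination-zero f e))
    where
    open SL₂ M
    1* : ∀ z → z ≈ (a * d - b * c) * z
    1* z = sym (trans (*-congʳ det≈1) (*-identityˡ z))

  möbius : SL₂ F → ℙ¹ → ℙ¹
  möbius M (v , v≉0) = (a * v 0F + b * v 1F ∷ c * v 0F + d * v 1F ∷ []) , λ e →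
    let (x≈0 , y≈0) = linear-injective M (e 0F) (e 1F) in
    v≉0 λ { 0F → x≈0 ; 1F → y≈0 }
    where open SL₂ M

  möbius-action : Action PSL₂ (ℙ 1)
  möbius-action = record
    { _·_        = möbius
    ; ·-cong     = λ e (t , t≉0 , f) → let open _≈±_ e in
        u * t , *-nonzero (sign-nonzero isSign) t≉0 ,
        λ { 0F → sum2 _ _ _ _ _ _ a≈ (f 0F) b≈ (f 1F)
          ; 1F → sum2 _ _ _ _ _ _ c≈ (f 0F) d≈ (f 1F) }
    ; ·-identity = λ (v , _) → 1# , 1≉0 ,
        λ { 0F → trans (1x+0y (v 0F) (v 1F)) (sym (*-identityˡ _))
          ; 1F → trans (0x+1y (v 0F) (v 1F)) (sym (*-identityˡ _)) }
    ; ·-assoc    = λ M N (v , _) →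
        let module M = SL₂ M
            module N = SL₂ N
        in 1# , 1≉0 ,
        λ { 0F → trans (assoc₂ M.a M.b N.a N.b N.c N.d (v 0F) (v 1F)) (sym (*-identityˡ _))
          ; 1F → trans (assoc₂ M.c M.d N.a N.b N.c N.d (v 0F) (v 1F)) (sym (*-identityˡ _)) }
    }

  numerator denominator : SL₂ F → Carrier → Carrier
  numerator   M z = SL₂.a M * z + SL₂.b M
  denominator M z = SL₂.c M * z + SL₂.d M

  fractional : (M : SL₂ F) (z : Carrier) → denominator M z ≉ 0# → Carrier
  fractional M z nz = numerator M z * inv (denominator M z) nz

  derivative : (M : SL₂ F) (z : Carrier) → denominator M z ≉ 0# → Carrier
  derivative M z nz = inv (denominator M z) nz * inv (denominator M z) nz

  denominator*fractional : ∀ M z nz → denominator M z * fractional M z nz ≈ numerator M z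
  denominator*fractional M z nz = begin
    λz * (n * i)  ≈⟨ solve 3 (λ l n i → l :* (n :* i) := (l :* i) :* n) refl λz n i ⟩
    (λz * i) * n  ≈⟨ *-congʳ (*-invʳ λz nz) ⟩
    1# * n        ≈⟨ *-identityˡ n ⟩
    n             ∎
    where
    λz n i : Carrier
    λz = denominator M z
    n  = numerator M z
    i  = inv λz nz

  affine-möbius : ∀ M {z w} → denominator M z ≉ 0# → denominator M z * w ≈ numerator M z →
                  Setoid._≈_ (ℙ 1) (möbius M (affine z)) (affine w)
  affine-möbius M {z} nz e = denominator M z , nz ,
    λ { 0F → trans (+-congˡ (*-identityʳ _)) (sym e)
      ; 1F → trans (+-congˡ (*-identityʳ _)) (sym (*-identityʳ _)) }

  module _ {M N : SL₂ F} {z w} (M≈N : M ≈± N) (z≈w : z ≈ w) where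
    open _≈±_ M≈N
    private
      module M = SL₂ M
      module N = SL₂ N

      linear-scale : ∀ {p q p′ q′} → p ≈ u * p′ → q ≈ u * q′ → p * z + q ≈ u * (p′ * w + q′)
      linear-scale {p′ = p′} {q′} ep eq = trans (+-cong (*-cong ep z≈w) eq)
        (solve 4 (λ u p q w → (u :* p) :* w :+ u :* q := u :* (p :* w :+ q)) refl u p′ q′ w)

      inv-scale : ∀ nz nz′ → inv (denominator M z) nz ≈ u * inv (denominator N w) nz′
      inv-scale nz nz′ = sym (inv-unique nz (begin
        denominator M z * (u * i)         ≈⟨ *-congʳ (linear-scale c≈ d≈) ⟩
        (u * denominator N w) * (u * i)   ≈⟨ solve 3 (λ u l i → (u :* l) :* (u :* i) := (u :* u) :* (l :* i))
                                               refl u (denominator N w) i ⟩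
        (u * u) * (denominator N w * i)   ≈⟨ *-cong (sign² isSign) (*-invʳ _ nz′) ⟩
        1# * 1#                           ≈⟨ *-identityˡ 1# ⟩
        1#                                ∎))
        where
        i : Carrier
        i = inv (denominator N w) nz′

      unsign : ∀ {x y x′ y′} → x ≈ u * x′ → y ≈ u * y′ → x * y ≈ x′ * y′
      unsign {x′ = x′} {y′} ex ey = trans (*-cong ex ey) (trans
        (solve 3 (λ u x y → (u :* x) :* (u :* y) := (u :* u) :* (x :* y)) refl u x′ y′)
        (trans (*-congʳ (sign² isSign)) (*-identityˡ _)))

    fractional-cong : ∀ nz nz′ → fractional M z nz ≈ fractional N w nz′
    fractional-cong nz nz′ = unsign (linear-scale a≈ b≈) (inv-scale nz nz′)

    derivative-cong : ∀ nz nz′ → derivative M z nz ≈ derivative N w nz′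
    derivative-cong nz nz′ = unsign (inv-scale nz nz′) (inv-scale nz nz′)

  private
    inv-1 : ∀ {x} (nz : x ≉ 0#) → x ≈ 1# → inv x nz ≈ 1#
    inv-1 nz e = sym (inv-unique nz (trans (*-identityʳ _) e))

    denominator-I : ∀ z → denominator I₂ z ≈ 1#
    denominator-I = solve 1 (λ z → con (+ 0) :* z :+ con (+ 1) := con (+ 1)) refl

  fractional-I : ∀ z nz → fractional I₂ z nz ≈ z
  fractional-I z nz = trans (*-congˡ (inv-1 nz (denominator-I z)))
    (solve 1 (λ z → (con (+ 1) :* z :+ con (+ 0)) :* con (+ 1) := z) refl z)

  derivative-I : ∀ z nz → derivative I₂ z nz ≈ 1#
  derivative-I z nz = trans (*-cong i≈1 i≈1) (*-identityˡ 1#)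
    where
    i≈1 : inv (denominator I₂ z) nz ≈ 1#
    i≈1 = inv-1 nz (denominator-I z)

  module _ (M N : SL₂ F) {z} (nz : denominator N z ≉ 0#) where
    private
      module M = SL₂ M
      module N = SL₂ N
      w : Carrier
      w = fractional N z nz

      linear-∘ : ∀ p q →
        (p * N.a + q * N.c) * z + (p * N.b + q * N.d) ≈ denominator N z * (p * w + q)
      linear-∘ p q = begin
        (p * N.a + q * N.c) * z + (p * N.b + q * N.d)
          ≈⟨ solve 7 (λ p q a b c d z → (p :* a :+ q :* c) :* z :+ (p :* b :+ q :* d) :=
                       p :* (a :* z :+ b) :+ q :* (c :* z :+ d)) refl p q N.a N.b N.c N.d z ⟩
        p * numerator N z + q * denominator N z
          ≈⟨ +-congʳ (*-congˡ (denominator*fractional N z nz)) ⟨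
        p * (denominator N z * w) + q * denominator N z
          ≈⟨ solve 4 (λ p q l w → p :* (l :* w) :+ q :* l := l :* (p :* w :+ q))
               refl p q (denominator N z) w ⟩
        denominator N z * (p * w + q) ∎

      inv-∘ : ∀ nzM nzMN →
        inv (denominator (M *₂ N) z) nzMN ≈ inv (denominator M w) nzM * inv (denominator N z) nz
      inv-∘ nzM nzMN = sym (inv-unique nzMN (begin
        denominator (M *₂ N) z * (i * j)                    ≈⟨ *-congʳ (linear-∘ M.c M.d) ⟩
        (denominator N z * denominator M w) * (i * j)       ≈⟨ solve 4 (λ l m i j → (l :* m) :* (i :* j) := (m :* i) :* (l :* j))
                                                                refl (denominator N z) (denominator M w) i j ⟩
        (denominator M w * i) * (denominator N z * j)       ≈⟨ *-cong (*-invʳ _ nzM) (*-invʳ _ nz) ⟩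
        1# * 1#                                             ≈⟨ *-identityˡ 1# ⟩
        1#                                                  ∎))
        where
        i j : Carrier
        i = inv (denominator M w) nzM
        j = inv (denominator N z) nz

    fractional-∘ : ∀ nzM nzMN → fractional (M *₂ N) z nzMN ≈ fractional M w nzM
    fractional-∘ nzM nzMN = begin
      numerator (M *₂ N) z * inv (denominator (M *₂ N) z) nzMN
        ≈⟨ *-cong (linear-∘ M.a M.b) (inv-∘ nzM nzMN) ⟩
      (denominator N z * numerator M w) * (i * j)
        ≈⟨ solve 4 (λ l n i j → (l :* n) :* (i :* j) := (l :* j) :* (n :* i))
             refl (denominator N z) (numerator M w) i j ⟩
      (denominator N z * j) * (numerator M w * i)
        ≈⟨ *-congʳ (*-invʳ _ nz) ⟩
      1# * (numerator M w * i)
        ≈⟨ *-identityˡ _ ⟩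
      numerator M w * i ∎
      where
      i j : Carrier
      i = inv (denominator M w) nzM
      j = inv (denominator N z) nz

    derivative-∘ : ∀ nzM nzMN →
      derivative (M *₂ N) z nzMN ≈ derivative N z nz * derivative M w nzM
    derivative-∘ nzM nzMN = trans (*-cong (inv-∘ nzM nzMN) (inv-∘ nzM nzMN))
      (solve 2 (λ i j → (i :* j) :* (i :* j) := (j :* j) :* (i :* i)) refl
        (inv (denominator M w) nzM) (inv (denominator N z) nz))

  fractional-remainder : ∀ M z w nz nw → let h = w - z in
    (fractional M w nw - fractional M z nz) - h * derivative M z nz ≈
    - (SL₂.c M * (h * h)) * (inv (denominator M w) nw * derivative M z nz)
  fractional-remainder M z w nz nw = *-cancelˡ (*-nonzero nw (*-nonzero nz nz)) (begin
    (μ * (l * l)) * ((n′ * j - n * i) - h * (i * i))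
      ≈⟨ solve 7 (λ l μ i j n n′ h →
           (μ :* (l :* l)) :* ((n′ :* j :- n :* i) :- h :* (i :* i)) :=
           (l :* l) :* n′ :* (μ :* j) :- μ :* l :* n :* (l :* i) :- μ :* h :* ((l :* i) :* (l :* i)))
           refl l μ i j n n′ h ⟩
    (l * l) * n′ * (μ * j) - μ * l * n * (l * i) - μ * h * ((l * i) * (l * i))
      ≈⟨ +-cong (+-cong (*-congˡ μj≈1) (-‿cong (*-congˡ li≈1))) (-‿cong (*-congˡ (*-cong li≈1 li≈1))) ⟩
    (l * l) * n′ * 1# - μ * l * n * 1# - μ * h * (1# * 1#)
      ≈⟨ solve 6 (λ a b c d z w →
           let l = c :* z :+ d ; μ = c :* w :+ d ; n = a :* z :+ b ; n′ = a :* w :+ b in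
           (l :* l) :* n′ :* con (+ 1) :- μ :* l :* n :* con (+ 1)
             :- μ :* (w :- z) :* (con (+ 1) :* con (+ 1)) :=
           l :* (w :- z) :* (a :* d :- b :* c) :- μ :* (w :- z)) refl a b c d z w ⟩
    l * h * (a * d - b * c) - μ * h
      ≈⟨ +-congʳ (*-congˡ det≈1) ⟩
    l * h * 1# - μ * h
      ≈⟨ solve 4 (λ c d z w →
           (c :* z :+ d) :* (w :- z) :* con (+ 1) :- (c :* w :+ d) :* (w :- z) :=
           :- (c :* ((w :- z) :* (w :- z))) :* (con (+ 1) :* (con (+ 1) :* con (+ 1)))) refl c d z w ⟩
    - (c * (h * h)) * (1# * (1# * 1#))
      ≈⟨ *-congˡ (*-cong μj≈1 (*-cong li≈1 li≈1)) ⟨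
    - (c * (h * h)) * ((μ * j) * ((l * i) * (l * i)))
      ≈⟨ solve 5 (λ k l μ i j → k :* ((μ :* j) :* ((l :* i) :* (l :* i))) :=
           (μ :* (l :* l)) :* (k :* (j :* (i :* i)))) refl (- (c * (h * h))) l μ i j ⟩
    (μ * (l * l)) * (- (c * (h * h)) * (j * (i * i))) ∎)
    where
    open SL₂ M
    l μ n n′ i j h : Carrier
    l  = denominator M z
    μ  = denominator M w
    n  = numerator M z
    n′ = numerator M w
    i  = inv l nz
    j  = inv μ nw
    h  = w - z
    li≈1 : l * i ≈ 1#
    li≈1 = *-invʳ l nz
    μj≈1 : μ * j ≈ 1#
    μj≈1 = *-invʳ μ nw

------------------------------------------------------------------------
-- Real and complex numbers

-- The reals, as a Dedekind-complete ordered field; this determines them up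
-- to isomorphism.
record CompleteOrderedField : Set₁ where
  field
    fieldStructure : Field
  open Field fieldStructure public
  infix 4 _<_
  field
    _<_                : Rel Carrier 0ℓ
    isStrictTotalOrder : IsStrictTotalOrder _≈_ _<_
    +-monoˡ-<          : ∀ x {y z} → y < z → x + y < x + z
    *-pos              : ∀ {x y} → 0# < x → 0# < y → 0# < x * y
  open NonStrict _≈_ _<_ public using (_≤_)

  IsUpperBound : Pred Carrier 0ℓ → Pred Carrier 0ℓ
  IsUpperBound P b = ∀ {x} → P x → x ≤ b

  field
    complete : (P : Pred Carrier 0ℓ) → ∃ P → ∃ (IsUpperBound P) →
               ∃ λ s → IsUpperBound P s × (∀ {b} → IsUpperBound P b → s ≤ b)

module OrderProperties (ℝ : CompleteOrderedField) where
  open CompleteOrderedField ℝ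
  open FieldProperties fieldStructure
  open IntegerSolver commutativeRing
  open import Data.Integer.Base using (+_)
  open IsStrictTotalOrder isStrictTotalOrder public
    using (compare; irrefl; <-respʳ-≈; <-respˡ-≈) renaming (trans to <-trans)

  pos-resp : ∀ {x y} → x ≈ y → 0# < x → 0# < y
  pos-resp = <-respʳ-≈

  pos⇒nonzero : ∀ {x} → 0# < x → x ≉ 0#
  pos⇒nonzero p e = irrefl (sym e) p

  <⇒pos : ∀ {x y} → x < y → 0# < y - x
  <⇒pos {x} {y} p = <-respˡ-≈ (-‿inverseˡ x) (<-respʳ-≈ (+-comm _ _) (+-monoˡ-< (- x) p))

  pos⇒< : ∀ {x y} → 0# < y - x → x < y
  pos⇒< {x} {y} p = <-respˡ-≈ (+-identityʳ x) (<-respʳ-≈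
    (solve 2 (λ x y → x :+ (y :- x) := y) refl x y) (+-monoˡ-< x p))

  neg⇒pos : ∀ {x} → x < 0# → 0# < - x
  neg⇒pos p = pos-resp (+-identityˡ _) (<⇒pos p)

  pos⇒neg : ∀ {x} → 0# < - x → x < 0#
  pos⇒neg p = pos⇒< (pos-resp (sym (+-identityˡ _)) p)

  +-pos : ∀ {x y} → 0# < x → 0# < y → 0# < x + y
  +-pos {x} p q = <-trans (pos-resp (sym (+-identityʳ x)) p) (+-monoˡ-< x q)

  square-pos : ∀ {x} → x ≉ 0# → 0# < x * x
  square-pos {x} x≉0 with compare 0# x
  ... | tri< p _ _ = *-pos p p
  ... | tri≈ _ e _ = ⊥-elim (x≉0 (sym e))
  ... | tri> _ _ n = pos-resp (solve 1 (λ x → (:- x) :* (:- x) := x :* x) refl x)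
                       (*-pos (neg⇒pos n) (neg⇒pos n))

  1-pos : 0# < 1#
  1-pos = pos-resp (*-identityˡ 1#) (square-pos 1≉0)

  NonNeg : Pred Carrier 0ℓ
  NonNeg x = 0# ≤ x

  nonNeg-resp : ∀ {x y} → x ≈ y → NonNeg x → NonNeg y
  nonNeg-resp e (inj₁ p) = inj₁ (pos-resp e p)
  nonNeg-resp e (inj₂ p) = inj₂ (trans p e)

  nonNeg-+ : ∀ {x y} → NonNeg x → NonNeg y → NonNeg (x + y)
  nonNeg-+ (inj₁ p) (inj₁ q) = inj₁ (+-pos p q)
  nonNeg-+ (inj₁ p) (inj₂ q) = inj₁ (pos-resp (trans (sym (+-identityʳ _)) (+-congˡ q)) p)
  nonNeg-+ (inj₂ p) q        = nonNeg-resp (trans (sym (+-identityˡ _)) (+-congʳ p)) q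

  nonNeg-* : ∀ {x y} → NonNeg x → NonNeg y → NonNeg (x * y)
  nonNeg-* (inj₁ p) (inj₁ q) = inj₁ (*-pos p q)
  nonNeg-* (inj₁ p) (inj₂ q) = inj₂ (trans (sym (zeroʳ _)) (*-congˡ q))
  nonNeg-* (inj₂ p) q        = inj₂ (trans (sym (zeroˡ _)) (*-congʳ p))

  pos+nonNeg : ∀ {x y} → 0# < x → NonNeg y → 0# < x + y
  pos+nonNeg p (inj₁ q) = +-pos p q
  pos+nonNeg p (inj₂ q) = pos-resp (trans (sym (+-identityʳ _)) (+-congˡ q)) p

  square-nonNeg : ∀ x → NonNeg (x * x)
  square-nonNeg x with compare x 0#
  ... | tri< _ ¬e _ = inj₁ (square-pos ¬e)
  ... | tri≈ _ e  _ = inj₂ (sym (trans (*-congʳ e) (zeroˡ x)))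
  ... | tri> _ ¬e _ = inj₁ (square-pos ¬e)

  ≤⇒nonNeg : ∀ {x y} → x ≤ y → NonNeg (y - x)
  ≤⇒nonNeg (inj₁ p) = inj₁ (<⇒pos p)
  ≤⇒nonNeg {x} (inj₂ e) = inj₂ (trans (sym (-‿inverseʳ x)) (+-congʳ e))

  nonNeg⇒≤ : ∀ {x y} → NonNeg (y - x) → x ≤ y
  nonNeg⇒≤ (inj₁ p) = inj₁ (pos⇒< p)
  nonNeg⇒≤ {x} {y} (inj₂ e) = inj₂ (trans (sym (+-identityʳ x)) (trans (+-congˡ e)
    (solve 2 (λ x y → x :+ (y :- x) := y) refl x y)))

  pos-cancelˡ : ∀ {x y} → 0# < x → 0# < x * y → 0# < y
  pos-cancelˡ {x} {y} p q with compare 0# y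
  ... | tri< r _ _ = r
  ... | tri≈ _ e _ = ⊥-elim (pos⇒nonzero q (trans (*-congˡ (sym e)) (zeroʳ x)))
  ... | tri> _ _ r = ⊥-elim (irrefl (sym zero≈) (+-pos q (*-pos p (neg⇒pos r))))
    where
    zero≈ : x * y + x * - y ≈ 0#
    zero≈ = solve 2 (λ x y → x :* y :+ x :* :- y := con (+ 0)) refl x y

  minimum : ∀ {p q} → 0# < p → 0# < q → ∃ λ m → 0# < m × (m ≤ p) × (m ≤ q)
  minimum {p} {q} p>0 q>0 with compare p q
  ... | tri< l _ _ = p , p>0 , inj₂ refl , inj₁ l
  ... | tri≈ _ e _ = p , p>0 , inj₂ refl , inj₂ e
  ... | tri> _ _ g = q , q>0 , inj₁ g , inj₂ refl

module _ (ℝ : CompleteOrderedField) where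
  open CompleteOrderedField ℝ
    using (fieldStructure; commutativeRing; semiring; +-monoid; +-rawMonoid; setoid;
           Carrier; _≈_; _≉_; _<_; _≤_; _+_; _*_; -_; _-_; 0#; 1#; refl; sym; trans; *-pos;
           +-cong; +-congʳ; +-congˡ; +-comm; +-assoc; +-identityˡ; +-identityʳ;
           *-cong; *-congʳ; *-congˡ; *-comm; *-identityˡ; *-identityʳ; zeroˡ; zeroʳ;
           -‿cong; -‿inverseˡ; -‿inverseʳ; 1≉0; inv; *-invʳ)
  open FieldProperties fieldStructure
  open OrderProperties ℝ
  open IntegerSolver commutativeRing
  open import Data.Integer.Base using (+_)
  open import Algebra.Definitions.RawMonoid +-rawMonoid using () renaming (_×_ to _⨯_)
  open import Algebra.Properties.Semiring.Exp semiring using (_^_; ^-congˡ)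
  open import Algebra.Properties.Monoid.Mult +-monoid using (×-congʳ)
  open import Relation.Binary.Reasoning.Setoid setoid

  -- A record only to raise the level.
  record IsOpenℝ (U : Pred Carrier 0ℓ) : Set₁ where
    field
      interior : ∀ {x} → U x →
        ∃ λ ε → 0# < ε × (∀ {y} → x - ε < y → y < x + ε → U y)
  open IsOpenℝ

  ℝ-topology : Topology setoid
  ℝ-topology = record
    { Open        = IsOpenℝ
    ; open-resp-≈ = λ o x≈y u → let (ε , ε>0 , i) = interior o u in
        i (pos⇒< (pos-resp (sym (lower x≈y)) ε>0)) (pos⇒< (pos-resp (sym (upper x≈y)) ε>0))
    ; open-resp-≐ = λ (f , g) o → record { interior = λ v →
        let (ε , ε>0 , i) = interior o (g v) in ε , ε>0 , λ p q → f (i p q) }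
    ; open-⊤      = record { interior = λ _ → 1# , 1-pos , λ _ _ → tt }
    ; open-∩      = λ o o′ → record { interior = λ (u , u′) →
        let (ε  , ε>0  , i ) = interior o u
            (ε′ , ε′>0 , i′) = interior o′ u′
            (δ , δ>0 , δ≤ε , δ≤ε′) = minimum ε>0 ε′>0
        in δ , δ>0 , λ p q → i (widen-lower δ≤ε p) (widen-upper δ≤ε q) ,
                             i′ (widen-lower δ≤ε′ p) (widen-upper δ≤ε′ q) }
    ; open-⋃      = λ I U o → record { interior = λ (j , u) →
        let (ε , ε>0 , i) = interior (o j) u in ε , ε>0 , λ p q → j , i p q }
    }
    where
    lower : ∀ {x y ε} → x ≈ y → y - (x - ε) ≈ ε
    lower {x} {y} {ε} e = trans (+-congʳ (sym e)) (solve 2 (λ x ε → x :- (x :- ε) := ε) refl x ε)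
    upper : ∀ {x y ε} → x ≈ y → (x + ε) - y ≈ ε
    upper {x} {y} {ε} e = trans (+-congʳ (+-congʳ e)) (solve 2 (λ y ε → (y :+ ε) :- y := ε) refl y ε)
    widen-lower : ∀ {x δ ε y} → δ ≤ ε → x - δ < y → x - ε < y
    widen-lower {x} {δ} {ε} {y} le p = pos⇒< (pos-resp
      (solve 4 (λ x δ ε y → (y :- (x :- δ)) :+ (ε :- δ) := y :- (x :- ε)) refl x δ ε y)
      (pos+nonNeg (<⇒pos p) (≤⇒nonNeg le)))
    widen-upper : ∀ {x δ ε y} → δ ≤ ε → y < x + δ → y < x + ε
    widen-upper {x} {δ} {ε} {y} le p = pos⇒< (pos-resp
      (solve 4 (λ x δ ε y → ((x :+ δ) :- y) :+ (ε :- δ) := (x :+ ε) :- y) refl x δ ε y)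
      (pos+nonNeg (<⇒pos p) (≤⇒nonNeg le)))

  ℂ-setoid : Setoid 0ℓ 0ℓ
  ℂ-setoid = ×-setoid setoid setoid

  ℂ-topology : Topology ℂ-setoid
  ℂ-topology = productTopology ℝ-topology ℝ-topology

  C : Set
  C = Setoid.Carrier ℂ-setoid

  re im : C → Carrier
  re = proj₁
  im = proj₂

  conj : C → C
  conj (x , y) = x , - y

  ∣_∣² : C → Carrier
  ∣ x , y ∣² = x * x + y * y

  ℂ-ring : CommutativeRing 0ℓ 0ℓ
  ℂ-ring = record
    { Carrier = C
    ; _≈_     = Setoid._≈_ ℂ-setoid
    ; _+_     = λ (x , y) (x′ , y′) → x + x′ , y + y′
    ; _*_     = λ (x , y) (x′ , y′) → x * x′ - y * y′ , x * y′ + y * x′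
    ; -_      = λ (x , y) → - x , - y
    ; 0#      = 0# , 0#
    ; 1#      = 1# , 0#
    ; isCommutativeRing = record
      { isRing = record
        { +-isAbelianGroup = record
          { isGroup = record
            { isMonoid = record
              { isSemigroup = record
                { isMagma = record
                  { isEquivalence = Setoid.isEquivalence ℂ-setoid
                  ; ∙-cong = λ (p , q) (r , s) → +-cong p r , +-cong q s }
                ; assoc = λ _ _ _ → +-assoc _ _ _ , +-assoc _ _ _ }
              ; identity = (λ _ → +-identityˡ _ , +-identityˡ _)
                         , (λ _ → +-identityʳ _ , +-identityʳ _) }
            ; inverse = (λ _ → -‿inverseˡ _ , -‿inverseˡ _)
                      , (λ _ → -‿inverseʳ _ , -‿inverseʳ _)
            ; ⁻¹-cong = λ (p , q) → -‿cong p , -‿cong q }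
          ; comm = λ _ _ → +-comm _ _ , +-comm _ _ }
        ; *-cong = λ (p , q) (r , s) →
            +-cong (*-cong p r) (-‿cong (*-cong q s)) , +-cong (*-cong p s) (*-cong q r)
        ; *-assoc = λ (a , b) (c , d) (e , f) →
            solve 6 (λ a b c d e f →
              (a :* c :- b :* d) :* e :- (a :* d :+ b :* c) :* f :=
              a :* (c :* e :- d :* f) :- b :* (c :* f :+ d :* e)) refl a b c d e f ,
            solve 6 (λ a b c d e f →
              (a :* c :- b :* d) :* f :+ (a :* d :+ b :* c) :* e :=
              a :* (c :* f :+ d :* e) :+ b :* (c :* e :- d :* f)) refl a b c d e f
        ; *-identity =
            (λ (a , b) →
              solve 2 (λ a b → con (+ 1) :* a :- con (+ 0) :* b := a) refl a b ,
              solve 2 (λ a b → con (+ 1) :* b :+ con (+ 0) :* a := b) refl a b) ,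
            (λ (a , b) →
              solve 2 (λ a b → a :* con (+ 1) :- b :* con (+ 0) := a) refl a b ,
              solve 2 (λ a b → a :* con (+ 0) :+ b :* con (+ 1) := b) refl a b)
        ; distrib =
            (λ (a , b) (c , d) (e , f) →
              solve 6 (λ a b c d e f → a :* (c :+ e) :- b :* (d :+ f) :=
                (a :* c :- b :* d) :+ (a :* e :- b :* f)) refl a b c d e f ,
              solve 6 (λ a b c d e f → a :* (d :+ f) :+ b :* (c :+ e) :=
                (a :* d :+ b :* c) :+ (a :* f :+ b :* e)) refl a b c d e f) ,
            (λ (a , b) (c , d) (e , f) →
              solve 6 (λ a b c d e f → (c :+ e) :* a :- (d :+ f) :* b :=
                (c :* a :- d :* b) :+ (e :* a :- f :* b)) refl a b c d e f ,
              solve 6 (λ a b c d e f → (c :+ e) :* b :+ (d :+ f) :* a :=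
                (c :* b :+ d :* a) :+ (e :* b :+ f :* a)) refl a b c d e f)
        }
      ; *-comm = λ (a , b) (c , d) →
          solve 4 (λ a b c d → a :* c :- b :* d := c :* a :- d :* b) refl a b c d ,
          solve 4 (λ a b c d → a :* d :+ b :* c := c :* b :+ d :* a) refl a b c d
      }
    }

  ∣∣²-pos : ∀ {z} → ¬ Setoid._≈_ ℂ-setoid z (0# , 0#) → 0# < ∣ z ∣²
  ∣∣²-pos {x , y} z≉0 with compare x 0#
  ... | tri< _ x≉0 _ = pos+nonNeg (square-pos x≉0) (square-nonNeg y)
  ... | tri> _ x≉0 _ = pos+nonNeg (square-pos x≉0) (square-nonNeg y)
  ... | tri≈ _ x≈0 _ = pos-resp (+-comm _ _)
    (pos+nonNeg (square-pos (λ y≈0 → z≉0 (x≈0 , y≈0))) (square-nonNeg x))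

  ℂ : Field
  ℂ = record
    { commutativeRing = ℂ-ring
    ; 1≉0             = λ e → 1≉0 (proj₁ e)
    ; inverse         = λ (x , y) z≉0 →
        let n = ∣ x , y ∣² ; n≉0 = pos⇒nonzero (∣∣²-pos z≉0) ; i = inv n n≉0 in
        (x * i , - y * i) ,
        trans (solve 3 (λ x y i → x :* (x :* i) :- y :* (:- y :* i) := (x :* x :+ y :* y) :* i)
                 refl x y i) (*-invʳ n n≉0) ,
        solve 3 (λ x y i → x :* (:- y :* i) :+ y :* (x :* i) := con (+ 0)) refl x y i
    }

  PSL₂ℝ PSL₂ℂ : Group 0ℓ 0ℓ
  PSL₂ℝ = PSL₂ fieldStructure
  PSL₂ℂ = PSL₂ ℂ

  private
    module ℂ = Field ℂ
      using (_≈_; _≉_; _+_; _*_; -_; _-_; 0#; 1#; refl; sym; trans; +-cong; *-cong;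
             *-congʳ; *-congˡ; *-assoc; *-identityˡ; *-identityʳ; -‿cong; 1≉0; inv; *-invʳ)
    module Gℝ = Group PSL₂ℝ using (Carrier; _≈_; _∙_; ε; _⁻¹; refl; inverseʳ; ⁻¹-cong)
    module Gℂ = Group PSL₂ℂ using (_≈_; _∙_; ε)

  ι : Carrier → C
  ι x = x , 0#

  private
    ι-cong : ∀ {x y} → x ≈ y → ι x ℂ.≈ ι y
    ι-cong e = e , refl

    ι-* : ∀ x y → ι (x * y) ℂ.≈ ι x ℂ.* ι y
    ι-* x y = solve 2 (λ x y → x :* y := x :* y :- con (+ 0) :* con (+ 0)) refl x y
            , solve 2 (λ x y → con (+ 0) := x :* con (+ 0) :+ con (+ 0) :* y) refl x y

    ι-+ : ∀ x y → ι (x + y) ℂ.≈ ι x ℂ.+ ι y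
    ι-+ x y = refl , sym (+-identityˡ 0#)

    ι-- : ∀ x → ι (- x) ℂ.≈ ℂ.- ι x
    ι-- x = refl , solve 0 (con (+ 0) := :- con (+ 0)) refl

    ι-lin : ∀ p q r s → ι (p * q + r * s) ℂ.≈ ι p ℂ.* ι q ℂ.+ ι r ℂ.* ι s
    ι-lin p q r s = ℂ.trans (ι-+ _ _) (ℂ.+-cong (ι-* p q) (ι-* r s))

    opaque
      ι-det : ∀ {a b c d} → a * d - b * c ≈ 1# → ι a ℂ.* ι d ℂ.- ι b ℂ.* ι c ℂ.≈ ℂ.1#
      ι-det {a} {b} {c} {d} e = ℂ.trans (ℂ.sym (ℂ.trans (ι-+ _ _) (ℂ.+-cong (ι-* a d)
        (ℂ.trans (ι-- _) (ℂ.-‿cong (ι-* b c)))))) (ι-cong e)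

  complexify : SL₂ fieldStructure → SL₂ ℂ
  complexify M = record { a = ι a ; b = ι b ; c = ι c ; d = ι d ; det≈1 = ι-det det≈1 }
    where open SL₂ M

  private
    ι-sign : ∀ {u} → IsSign fieldStructure u → IsSign ℂ (ι u)
    ι-sign (inj₁ e) = inj₁ (ι-cong e)
    ι-sign (inj₂ e) = inj₂ (ℂ.trans (ι-cong e) (ι-- 1#))

    complexify-cong : ∀ {M N} → M Gℝ.≈ N → complexify M Gℂ.≈ complexify N
    complexify-cong e = record
      { u = ι u ; isSign = ι-sign isSign
      ; a≈ = ι-scale a≈ ; b≈ = ι-scale b≈ ; c≈ = ι-scale c≈ ; d≈ = ι-scale d≈ }
      where
      open _≈±_ e
      ι-scale : ∀ {x y} → x ≈ u * y → ι x ℂ.≈ ι u ℂ.* ι y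
      ι-scale e = ℂ.trans (ι-cong e) (ι-* _ _)

    1* : ∀ {x y} → x ℂ.≈ y → x ℂ.≈ ℂ.1# ℂ.* y
    1* e = ℂ.trans e (ℂ.sym (ℂ.*-identityˡ _))

    complexify-∙ : ∀ M N → complexify (M Gℝ.∙ N) Gℂ.≈ complexify M Gℂ.∙ complexify N
    complexify-∙ M N = record
      { u = ℂ.1# ; isSign = inj₁ ℂ.refl
      ; a≈ = 1* (ι-lin _ _ _ _) ; b≈ = 1* (ι-lin _ _ _ _)
      ; c≈ = 1* (ι-lin _ _ _ _) ; d≈ = 1* (ι-lin _ _ _ _) }

    complexify-ε : complexify Gℝ.ε Gℂ.≈ Gℂ.ε
    complexify-ε = record
      { u = ℂ.1# ; isSign = inj₁ ℂ.refl
      ; a≈ = 1* ℂ.refl ; b≈ = 1* ℂ.refl ; c≈ = 1* ℂ.refl ; d≈ = 1* ℂ.refl }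


  Cubic : Set
  Cubic = Vector Carrier 4

  evaluate : Cubic → Carrier → Carrier → Carrier
  evaluate f x y = f 0F * x ^ 3 + f 1F * (x ^ 2 * y) + f 2F * (x * y ^ 2) + f 3F * y ^ 3

  Δ₃ : Carrier → Carrier → Carrier → Carrier → Carrier
  Δ₃ a b c d = b ^ 2 * c ^ 2 - 4 ⨯ (a * c ^ 3) - 4 ⨯ (b ^ 3 * d) - 27 ⨯ (a ^ 2 * d ^ 2)
             + 18 ⨯ (a * b * c * d)

  discriminant : Cubic → Carrier
  discriminant f = Δ₃ (f 0F) (f 1F) (f 2F) (f 3F)

  -- The coefficients of f(αx + βy, γx + δy) for f with coefficients a, b, c, d;
  -- see evaluate-∘ᶜ.
  coefficient : (a b c d α β γ δ : Carrier) → Cubic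
  coefficient a b c d α β γ δ =
    a * α ^ 3 + b * (α ^ 2 * γ) + c * (α * γ ^ 2) + d * γ ^ 3 ∷
    3 ⨯ (a * (α ^ 2 * β)) + b * (α ^ 2 * δ + 2 ⨯ (α * β * γ))
      + c * (β * γ ^ 2 + 2 ⨯ (α * γ * δ)) + 3 ⨯ (d * (γ ^ 2 * δ)) ∷
    3 ⨯ (a * (α * β ^ 2)) + b * (β ^ 2 * γ + 2 ⨯ (α * β * δ))
      + c * (α * δ ^ 2 + 2 ⨯ (β * γ * δ)) + 3 ⨯ (d * (γ * δ ^ 2)) ∷
    a * β ^ 3 + b * (β ^ 2 * δ) + c * (β * δ ^ 2) + d * δ ^ 3 ∷ []

  infixl 7 _∘ᶜ_
  _∘ᶜ_ : Cubic → SL₂ fieldStructure → Cubic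
  f ∘ᶜ M = coefficient (f 0F) (f 1F) (f 2F) (f 3F) (SL₂.a M) (SL₂.b M) (SL₂.c M) (SL₂.d M)

  private
    module _ {n : ℕ} where
      P : Set
      P = Polynomial n

      eval-P : P → P → P → P → P → P → P
      eval-P a b c d x y = a :* x :^ 3 :+ b :* (x :^ 2 :* y) :+ c :* (x :* y :^ 2) :+ d :* y :^ 3

      Δ₃-P : P → P → P → P → P
      Δ₃-P a b c d = b :^ 2 :* c :^ 2 :- 4 :× (a :* c :^ 3) :- 4 :× (b :^ 3 :* d)
                  :- 27 :× (a :^ 2 :* d :^ 2) :+ 18 :× (a :* b :* c :* d)

      c₀ c₁ c₂ c₃ : P → P → P → P → P → P → P → P → P
      c₀ a b c d α β γ δ = a :* α :^ 3 :+ b :* (α :^ 2 :* γ) :+ c :* (α :* γ :^ 2) :+ d :* γ :^ 3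
      c₁ a b c d α β γ δ =
        3 :× (a :* (α :^ 2 :* β)) :+ b :* (α :^ 2 :* δ :+ 2 :× (α :* β :* γ))
          :+ c :* (β :* γ :^ 2 :+ 2 :× (α :* γ :* δ)) :+ 3 :× (d :* (γ :^ 2 :* δ))
      c₂ a b c d α β γ δ =
        3 :× (a :* (α :* β :^ 2)) :+ b :* (β :^ 2 :* γ :+ 2 :× (α :* β :* δ))
          :+ c :* (α :* δ :^ 2 :+ 2 :× (β :* γ :* δ)) :+ 3 :× (d :* (γ :* δ :^ 2))
      c₃ a b c d α β γ δ = a :* β :^ 3 :+ b :* (β :^ 2 :* δ) :+ c :* (β :* δ :^ 2) :+ d :* δ :^ 3

  evaluate-∘ᶜ : ∀ f M x y → let open SL₂ M in
    evaluate (f ∘ᶜ M) x y ≈ evaluate f (a * x + b * y) (c * x + d * y)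
  evaluate-∘ᶜ f M x y = solve 10 (λ a b c d α β γ δ x y →
    eval-P (c₀ a b c d α β γ δ) (c₁ a b c d α β γ δ) (c₂ a b c d α β γ δ) (c₃ a b c d α β γ δ) x y
    := eval-P a b c d (α :* x :+ β :* y) (γ :* x :+ δ :* y))
    refl (f 0F) (f 1F) (f 2F) (f 3F) (SL₂.a M) (SL₂.b M) (SL₂.c M) (SL₂.d M) x y

  private
    poly-cong : ∀ {n} (p : Polynomial n) {ρ ρ′ : Vec Carrier n} →
                (∀ i → lookup ρ i ≈ lookup ρ′ i) → ⟦ p ⟧ₚ ρ ≈ ⟦ p ⟧ₚ ρ′
    poly-cong (op [+] p q) e = +-cong (poly-cong p e) (poly-cong q e)
    poly-cong (op [*] p q) e = *-cong (poly-cong p e) (poly-cong q e)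
    poly-cong (con c)      e = refl
    poly-cong (var i)      e = e i
    poly-cong (p :^ n)     e = ^-congˡ n (poly-cong p e)
    poly-cong (:- p)       e = -‿cong (poly-cong p e)

    v₀ v₁ v₂ v₃ v₄ v₅ v₆ v₇ : Polynomial 8
    v₀ = var 0F
    v₁ = var 1F
    v₂ = var 2F
    v₃ = var 3F
    v₄ = var 4F
    v₅ = var 5F
    v₆ = var 6F
    v₇ = var 7F

    coefficient-cong : ∀ {a b c d α β γ δ a′ b′ c′ d′ α′ β′ γ′ δ′} →
      a ≈ a′ → b ≈ b′ → c ≈ c′ → d ≈ d′ → α ≈ α′ → β ≈ β′ → γ ≈ γ′ → δ ≈ δ′ →
      ∀ i → coefficient a b c d α β γ δ i ≈ coefficient a′ b′ c′ d′ α′ β′ γ′ δ′ i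
    coefficient-cong {a} {b} {c} {d} {α} {β} {γ} {δ} {a′} {b′} {c′} {d′} {α′} {β′} {γ′} {δ′}
      ea eb ec ed eα eβ eγ eδ = λ
      { 0F → poly-cong (c₀ v₀ v₁ v₂ v₃ v₄ v₅ v₆ v₇) {ρ} {ρ′} e
      ; 1F → poly-cong (c₁ v₀ v₁ v₂ v₃ v₄ v₅ v₆ v₇) {ρ} {ρ′} e
      ; 2F → poly-cong (c₂ v₀ v₁ v₂ v₃ v₄ v₅ v₆ v₇) {ρ} {ρ′} e
      ; 3F → poly-cong (c₃ v₀ v₁ v₂ v₃ v₄ v₅ v₆ v₇) {ρ} {ρ′} e }
      where
      ρ ρ′ : Vec Carrier 8
      ρ  = a ∷ᵛ b ∷ᵛ c ∷ᵛ d ∷ᵛ α ∷ᵛ β ∷ᵛ γ ∷ᵛ δ ∷ᵛ []ᵛ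
      ρ′ = a′ ∷ᵛ b′ ∷ᵛ c′ ∷ᵛ d′ ∷ᵛ α′ ∷ᵛ β′ ∷ᵛ γ′ ∷ᵛ δ′ ∷ᵛ []ᵛ
      e : ∀ i → lookup ρ i ≈ lookup ρ′ i
      e = λ { 0F → ea ; 1F → eb ; 2F → ec ; 3F → ed ; 4F → eα ; 5F → eβ ; 6F → eγ ; 7F → eδ }

    coefficient-scale : ∀ t u a b c d α β γ δ i →
      coefficient (t * a) (t * b) (t * c) (t * d) (u * α) (u * β) (u * γ) (u * δ) i ≈
      (u ^ 3 * t) * coefficient a b c d α β γ δ i
    coefficient-scale t u a b c d α β γ δ = λ
      { 0F → solve 10 (λ t u a b c d α β γ δ →
          c₀ (t :* a) (t :* b) (t :* c) (t :* d) (u :* α) (u :* β) (u :* γ) (u :* δ) :=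
          (u :^ 3 :* t) :* c₀ a b c d α β γ δ) refl t u a b c d α β γ δ
      ; 1F → solve 10 (λ t u a b c d α β γ δ →
          c₁ (t :* a) (t :* b) (t :* c) (t :* d) (u :* α) (u :* β) (u :* γ) (u :* δ) :=
          (u :^ 3 :* t) :* c₁ a b c d α β γ δ) refl t u a b c d α β γ δ
      ; 2F → solve 10 (λ t u a b c d α β γ δ →
          c₂ (t :* a) (t :* b) (t :* c) (t :* d) (u :* α) (u :* β) (u :* γ) (u :* δ) :=
          (u :^ 3 :* t) :* c₂ a b c d α β γ δ) refl t u a b c d α β γ δ
      ; 3F → solve 10 (λ t u a b c d α β γ δ →
          c₃ (t :* a) (t :* b) (t :* c) (t :* d) (u :* α) (u :* β) (u :* γ) (u :* δ) :=
          (u :^ 3 :* t) :* c₃ a b c d α β γ δ) refl t u a b c d α β γ δ }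

    ∘ᶜ-scale : ∀ {f g M N t} → (∀ i → f i ≈ t * g i) → (e : M Gℝ.≈ N) →
      ∀ i → (f ∘ᶜ M) i ≈ (_≈±_.u e ^ 3 * t) * (g ∘ᶜ N) i
    ∘ᶜ-scale {g = g} {N = N} {t = t} f≈ e i = trans
      (coefficient-cong (f≈ 0F) (f≈ 1F) (f≈ 2F) (f≈ 3F) a≈ b≈ c≈ d≈ i)
      (coefficient-scale t u (g 0F) (g 1F) (g 2F) (g 3F) N.a N.b N.c N.d i)
      where
      open _≈±_ e
      module N = SL₂ N

    ∘ᶜ-∘ᶜ : ∀ f M N i → (f ∘ᶜ M ∘ᶜ N) i ≈ (f ∘ᶜ (M Gℝ.∙ N)) i
    ∘ᶜ-∘ᶜ f M N = λ
      { 0F → solve 12 (λ a b c d α β γ δ p q r s → compose c₀ a b c d α β γ δ p q r s)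
               refl (f 0F) (f 1F) (f 2F) (f 3F) M.a M.b M.c M.d N.a N.b N.c N.d
      ; 1F → solve 12 (λ a b c d α β γ δ p q r s → compose c₁ a b c d α β γ δ p q r s)
               refl (f 0F) (f 1F) (f 2F) (f 3F) M.a M.b M.c M.d N.a N.b N.c N.d
      ; 2F → solve 12 (λ a b c d α β γ δ p q r s → compose c₂ a b c d α β γ δ p q r s)
               refl (f 0F) (f 1F) (f 2F) (f 3F) M.a M.b M.c M.d N.a N.b N.c N.d
      ; 3F → solve 12 (λ a b c d α β γ δ p q r s → compose c₃ a b c d α β γ δ p q r s)
               refl (f 0F) (f 1F) (f 2F) (f 3F) M.a M.b M.c M.d N.a N.b N.c N.d }
      where
      module M = SL₂ M
      module N = SL₂ N
      compose : ∀ {n} → let P = Polynomial n in (P → P → P → P → P → P → P → P → P) →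
        P → P → P → P → P → P → P → P → P → P → P → P → P × P
      compose k a b c d α β γ δ p q r s =
        k (c₀ a b c d α β γ δ) (c₁ a b c d α β γ δ) (c₂ a b c d α β γ δ) (c₃ a b c d α β γ δ) p q r s
        := k a b c d (α :* p :+ β :* r) (α :* q :+ β :* s) (γ :* p :+ δ :* r) (γ :* q :+ δ :* s)

    ∘ᶜ-identity : ∀ f i → (f ∘ᶜ Gℝ.ε) i ≈ f i
    ∘ᶜ-identity f = λ
      { 0F → solve 4 (λ a b c d → c₀ a b c d :1 :0 :0 :1 := a) refl (f 0F) (f 1F) (f 2F) (f 3F)
      ; 1F → solve 4 (λ a b c d → c₁ a b c d :1 :0 :0 :1 := b) refl (f 0F) (f 1F) (f 2F) (f 3F)
      ; 2F → solve 4 (λ a b c d → c₂ a b c d :1 :0 :0 :1 := c) refl (f 0F) (f 1F) (f 2F) (f 3F)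
      ; 3F → solve 4 (λ a b c d → c₃ a b c d :1 :0 :0 :1 := d) refl (f 0F) (f 1F) (f 2F) (f 3F) }
      where
      :0 :1 : Polynomial 4
      :0 = con (+ 0)
      :1 = con (+ 1)

    ∘ᶜ-zero : ∀ {f} M → (∀ i → f i ≈ 0#) → ∀ i → (f ∘ᶜ M) i ≈ 0#
    ∘ᶜ-zero {f} M f≈0 i = trans
      (∘ᶜ-scale {f} {f} {M} {M} {0#} (λ j → trans (f≈0 j) (sym (zeroˡ _))) Gℝ.refl i)
      (trans (*-congʳ (zeroʳ _)) (zeroˡ _))

  opaque
    ∘ᶜ-nonzero : ∀ f M → NonzeroVector fieldStructure 3 f → NonzeroVector fieldStructure 3 (f ∘ᶜ M)
    ∘ᶜ-nonzero f M f≉0 f∘M≈0 = f≉0 λ i → cancel (s1 i) (s2 i) (s3 i) (s4 i)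
      where
      M⁻¹ E : SL₂ fieldStructure
      M⁻¹ = M Gℝ.⁻¹
      E   = M Gℝ.∙ M⁻¹
      E≈ε : E Gℝ.≈ Gℝ.ε
      E≈ε = Gℝ.inverseʳ M
      u k : Carrier
      u = _≈±_.u E≈ε
      k = u ^ 3 * 1#
      u≉0 : u ≉ 0#
      u≉0 = sign-nonzero fieldStructure (_≈±_.isSign E≈ε)
      k≉0 : k ≉ 0#
      k≉0 = *-nonzero (*-nonzero u≉0 (*-nonzero u≉0 (*-nonzero u≉0 1≉0))) 1≉0
      s1 : ∀ i → (f ∘ᶜ Gℝ.ε) i ≈ f i
      s1 = ∘ᶜ-identity f
      s2 : ∀ i → (f ∘ᶜ E) i ≈ k * (f ∘ᶜ Gℝ.ε) i
      s2 = ∘ᶜ-scale {f} {f} {E} {Gℝ.ε} {1#} (λ _ → sym (*-identityˡ _)) E≈ε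
      s3 : ∀ i → (f ∘ᶜ M ∘ᶜ M⁻¹) i ≈ (f ∘ᶜ E) i
      s3 = ∘ᶜ-∘ᶜ f M M⁻¹
      s4 : ∀ i → (f ∘ᶜ M ∘ᶜ M⁻¹) i ≈ 0#
      s4 = ∘ᶜ-zero {f ∘ᶜ M} M⁻¹ f∘M≈0
      cancel : ∀ {x y z w} → y ≈ x → z ≈ k * y → w ≈ z → w ≈ 0# → x ≈ 0#
      cancel {x} {y} y≈x z≈ky w≈z w≈0 = *-cancelˡ k≉0 (trans (*-congˡ (sym y≈x))
        (trans (sym z≈ky) (trans (sym w≈z) (trans w≈0 (sym (zeroʳ k))))))

  private
    -- The Hessian covariant (p, q, r) satisfies 4pr - q² = 3Δ₃.
    hessian-p hessian-q hessian-r : ∀ {n} → let P = Polynomial n in P → P → P → P → P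
    hessian-p a b c d = b :* b :- 3 :× (a :* c)
    hessian-q a b c d = b :* c :- 9 :× (a :* d)
    hessian-r a b c d = c :* c :- 3 :× (b :* d)

    p q r : Carrier → Carrier → Carrier → Carrier → Carrier
    p a b c d = b * b - 3 ⨯ (a * c)
    q a b c d = b * c - 9 ⨯ (a * d)
    r a b c d = c * c - 3 ⨯ (b * d)

    3ℝ : Carrier
    3ℝ = 1# + 1# + 1#

    3≉0 : 3ℝ ≉ 0#
    3≉0 = pos⇒nonzero (+-pos (+-pos 1-pos 1-pos) 1-pos)

    3Δ₃ : ∀ a b c d →
      3ℝ * Δ₃ a b c d ≈ 4 ⨯ (p a b c d * r a b c d) - q a b c d * q a b c d
    3Δ₃ = solve 4 (λ a b c d → con (+ 3) :* Δ₃-P a b c d :=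
      4 :× (hessian-p a b c d :* hessian-r a b c d) :- hessian-q a b c d :* hessian-q a b c d) refl

    expand : ∀ p q r α β γ δ → let D = α * δ - β * γ in
      4 ⨯ (((D * D) * (p * (α * α) + q * (α * γ) + r * (γ * γ)))
         * ((D * D) * (p * (β * β) + q * (β * δ) + r * (δ * δ))))
        - ((D * D) * (2 ⨯ (p * (α * β)) + q * (α * δ + β * γ) + 2 ⨯ (r * (γ * δ))))
        * ((D * D) * (2 ⨯ (p * (α * β)) + q * (α * δ + β * γ) + 2 ⨯ (r * (γ * δ))))
      ≈ D ^ 6 * (4 ⨯ (p * r) - q * q)
    expand = solve 7 (λ p q r α β γ δ →
      let D  = α :* δ :- β :* γ
          q″ = (D :* D) :* (2 :× (p :* (α :* β)) :+ q :* (α :* δ :+ β :* γ) :+ 2 :× (r :* (γ :* δ))) in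
      4 :× (((D :* D) :* (p :* (α :* α) :+ q :* (α :* γ) :+ r :* (γ :* γ)))
         :* ((D :* D) :* (p :* (β :* β) :+ q :* (β :* δ) :+ r :* (δ :* δ)))) :- q″ :* q″
      := D :^ 6 :* (4 :× (p :* r) :- q :* q)) refl

    module _ (a b c d α β γ δ : Carrier) where
      f′ : Cubic
      f′ = coefficient a b c d α β γ δ

      D : Carrier
      D = α * δ - β * γ

      p-∘ᶜ : p (f′ 0F) (f′ 1F) (f′ 2F) (f′ 3F) ≈
           (D * D) * (p a b c d * (α * α) + q a b c d * (α * γ) + r a b c d * (γ * γ))
      p-∘ᶜ = solve 8 (λ a b c d α β γ δ →
        hessian-p (c₀ a b c d α β γ δ) (c₁ a b c d α β γ δ) (c₂ a b c d α β γ δ) (c₃ a b c d α β γ δ) :=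
        ((α :* δ :- β :* γ) :* (α :* δ :- β :* γ)) :*
        (hessian-p a b c d :* (α :* α) :+ hessian-q a b c d :* (α :* γ) :+ hessian-r a b c d :* (γ :* γ)))
        refl a b c d α β γ δ

      q-∘ᶜ : q (f′ 0F) (f′ 1F) (f′ 2F) (f′ 3F) ≈
           (D * D) * (2 ⨯ (p a b c d * (α * β)) + q a b c d * (α * δ + β * γ) + 2 ⨯ (r a b c d * (γ * δ)))
      q-∘ᶜ = solve 8 (λ a b c d α β γ δ →
        hessian-q (c₀ a b c d α β γ δ) (c₁ a b c d α β γ δ) (c₂ a b c d α β γ δ) (c₃ a b c d α β γ δ) :=
        ((α :* δ :- β :* γ) :* (α :* δ :- β :* γ)) :*
        (2 :× (hessian-p a b c d :* (α :* β)) :+ hessian-q a b c d :* (α :* δ :+ β :* γ)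
          :+ 2 :× (hessian-r a b c d :* (γ :* δ))))
        refl a b c d α β γ δ

      r-∘ᶜ : r (f′ 0F) (f′ 1F) (f′ 2F) (f′ 3F) ≈
           (D * D) * (p a b c d * (β * β) + q a b c d * (β * δ) + r a b c d * (δ * δ))
      r-∘ᶜ = solve 8 (λ a b c d α β γ δ →
        hessian-r (c₀ a b c d α β γ δ) (c₁ a b c d α β γ δ) (c₂ a b c d α β γ δ) (c₃ a b c d α β γ δ) :=
        ((α :* δ :- β :* γ) :* (α :* δ :- β :* γ)) :*
        (hessian-p a b c d :* (β :* β) :+ hessian-q a b c d :* (β :* δ) :+ hessian-r a b c d :* (δ :* δ)))
        refl a b c d α β γ δ

      3Δ₃′ : 3ℝ * discriminant f′ ≈ D ^ 6 * (3ℝ * Δ₃ a b c d)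
      3Δ₃′ = trans (3Δ₃ (f′ 0F) (f′ 1F) (f′ 2F) (f′ 3F)) (trans (combine p-∘ᶜ q-∘ᶜ r-∘ᶜ)
        (trans (expand (p a b c d) (q a b c d) (r a b c d) α β γ δ) (*-congˡ (sym (3Δ₃ a b c d)))))
        where
        combine : ∀ {x y z x′ y′ z′} → x ≈ x′ → y ≈ y′ → z ≈ z′ →
                  4 ⨯ (x * z) - y * y ≈ 4 ⨯ (x′ * z′) - y′ * y′
        combine ex ey ez = +-cong (×-congʳ 4 (*-cong ex ez)) (-‿cong (*-cong ey ey))

  opaque
    discriminant-∘ᶜ : ∀ f M → discriminant (f ∘ᶜ M) ≈ discriminant f
    discriminant-∘ᶜ f M = *-cancelˡ 3≉0 (trans
      (3Δ₃′ (f 0F) (f 1F) (f 2F) (f 3F) (SL₂.a M) (SL₂.b M) (SL₂.c M) (SL₂.d M))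
      (trans (*-congʳ (trans (^-congˡ 6 (SL₂.det≈1 M))
        (solve 0 (con (+ 1) :^ 6 := con (+ 1)) refl))) (*-identityˡ _)))

  private
    opaque
      ε⁻¹≈ε : Gℝ.ε Gℝ.⁻¹ Gℝ.≈ Gℝ.ε
      ε⁻¹≈ε = GroupProperties.ε⁻¹≈ε PSL₂ℝ

      ∙-⁻¹ : ∀ A B → (A Gℝ.∙ B) Gℝ.⁻¹ Gℝ.≈ B Gℝ.⁻¹ Gℝ.∙ A Gℝ.⁻¹
      ∙-⁻¹ = GroupProperties.⁻¹-anti-homo-∙ PSL₂ℝ

      sign³-nonzero : ∀ {M N} (e : M Gℝ.≈ N) → _≈±_.u e ^ 3 ≉ 0#
      sign³-nonzero e = *-nonzero u≉0 (*-nonzero u≉0 (*-nonzero u≉0 1≉0))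
        where
        u≉0 : _≈±_.u e ≉ 0#
        u≉0 = sign-nonzero fieldStructure (_≈±_.isSign e)

  ℝℙ³ : Setoid 0ℓ 0ℓ
  ℝℙ³ = ℙ fieldStructure 3

  IsNegative : Pred (Setoid.Carrier ℝℙ³) 0ℓ
  IsNegative (f , _) = discriminant f < 0#

  IsNegative-respects : IsNegative Respects (Setoid._≈_ ℝℙ³)
  IsNegative-respects {f , _} {g , _} (t , t≉0 , f≈tg) Δf<0 = pos⇒neg (pos-cancelˡ t⁴>0 (pos-resp (begin
    - discriminant f                ≈⟨ -‿cong (poly-cong (Δ₃-P (var 0F) (var 1F) (var 2F) (var 3F)) {ρ} {ρ′}
                                         λ { 0F → f≈tg 0F ; 1F → f≈tg 1F ; 2F → f≈tg 2F ; 3F → f≈tg 3F }) ⟩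
    - Δ₃ (t * g 0F) (t * g 1F) (t * g 2F) (t * g 3F)
                                    ≈⟨ solve 5 (λ t a b c d →
                                         :- Δ₃-P (t :* a) (t :* b) (t :* c) (t :* d) :=
                                         ((t :* t) :* (t :* t)) :* :- Δ₃-P a b c d)
                                         refl t (g 0F) (g 1F) (g 2F) (g 3F) ⟩
    (t * t) * (t * t) * - discriminant g ∎) (neg⇒pos Δf<0)))
    where
    ρ ρ′ : Vec Carrier 4
    ρ  = f 0F ∷ᵛ f 1F ∷ᵛ f 2F ∷ᵛ f 3F ∷ᵛ []ᵛ
    ρ′ = t * g 0F ∷ᵛ t * g 1F ∷ᵛ t * g 2F ∷ᵛ t * g 3F ∷ᵛ []ᵛ
    t⁴>0 : 0# < (t * t) * (t * t)
    t⁴>0 = *-pos (square-pos t≉0) (square-pos t≉0)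

  private
    1· : ∀ (f : Cubic) i → f i ≈ 1# * f i
    1· f i = sym (*-identityˡ _)

    Δ⁻-setoid : Setoid 0ℓ 0ℓ
    Δ⁻-setoid = subsetoid ℝℙ³ IsNegative

    module Δ = Setoid Δ⁻-setoid using (Carrier; _≈_)

    act : SL₂ fieldStructure → Δ.Carrier → Δ.Carrier
    act A ((f , f≉0) , Δ<0) =
      (f ∘ᶜ A Gℝ.⁻¹ , ∘ᶜ-nonzero f (A Gℝ.⁻¹) f≉0) ,
      <-respˡ-≈ (sym (discriminant-∘ᶜ f (A Gℝ.⁻¹))) Δ<0

    scaled : ∀ {f g M N t} (e : M Gℝ.≈ N) → t ≉ 0# → (∀ i → f i ≈ t * g i) →
      ∃ λ s → s ≉ 0# × (∀ i → (f ∘ᶜ M) i ≈ s * (g ∘ᶜ N) i)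
    scaled {f} {g} {M} {N} {t} e t≉0 f≈tg =
      _≈±_.u e ^ 3 * t , *-nonzero (sign³-nonzero e) t≉0 , ∘ᶜ-scale {f} {g} {M} {N} {t} f≈tg e

    opaque
      act-cong : ∀ {A B x y} → A Gℝ.≈ B → x Δ.≈ y → act A x Δ.≈ act B y
      act-cong {A} {B} {(f , _) , _} {(g , _) , _} A≈B (t , t≉0 , f≈tg) =
        scaled {f} {g} {A Gℝ.⁻¹} {B Gℝ.⁻¹} {t} (Gℝ.⁻¹-cong {A} {B} A≈B) t≉0 f≈tg

      act-ε : ∀ x → act Gℝ.ε x Δ.≈ x
      act-ε ((f , _) , _) =
        let (s , s≉0 , e) = scaled {f} {f} {Gℝ.ε Gℝ.⁻¹} {Gℝ.ε} {1#} ε⁻¹≈ε 1≉0 (1· f) in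
        s , s≉0 , λ i → trans (e i) (*-congˡ (∘ᶜ-identity f i))

      act-∙ : ∀ A B x → act (A Gℝ.∙ B) x Δ.≈ act A (act B x)
      act-∙ A B ((f , _) , _) =
        let (s , s≉0 , e) = scaled {f} {f} {(A Gℝ.∙ B) Gℝ.⁻¹} {B Gℝ.⁻¹ Gℝ.∙ A Gℝ.⁻¹} {1#}
                              (∙-⁻¹ A B) 1≉0 (1· f) in
        s , s≉0 , λ i → trans (e i) (*-congˡ (sym (∘ᶜ-∘ᶜ f (B Gℝ.⁻¹) (A Gℝ.⁻¹) i)))

    Δ⁻-topology : Topology Δ⁻-setoid
    Δ⁻-topology = subspaceTopology ℝℙ³ (ℙ-topology fieldStructure 3 ℝ-topology) IsNegative

    Δ⁻-action : Action PSL₂ℝ Δ⁻-setoid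
    Δ⁻-action = record
      { _·_ = act
      ; ·-cong = λ {A} {B} {x} {y} → act-cong {A} {B} {x} {y}
      ; ·-identity = act-ε
      ; ·-assoc = act-∙ }

  Δ⁻ : GSpace PSL₂ℝ
  Δ⁻ = record { setoid = Δ⁻-setoid ; topology = Δ⁻-topology ; action = Δ⁻-action }

  ----------------------------------------------------------------------
  -- Root sets

  ℂℙ¹ : Setoid 0ℓ 0ℓ
  ℂℙ¹ = ℙ ℂ 1

  SP³ℂℙ¹ : Setoid 0ℓ 0ℓ
  SP³ℂℙ¹ = SP-setoid 3 ℂℙ¹

  ιℙ : ℙ¹ fieldStructure → ℙ¹ ℂ
  ιℙ (v , v≉0) = (ι ∘ v) , λ e → v≉0 (proj₁ ∘ e)

  rootTriple : ℙ¹ fieldStructure → C → Vector (ℙ¹ ℂ) 3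
  rootTriple r z = ιℙ r ∷ affine ℂ z ∷ affine ℂ (conj z) ∷ []

  IsRootSet : Pred (Setoid.Carrier SP³ℂℙ¹) 0ℓ
  IsRootSet s = Σ[ r ∈ ℙ¹ fieldStructure ] Σ[ z ∈ C ]
    (im z ≉ 0# × Setoid._≈_ SP³ℂℙ¹ s (rootTriple r z))

  denominator-nonzero : ∀ M {z} → im z ≉ 0# → denominator ℂ (complexify M) z ℂ.≉ ℂ.0#
  denominator-nonzero M {x , y} y≉0 (e , e′) = 1≉0 (begin
    1#              ≈⟨ det≈1 ⟨
    a * d - b * c   ≈⟨ +-cong (*-congˡ d≈0) (-‿cong (*-congˡ c≈0)) ⟩
    a * 0# - b * 0# ≈⟨ solve 2 (λ a b → a :* con (+ 0) :- b :* con (+ 0) := con (+ 0)) refl a b ⟩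
    0#              ∎)
    where
    open SL₂ M
    c≈0 : c ≈ 0#
    c≈0 = *-cancelˡ y≉0 (begin
      y * c                    ≈⟨ solve 3 (λ x y c → y :* c := (c :* y :+ con (+ 0) :* x) :+ con (+ 0)) refl x y c ⟩
      (c * y + 0# * x) + 0#    ≈⟨ e′ ⟩
      0#                       ≈⟨ zeroʳ y ⟨
      y * 0#                   ∎)
    d≈0 : d ≈ 0#
    d≈0 = begin
      d                                ≈⟨ solve 3 (λ x y d → d := (con (+ 0) :* x :- con (+ 0) :* y) :+ d) refl x y d ⟩
      (0# * x - 0# * y) + d            ≈⟨ +-congʳ (+-congʳ (*-congʳ c≈0)) ⟨
      (c * x - 0# * y) + d             ≈⟨ e ⟩
      0#                               ∎

  möbiusℂ : (M : SL₂ fieldStructure) (z : C) → im z ≉ 0# → C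
  möbiusℂ M z nz = fractional ℂ (complexify M) z (denominator-nonzero M nz)

  im-möbiusℂ : ∀ M z nz →
    im (möbiusℂ M z nz) * ∣ denominator ℂ (complexify M) z ∣² ≈ im z
  im-möbiusℂ M (x , y) nz = begin
    w₂ * (l₁ * l₁ + l₂ * l₂)
      ≈⟨ solve 4 (λ l₁ l₂ w₁ w₂ → w₂ :* (l₁ :* l₁ :+ l₂ :* l₂) :=
           (l₁ :* w₂ :+ l₂ :* w₁) :* l₁ :- (l₁ :* w₁ :- l₂ :* w₂) :* l₂) refl l₁ l₂ w₁ w₂ ⟩
    (l₁ * w₂ + l₂ * w₁) * l₁ - (l₁ * w₁ - l₂ * w₂) * l₂
      ≈⟨ +-cong (*-congʳ (proj₂ λw≈n)) (-‿cong (*-congʳ (proj₁ λw≈n))) ⟩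
    im n * l₁ - re n * l₂
      ≈⟨ solve 6 (λ a b c d x y →
           ((a :* y :+ con (+ 0) :* x) :+ con (+ 0)) :* ((c :* x :- con (+ 0) :* y) :+ d) :-
           ((a :* x :- con (+ 0) :* y) :+ b) :* ((c :* y :+ con (+ 0) :* x) :+ con (+ 0)) :=
           (a :* d :- b :* c) :* y) refl a b c d x y ⟩
    (a * d - b * c) * y
      ≈⟨ trans (*-congʳ det≈1) (*-identityˡ y) ⟩
    y ∎
    where
    open SL₂ M
    n : C
    n = numerator ℂ (complexify M) (x , y)
    l₁ l₂ w₁ w₂ : Carrier
    l₁ = re (denominator ℂ (complexify M) (x , y))
    l₂ = im (denominator ℂ (complexify M) (x , y))
    w₁ = re (möbiusℂ M (x , y) nz)
    w₂ = im (möbiusℂ M (x , y) nz)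
    λw≈n : denominator ℂ (complexify M) (x , y) ℂ.* möbiusℂ M (x , y) nz ℂ.≈ n
    λw≈n = denominator*fractional ℂ (complexify M) (x , y) (denominator-nonzero M nz)

  private
    conj-nonreal : ∀ {z} → im z ≉ 0# → im (conj z) ≉ 0#
    conj-nonreal {z} nz e = nz (trans (solve 1 (λ y → y := :- :- y) refl (im z))
      (trans (-‿cong e) (solve 0 (:- con (+ 0) := con (+ 0)) refl)))

    möbiusℂ-nonreal : ∀ M z nz → im (möbiusℂ M z nz) ≉ 0#
    möbiusℂ-nonreal M z nz e = nz (trans (sym (im-möbiusℂ M z nz)) (trans (*-congʳ e) (zeroˡ _)))

    conj-lin : ∀ a b x y →
      (ι a ℂ.* conj (x , y) ℂ.+ ι b) ℂ.≈ conj (ι a ℂ.* (x , y) ℂ.+ ι b)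
    conj-lin a b x y =
      solve 4 (λ a b x y → (a :* x :- con (+ 0) :* (:- y)) :+ b := (a :* x :- con (+ 0) :* y) :+ b)
        refl a b x y ,
      solve 3 (λ a x y → (a :* (:- y) :+ con (+ 0) :* x) :+ con (+ 0) :=
        :- ((a :* y :+ con (+ 0) :* x) :+ con (+ 0))) refl a x y

    conj-* : ∀ z w → conj z ℂ.* conj w ℂ.≈ conj (z ℂ.* w)
    conj-* (a , b) (c , d) =
      solve 4 (λ a b c d → a :* c :- (:- b) :* (:- d) := a :* c :- b :* d) refl a b c d ,
      solve 4 (λ a b c d → a :* (:- d) :+ (:- b) :* c := :- (a :* d :+ b :* c)) refl a b c d

    conj-cong : ∀ {z w} → z ℂ.≈ w → conj z ℂ.≈ conj w
    conj-cong (p , q) = p , -‿cong q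

    root-möbius : ∀ M z nz → Setoid._≈_ ℂℙ¹
      (möbius ℂ (complexify M) (affine ℂ z)) (affine ℂ (möbiusℂ M z nz))
    root-möbius M z nz = affine-möbius ℂ (complexify M) {z} {möbiusℂ M z nz} (denominator-nonzero M nz)
      (denominator*fractional ℂ (complexify M) z (denominator-nonzero M nz))

    root-möbius-conj : ∀ M z nz → Setoid._≈_ ℂℙ¹
      (möbius ℂ (complexify M) (affine ℂ (conj z))) (affine ℂ (conj (möbiusℂ M z nz)))
    root-möbius-conj M z nz =
      affine-möbius ℂ (complexify M) {conj z} {conj (möbiusℂ M z nz)}
        (denominator-nonzero M (conj-nonreal {z} nz))
        (ℂ.trans (ℂ.*-congʳ (conj-lin c d (re z) (im z)))
        (ℂ.trans (conj-* (denominator ℂ (complexify M) z) (möbiusℂ M z nz))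
        (ℂ.trans (conj-cong
          {denominator ℂ (complexify M) z ℂ.* möbiusℂ M z nz} {numerator ℂ (complexify M) z}
          (denominator*fractional ℂ (complexify M) z (denominator-nonzero M nz)))
                 (ℂ.sym (conj-lin a b (re z) (im z))))))
      where open SL₂ M

    ιℙ-möbius : ∀ M r → Setoid._≈_ ℂℙ¹
      (möbius ℂ (complexify M) (ιℙ r)) (ιℙ (möbius fieldStructure M r))
    ιℙ-möbius M (v , _) = ℂ.1# , ℂ.1≉0 , λ
      { 0F → 1* (ℂ.sym (ι-lin a (v 0F) b (v 1F)))
      ; 1F → 1* (ℂ.sym (ι-lin c (v 0F) d (v 1F))) }
      where open SL₂ M

    module S = Setoid SP³ℂℙ¹ using (Carrier; _≈_; trans)
    module ℙC = Setoid ℂℙ¹ using (refl; trans)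
    module Mℂ = Action (möbius-action ℂ) using (·-cong; ·-identity; ·-assoc)

    actᵥ : SL₂ fieldStructure → S.Carrier → S.Carrier
    actᵥ M s i = möbius ℂ (complexify M) (s i)

    opaque
      actᵥ-cong : ∀ {M N s t} → M Gℝ.≈ N → s S.≈ t → actᵥ M s S.≈ actᵥ N t
      actᵥ-cong {M} {N} {s} {t} e (π , f) = π , λ i →
        Mℂ.·-cong {complexify M} {complexify N} {s i} {t (π Perm.⟨$⟩ʳ i)}
          (complexify-cong {M} {N} e) (f i)

      actᵥ-root : ∀ M {s} → IsRootSet s → IsRootSet (actᵥ M s)
      actᵥ-root M {s} (r , z , nz , e) =
        möbius fieldStructure M r , möbiusℂ M z nz , möbiusℂ-nonreal M z nz ,
        S.trans {actᵥ M s} {actᵥ M (rootTriple r z)} {rootTriple r₁ z₁}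
          (actᵥ-cong {M} {M} {s} {rootTriple r z} (Gℝ.refl {M}) e)
          (Perm.id , λ { 0F → ιℙ-möbius M r
                       ; 1F → root-möbius M z nz
                       ; 2F → root-möbius-conj M z nz })
        where
        r₁ : ℙ¹ fieldStructure
        r₁ = möbius fieldStructure M r
        z₁ : C
        z₁ = möbiusℂ M z nz

      actᵥ-ε : ∀ s → actᵥ Gℝ.ε s S.≈ s
      actᵥ-ε s = Perm.id , λ i → ℙC.trans {actᵥ Gℝ.ε s i} {möbius ℂ Gℂ.ε (s i)} {s i}
        (Mℂ.·-cong {complexify Gℝ.ε} {Gℂ.ε} {s i} {s i} complexify-ε (ℙC.refl {s i}))
        (Mℂ.·-identity (s i))

      actᵥ-∙ : ∀ M N s → actᵥ (M Gℝ.∙ N) s S.≈ actᵥ M (actᵥ N s)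
      actᵥ-∙ M N s = Perm.id , λ i → ℙC.trans {actᵥ (M Gℝ.∙ N) s i}
        {möbius ℂ (complexify M Gℂ.∙ complexify N) (s i)} {actᵥ M (actᵥ N s) i}
        (Mℂ.·-cong {complexify (M Gℝ.∙ N)} {complexify M Gℂ.∙ complexify N} {s i} {s i}
          (complexify-∙ M N) (ℙC.refl {s i}))
        (Mℂ.·-assoc (complexify M) (complexify N) (s i))

  ℛ[Δ⁻] : GSpace PSL₂ℝ
  ℛ[Δ⁻] = record
    { setoid   = subsetoid SP³ℂℙ¹ IsRootSet
    ; topology = subspaceTopology SP³ℂℙ¹ (SP-topology 3 ℂℙ¹ (ℙ-topology ℂ 1 ℂ-topology)) IsRootSet
    ; action   = record
      { _·_        = λ { M (s , p) → (λ i → möbius ℂ (complexify M) (s i)) , actᵥ-root M {s} p }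
      ; ·-cong     = λ {M} {N} {s} {t} → actᵥ-cong {M} {N} {proj₁ s} {proj₁ t}
      ; ·-identity = λ { (s , _) → actᵥ-ε s }
      ; ·-assoc    = λ { M N (s , _) → actᵥ-∙ M N s }
      }
    }

  ----------------------------------------------------------------------
  -- The unit tangent bundle of the upper half plane

  ℍ²-setoid : Setoid 0ℓ 0ℓ
  ℍ²-setoid = subsetoid ℂ-setoid (λ z → 0# < im z)

  ℍ²-topology : Topology ℍ²-setoid
  ℍ²-topology = subspaceTopology ℂ-setoid ℂ-topology (λ z → 0# < im z)

  ℍ² : Set
  ℍ² = Setoid.Carrier ℍ²-setoid

  nonreal : (p : ℍ²) → im (proj₁ p) ≉ 0#
  nonreal (_ , y>0) = pos⇒nonzero y>0

  -- The metric (dx² + dy²)/y².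
  ⟨_,_⟩at_ : C → C → ℍ² → Carrier
  ⟨ v , w ⟩at p = (re v * re w + im v * im w) * inv (y * y) (*-nonzero (nonreal p) (nonreal p))
    where
    y : Carrier
    y = im (proj₁ p)

  -- The tangent bundle is trivialised as ℍ² × ℂ.
  Tℍ²-setoid : Setoid 0ℓ 0ℓ
  Tℍ²-setoid = ×-setoid ℍ²-setoid ℂ-setoid

  -- ‖v‖ = 1, in the form ‖v‖² = 1.
  IsUnit : Pred (Setoid.Carrier Tℍ²-setoid) 0ℓ
  IsUnit (p , v) = ⟨ v , v ⟩at p ≈ 1#

  isometry : SL₂ fieldStructure → ℍ² → ℍ²
  isometry M p@(z , y>0) = möbiusℂ M z (nonreal p) , pos-cancelˡ
    (∣∣²-pos (denominator-nonzero M (nonreal p)))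
    (pos-resp (trans (sym (im-möbiusℂ M z (nonreal p))) (*-comm _ _)) y>0)

  -- The differential of z ↦ (az + b)/(cz + d) at z is multiplication by
  -- 1/(cz + d)²; see differential-correct.
  differential : SL₂ fieldStructure → ℍ² → C → C
  differential M p@(z , _) v =
    v ℂ.* derivative ℂ (complexify M) z (denominator-nonzero M (nonreal p))

  private
    ∣∣²-* : ∀ z w → ∣ z ℂ.* w ∣² ≈ ∣ z ∣² * ∣ w ∣²
    ∣∣²-* (a , b) (c , d) = solve 4 (λ a b c d →
      (a :* c :- b :* d) :* (a :* c :- b :* d) :+ (a :* d :+ b :* c) :* (a :* d :+ b :* c) :=
      (a :* a :+ b :* b) :* (c :* c :+ d :* d)) refl a b c d

    ∣∣²-cong : ∀ {z w} → z ℂ.≈ w → ∣ z ∣² ≈ ∣ w ∣²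
    ∣∣²-cong (p , q) = +-cong (*-cong p p) (*-cong q q)

    ∣inv∣² : ∀ z z≉0 → ∣ z ∣² * ∣ ℂ.inv z z≉0 ∣² ≈ 1#
    ∣inv∣² z z≉0 = trans (sym (∣∣²-* z (ℂ.inv z z≉0)))
      (trans (∣∣²-cong {z ℂ.* ℂ.inv z z≉0} {ℂ.1#} (ℂ.*-invʳ z z≉0))
        (solve 0 (con (+ 1) :* con (+ 1) :+ con (+ 0) :* con (+ 0) := con (+ 1)) refl))

    unit⇒ : ∀ p {v} → IsUnit (p , v) → ∣ v ∣² ≈ im (proj₁ p) * im (proj₁ p)
    unit⇒ p@((_ , y) , _) {v} e = begin
      ∣ v ∣²                          ≈⟨ *-identityˡ _ ⟨
      1# * ∣ v ∣²                     ≈⟨ *-congʳ (*-invʳ (y * y) y²≉0) ⟨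
      (y * y) * i * ∣ v ∣²            ≈⟨ solve 3 (λ s i n → s :* i :* n := s :* (n :* i)) refl (y * y) i ∣ v ∣² ⟩
      (y * y) * (∣ v ∣² * i)          ≈⟨ *-congˡ e ⟩
      (y * y) * 1#                    ≈⟨ *-identityʳ _ ⟩
      y * y                           ∎
      where
      y²≉0 : y * y ≉ 0#
      y²≉0 = *-nonzero (nonreal p) (nonreal p)
      i : Carrier
      i = inv (y * y) y²≉0

    unit⇐ : ∀ p {v} → ∣ v ∣² ≈ im (proj₁ p) * im (proj₁ p) → IsUnit (p , v)
    unit⇐ p e = trans (*-congʳ e) (*-invʳ _ (*-nonzero (nonreal p) (nonreal p)))

    opaque
      differential-unit : ∀ M p {v} → IsUnit (p , v) → IsUnit (isometry M p , differential M p v)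
      differential-unit M p@(z , _) {v} e = unit⇐ (isometry M p) (begin
        ∣ v ℂ.* (j ℂ.* j) ∣²               ≈⟨ ∣∣²-* v (j ℂ.* j) ⟩
        ∣ v ∣² * ∣ j ℂ.* j ∣²              ≈⟨ *-congˡ (∣∣²-* j j) ⟩
        ∣ v ∣² * (∣ j ∣² * ∣ j ∣²)         ≈⟨ *-congʳ (unit⇒ p e) ⟩
        (y * y) * (∣ j ∣² * ∣ j ∣²)        ≈⟨ *-congʳ (*-cong (im-möbiusℂ M z nz) (im-möbiusℂ M z nz)) ⟨
        ((w * n) * (w * n)) * (∣ j ∣² * ∣ j ∣²)
          ≈⟨ solve 3 (λ w n k → ((w :* n) :* (w :* n)) :* (k :* k) := (w :* w) :* ((n :* k) :* (n :* k)))
               refl w n ∣ j ∣² ⟩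
        (w * w) * ((n * ∣ j ∣²) * (n * ∣ j ∣²))
          ≈⟨ *-congˡ (*-cong (∣inv∣² den (denominator-nonzero M nz)) (∣inv∣² den (denominator-nonzero M nz))) ⟩
        (w * w) * (1# * 1#)                ≈⟨ solve 1 (λ x → x :* (con (+ 1) :* con (+ 1)) := x) refl (w * w) ⟩
        w * w                              ∎)
        where
        nz : im z ≉ 0#
        nz = nonreal p
        den j : C
        den = denominator ℂ (complexify M) z
        j   = ℂ.inv den (denominator-nonzero M nz)
        y w n : Carrier
        y = im z
        w = im (möbiusℂ M z nz)
        n = ∣ den ∣²

    UTℍ²-setoid : Setoid 0ℓ 0ℓ
    UTℍ²-setoid = subsetoid Tℍ²-setoid IsUnit

    module U = Setoid UTℍ²-setoid using (Carrier; _≈_)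

    actᵤ : SL₂ fieldStructure → U.Carrier → U.Carrier
    actᵤ M ((p , v) , e) = (isometry M p , differential M p v) , differential-unit M p e

    opaque
      actᵤ-cong : ∀ {M N x y} → M Gℝ.≈ N → x U.≈ y → actᵤ M x U.≈ actᵤ N y
      actᵤ-cong {M} {N} {((z , z>0) , v) , _} {((w , w>0) , v′) , _} e (z≈w , v≈v′) =
        fractional-cong ℂ {complexify M} {complexify N} {z} {w} e′ z≈w nz nw ,
        ℂ.*-cong {v} {v′} v≈v′ (derivative-cong ℂ {complexify M} {complexify N} {z} {w} e′ z≈w nz nw)
        where
        e′ : complexify M Gℂ.≈ complexify N
        e′ = complexify-cong {M} {N} e
        nz : denominator ℂ (complexify M) z ℂ.≉ ℂ.0#
        nz = denominator-nonzero M (pos⇒nonzero z>0)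
        nw : denominator ℂ (complexify N) w ℂ.≉ ℂ.0#
        nw = denominator-nonzero N (pos⇒nonzero w>0)

      actᵤ-ε : ∀ x → actᵤ Gℝ.ε x U.≈ x
      actᵤ-ε ((p@(z , _) , v) , _) =
        ℂ.trans (fractional-cong ℂ {complexify Gℝ.ε} {Gℂ.ε} {z} {z} complexify-ε ℂ.refl nz nz)
                (fractional-I ℂ z nz) ,
        ℂ.trans (ℂ.*-congˡ {v} (ℂ.trans
                  (derivative-cong ℂ {complexify Gℝ.ε} {Gℂ.ε} {z} {z} complexify-ε ℂ.refl nz nz)
                  (derivative-I ℂ z nz)))
                (ℂ.*-identityʳ v)
        where
        nz : denominator ℂ Gℂ.ε z ℂ.≉ ℂ.0#
        nz = denominator-nonzero Gℝ.ε (nonreal p)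

      actᵤ-∙ : ∀ M N x → actᵤ (M Gℝ.∙ N) x U.≈ actᵤ M (actᵤ N x)
      actᵤ-∙ M N ((p@(z , _) , v) , _) =
        ℂ.trans (fractional-cong ℂ {MN} {CM Gℂ.∙ CN} {z} {z} (complexify-∙ M N) ℂ.refl nz nz′)
                (fractional-∘ ℂ CM CN {z} nzN nzM nz′) ,
        ℂ.trans (ℂ.*-congˡ {v} (ℂ.trans
                  (derivative-cong ℂ {MN} {CM Gℂ.∙ CN} {z} {z} (complexify-∙ M N) ℂ.refl nz nz′)
                  (derivative-∘ ℂ CM CN {z} nzN nzM nz′)))
                (ℂ.sym (ℂ.*-assoc v (derivative ℂ CN z nzN) (derivative ℂ CM w nzM)))
        where
        MN CM CN : SL₂ ℂ
        MN = complexify (M Gℝ.∙ N)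
        CM = complexify M
        CN = complexify N
        w : C
        w = möbiusℂ N z (nonreal p)
        nz : denominator ℂ MN z ℂ.≉ ℂ.0#
        nz = denominator-nonzero (M Gℝ.∙ N) (nonreal p)
        nzN : denominator ℂ CN z ℂ.≉ ℂ.0#
        nzN = denominator-nonzero N (nonreal p)
        nzM : denominator ℂ CM w ℂ.≉ ℂ.0#
        nzM = denominator-nonzero M (nonreal (isometry N p))
        nz′ : denominator ℂ (CM Gℂ.∙ CN) z ℂ.≉ ℂ.0#
        nz′ e = nz (ℂ.trans (ℂ.+-cong (ℂ.*-congʳ (ι-lin _ _ _ _)) (ι-lin _ _ _ _)) e)

  UTℍ² : GSpace PSL₂ℝ
  UTℍ² = record
    { setoid   = UTℍ²-setoid
    ; topology = subspaceTopology Tℍ²-setoid (productTopology ℍ²-topology ℂ-topology) IsUnit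
    ; action   = record
      { _·_        = actᵤ
      ; ·-cong     = λ {M} {N} {x} {y} → actᵤ-cong {M} {N} {x} {y}
      ; ·-identity = actᵤ-ε
      ; ·-assoc    = actᵤ-∙
      }
    }

  -- The norms are squared, so ε and δ stand for the squares of the usual ones.
  -- Near p the Riemannian and the Euclidean norm are equivalent, so the latter
  -- may be used.
  record IsDifferential (f : ℍ² → C) (p : ℍ²) (L : C → C) : Set where
    field
      additive     : ∀ v w → L (v ℂ.+ w) ℂ.≈ L v ℂ.+ L w
      homogeneous  : ∀ t v → L (ι t ℂ.* v) ℂ.≈ ι t ℂ.* L v
      approximates : ∀ {ε} → 0# < ε → ∃ λ δ → 0# < δ × (∀ q →
        let h = proj₁ q ℂ.- proj₁ p in
        ∣ h ∣² < δ → ∣ (f q ℂ.- f p) ℂ.- L h ∣² ≤ ε * ∣ h ∣²)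

  differential-correct : ∀ M p → IsDifferential (proj₁ ∘ isometry M) p (differential M p)
  differential-correct M p@(z , y>0) = record
    { additive     = λ v w → ℂ-distribʳ ∂ v w
    ; homogeneous  = λ t v → ℂ.*-assoc (ι t) v ∂
    ; approximates = λ {ε} ε>0 →
        let (δ , δ>0 , δ≤t² , δ≤εt²N²) = minimum t²>0 (*-pos (*-pos ε>0 t²>0) (*-pos N>0 N>0)) in
        δ , δ>0 , λ q H<δ → estimate ε>0 δ≤t² δ≤εt²N² q H<δ
    }
    where
    open SL₂ M
    ℂ-distribʳ : ∀ x v w → (v ℂ.+ w) ℂ.* x ℂ.≈ v ℂ.* x ℂ.+ w ℂ.* x
    ℂ-distribʳ = CommutativeRing.distribʳ ℂ-ring
    nz : denominator ℂ (complexify M) z ℂ.≉ ℂ.0#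
    nz = denominator-nonzero M (nonreal p)
    l i ∂ : C
    l = denominator ℂ (complexify M) z
    i = ℂ.inv l nz
    ∂ = derivative ℂ (complexify M) z nz
    N E y 2ℝ t : Carrier
    N = ∣ l ∣²
    E = ∣ i ∣²
    y = im z
    2ℝ = 1# + 1#
    2>0 : 0# < 2ℝ
    2>0 = +-pos 1-pos 1-pos
    t = inv 2ℝ (pos⇒nonzero 2>0) * y
    t+t≈y : t + t ≈ y
    t+t≈y = begin
      t + t    ≈⟨ solve 2 (λ k y → k :* y :+ k :* y := (con (+ 2) :* k) :* y) refl
                    (inv 2ℝ (pos⇒nonzero 2>0)) y ⟩
      (2ℝ * inv 2ℝ (pos⇒nonzero 2>0)) * y  ≈⟨ *-congʳ (*-invʳ 2ℝ (pos⇒nonzero 2>0)) ⟩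
      1# * y   ≈⟨ *-identityˡ y ⟩
      y        ∎
    t>0 : 0# < t
    t>0 = pos-cancelˡ 2>0 (pos-resp (trans (sym t+t≈y)
      (solve 1 (λ t → t :+ t := con (+ 2) :* t) refl t)) y>0)
    t²>0 : 0# < t * t
    t²>0 = *-pos t>0 t>0
    N>0 : 0# < N
    N>0 = ∣∣²-pos nz
    NE≈1 : N * E ≈ 1#
    NE≈1 = ∣inv∣² l nz
    -- im q stays at least t = y/2 near p.
    height : ∀ v h₁ → h₁ * h₁ + (v - y) * (v - y) < t * t → NonNeg (v * v - t * t)
    height v h₁ H<t² with compare t v
    ... | tri< t<v _ _ = nonNeg-resp
      (solve 2 (λ t v → (v :- t) :* ((v :- t) :+ (t :+ t)) := v :* v :- t :* t) refl t v)
      (nonNeg-* (inj₁ (<⇒pos t<v)) (inj₁ (+-pos (<⇒pos t<v) (+-pos t>0 t>0))))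
    ... | tri≈ _ t≈v _ = nonNeg-resp (trans (sym (-‿inverseʳ (t * t)))
      (+-congʳ (*-cong t≈v t≈v))) (inj₂ refl)
    ... | tri> _ _ v<t = ⊥-elim (irrefl (sym (-‿inverseʳ (t * t))) (pos-resp
      (solve 3 (λ t v h₁ →
        (t :* t :- (h₁ :* h₁ :+ (v :- (t :+ t)) :* (v :- (t :+ t)))) :+
        (h₁ :* h₁ :+ (((t :- v) :* (t :- v)) :+ (t :+ t) :* (t :- v))) := t :* t :- t :* t)
        refl t v h₁)
      (pos+nonNeg
        (pos-resp (+-congˡ (-‿cong (+-congˡ (*-cong v-y≈ v-y≈)))) (<⇒pos H<t²))
        (nonNeg-+ (square-nonNeg h₁) (nonNeg-+ (square-nonNeg (t - v))
          (nonNeg-* (inj₁ (+-pos t>0 t>0)) (inj₁ (<⇒pos v<t))))))))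
      where
      v-y≈ : v - y ≈ v - (t + t)
      v-y≈ = +-congˡ (-‿cong (sym t+t≈y))
    estimate : ∀ {ε δ} → 0# < ε → δ ≤ t * t → δ ≤ (ε * (t * t)) * (N * N) → ∀ q →
      let h = proj₁ q ℂ.- z in
      ∣ h ∣² < δ →
      ∣ (proj₁ (isometry M q) ℂ.- proj₁ (isometry M p)) ℂ.- differential M p h ∣² ≤ ε * ∣ h ∣²
    estimate {ε} {δ} ε>0 δ≤t² δ≤εt²N² q@(w , w₂>0) H<δ =
      nonNeg⇒≤ (nonNeg-resp (trans final (+-congˡ (-‿cong (sym norm)))) (nonNeg-* H≥0 step₄))
      where
      nw : denominator ℂ (complexify M) w ℂ.≉ ℂ.0#
      nw = denominator-nonzero M (nonreal q)
      h μ j : C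
      h = w ℂ.- z
      μ = denominator ℂ (complexify M) w
      j = ℂ.inv μ nw
      H J v : Carrier
      H = ∣ h ∣²
      J = ∣ j ∣²
      v = im w
      H≥0 : NonNeg H
      H≥0 = nonNeg-+ (square-nonNeg (re h)) (square-nonNeg (im h))
      J≥0 : NonNeg J
      J≥0 = nonNeg-+ (square-nonNeg (re j)) (square-nonNeg (im j))
      E²≥0 : NonNeg (E * E)
      E²≥0 = square-nonNeg E
      μJ≈1 : ∣ μ ∣² * J ≈ 1#
      μJ≈1 = ∣inv∣² μ nw
      norm : ∣ (proj₁ (isometry M q) ℂ.- proj₁ (isometry M p)) ℂ.- differential M p h ∣² ≈
             (c * c) * (H * H) * (J * (E * E))
      norm = begin
        ∣ (proj₁ (isometry M q) ℂ.- proj₁ (isometry M p)) ℂ.- differential M p h ∣²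
          ≈⟨ ∣∣²-cong (fractional-remainder ℂ (complexify M) z w nz nw) ⟩
        ∣ (ℂ.- (ι c ℂ.* (h ℂ.* h))) ℂ.* (j ℂ.* (i ℂ.* i)) ∣²
          ≈⟨ trans (∣∣²-* (ℂ.- (ι c ℂ.* (h ℂ.* h))) (j ℂ.* (i ℂ.* i)))
               (*-cong (∣∣²-neg (ι c ℂ.* (h ℂ.* h))) (∣∣²-* j (i ℂ.* i))) ⟩
        ∣ ι c ℂ.* (h ℂ.* h) ∣² * (J * ∣ i ℂ.* i ∣²)
          ≈⟨ *-cong (trans (∣∣²-* (ι c) (h ℂ.* h)) (*-congˡ (∣∣²-* h h))) (*-congˡ (∣∣²-* i i)) ⟩
        ((c * c + 0# * 0#) * (H * H)) * (J * (E * E))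
          ≈⟨ *-congʳ (*-congʳ (solve 1 (λ c → c :* c :+ con (+ 0) :* con (+ 0) := c :* c) refl c)) ⟩
        (c * c) * (H * H) * (J * (E * E)) ∎
        where
        ∣∣²-neg : ∀ x → ∣ ℂ.- x ∣² ≈ ∣ x ∣²
        ∣∣²-neg (x₁ , x₂) = solve 2 (λ a b → (:- a) :* (:- a) :+ (:- b) :* (:- b) := a :* a :+ b :* b)
          refl x₁ x₂
      step₁ : NonNeg (v * v - t * t)
      step₁ = height v (re h) (H<δ ≤-trans′ δ≤t²)
        where
        _≤-trans′_ : ∀ {a b c} → a < b → b ≤ c → a < c
        a<b ≤-trans′ inj₁ b<c = <-trans a<b b<c
        a<b ≤-trans′ inj₂ b≈c = <-respʳ-≈ b≈c a<b
      step₂ : NonNeg (ε * (t * t) - H * (E * E))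
      step₂ = nonNeg-resp (begin
        (δ - H) * (E * E) + ((ε * (t * t)) * (N * N) - δ) * (E * E)
          ≈⟨ solve 5 (λ δ H k N E →
               (δ :- H) :* (E :* E) :+ (k :* (N :* N) :- δ) :* (E :* E) :=
               k :* ((N :* E) :* (N :* E)) :- H :* (E :* E)) refl δ H (ε * (t * t)) N E ⟩
        (ε * (t * t)) * ((N * E) * (N * E)) - H * (E * E)
          ≈⟨ +-congʳ (*-congˡ (trans (*-cong NE≈1 NE≈1) (*-identityˡ 1#))) ⟩
        (ε * (t * t)) * 1# - H * (E * E)
          ≈⟨ +-congʳ (*-identityʳ _) ⟩
        ε * (t * t) - H * (E * E) ∎)
        (nonNeg-+ (nonNeg-* (inj₁ (<⇒pos H<δ)) E²≥0) (nonNeg-* (≤⇒nonNeg δ≤εt²N²) E²≥0))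
      step₃ : NonNeg (1# - (c * c) * J * (v * v))
      step₃ = nonNeg-resp (begin
        J * (re μ * re μ)
          ≈⟨ solve 5 (λ J c d x v →
               J :* (((c :* x :- con (+ 0) :* v) :+ d) :* ((c :* x :- con (+ 0) :* v) :+ d)) :=
               (((c :* x :- con (+ 0) :* v) :+ d) :* ((c :* x :- con (+ 0) :* v) :+ d) :+
                ((c :* v :+ con (+ 0) :* x) :+ con (+ 0)) :* ((c :* v :+ con (+ 0) :* x) :+ con (+ 0))) :* J
               :- (c :* c) :* J :* (v :* v)) refl J c d (re w) v ⟩
        ∣ μ ∣² * J - (c * c) * J * (v * v)
          ≈⟨ +-congʳ μJ≈1 ⟩
        1# - (c * c) * J * (v * v) ∎)
        (nonNeg-* J≥0 (square-nonNeg (re μ)))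
      step₄ : NonNeg (ε - (c * c) * J * (H * (E * E)))
      step₄ = nonNeg-resp
        (solve 5 (λ ε k v T X →
          ε :* (con (+ 1) :- k :* v) :+ k :* (ε :* (v :- T) :+ (ε :* T :- X)) := ε :- k :* X)
          refl ε ((c * c) * J) (v * v) (t * t) (H * (E * E)))
        (nonNeg-+ (nonNeg-* (inj₁ ε>0) step₃)
          (nonNeg-* (nonNeg-* (square-nonNeg c) J≥0)
            (nonNeg-+ (nonNeg-* (inj₁ ε>0) step₁) step₂)))
      final : H * (ε - (c * c) * J * (H * (E * E))) ≈ ε * H - (c * c) * (H * H) * (J * (E * E))
      final = solve 5 (λ ε k H J E² →
        H :* (ε :- k :* J :* (H :* E²)) := ε :* H :- k :* (H :* H) :* (J :* E²))
        refl ε (c * c) H J (E * E)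

{-# OPTIONS --safe #-}
module Submission where

-- Both spaces are compared with ℝℙ¹ × ℍ², the pairs of a real root r and the
-- root z in the upper half plane. The pair (r, z) corresponds to the cubic
-- (tX - sY)(X - zY)(X - z̄Y) for r = [s : t], to the root set {r, z, z̄}, and to
-- the unit vector at z whose geodesic ray ends at r. With ω = s - tz this vector
-- is v = i y ω / ω̄. A matrix acting with cocycle j = cz + d divides ω by j and y
-- by |j|², hence v by j², which is the action on tangent vectors.
--
-- For continuity, each topology involved is described by a system of balls, one
-- construction (product, power, subspace, quotient) at a time, so that all
-- arguments become ε-δ estimates. That the roots depend continuously on the cubic
-- holds because the real root is simple, so that the form changes sign there, and
-- because the remaining quadratic factor is a rational function of the
-- coefficients and the real root.

open import Axiom.ExcludedMiddle using (ExcludedMiddle)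
open import Data.Product.Base using (_×_)
open import Defs

open import Level using (0ℓ)
open import Algebra.Bundles using (Group)
open import Data.Empty using (⊥; ⊥-elim)
open import Data.Fin.Base using (Fin; zero; suc)
open import Data.Fin.Patterns using (0F; 1F; 2F; 3F; 4F; 5F; 6F; 7F; 8F)
import Data.Fin.Permutation as Perm
open import Data.Integer.Base using (+_)
open import Data.Nat.Base using (ℕ; zero; suc)
open import Data.Product.Base using (Σ-syntax; ∃; _,_; proj₁; proj₂)
open import Data.Product.Relation.Binary.Pointwise.NonDependent using (×-setoid)
open import Data.Sum.Base using (_⊎_; inj₁; inj₂)
open import Data.Vec.Base using (Vec; lookup) renaming ([] to []ᵛ; _∷_ to _∷ᵛ_)
open import Data.Vec.Functional using (Vector; []; _∷_)
open import Function.Base using (_∘_)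
open import Function.Bundles using (Inverse; Equivalence; mk⇔)
open import Relation.Binary.Bundles using (Setoid)
open import Relation.Binary.Definitions using (tri<; tri≈; tri>)
import Relation.Binary.PropositionalEquality as ≡
open import Relation.Binary.Structures using (IsEquivalence)
open import Relation.Nullary using (¬_)
open import Relation.Unary using (Pred)

-- The inverse maps are defined by case distinctions on signs, so they are not given by one
-- continuous formula. Continuity of an inverse is therefore reduced to a statement about the map f
-- itself: if f x′ is near f x, then x′ is near x. Nearness in a projective space asks for a
-- representative near the given one, so each of these proofs has to produce a representative of r′
-- close to the fixed representative of r: by a linear projection, as a zero between two points on
-- either side of r, or as the real part of a complex vector. It is then identified with r′ by an
-- equation that determines the point.
--
-- The formula for v is forced by equivariance. For r = [1 : 0] one has ω = 1, and v = i y is the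
-- upward unit vector, whose ray ends at infinity. The quotient ω / ω̄ does not change when s and t
-- are multiplied by a real factor, so v depends on the point r alone.

module Analysis (ℝ : CompleteOrderedField) where
  open CompleteOrderedField ℝ
  open OrderProperties ℝ
  open IntegerSolver commutativeRing
  open import Algebra.Properties.Semiring.Exp semiring using (_^_)

  -- Estimates in an ordered field.

  2>0 : 0# < 1# + 1#
  2>0 = +-pos 1-pos 1-pos

  halve : ∀ {ε} → 0# < ε → ∃ λ δ → 0# < δ × δ + δ ≈ ε
  halve {ε} ε>0 = h , pos-cancelˡ 2>0 (pos-resp (sym 2h≈ε) ε>0) ,
    trans (solve 1 (λ h → h :+ h := con (+ 2) :* h) refl h) 2h≈ε
    where
    h : Carrier
    h = inv (1# + 1#) (pos⇒nonzero 2>0) * ε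
    2h≈ε : (1# + 1#) * h ≈ ε
    2h≈ε = trans (sym (*-assoc _ _ _)) (trans (*-congʳ (*-invʳ _ _)) (*-identityˡ ε))

  ≤-<-trans : ∀ {x y z} → x ≤ y → y < z → x < z
  ≤-<-trans (inj₁ p) q = <-trans p q
  ≤-<-trans (inj₂ e) q = <-respˡ-≈ (sym e) q

  ≤-trans : ∀ {x y z} → x ≤ y → y ≤ z → x ≤ z
  ≤-trans p        (inj₁ q) = inj₁ (≤-<-trans p q)
  ≤-trans (inj₁ p) (inj₂ e) = inj₁ (<-respʳ-≈ e p)
  ≤-trans (inj₂ d) (inj₂ e) = inj₂ (trans d e)

  <-irrefl : ∀ {x} → ¬ x < x
  <-irrefl = irrefl refl

  -- This is |h| < ε without absolute values. With two positivity conditions, an estimate becomes a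
  -- ring identity that writes the required quantity as a sum of products of positive ones.
  Small : Carrier → Carrier → Set
  Small ε h = 0# < ε + h × 0# < ε - h

  small-resp : ∀ {ε h k} → h ≈ k → Small ε h → Small ε k
  small-resp e (p , q) = pos-resp (+-congˡ e) p , pos-resp (+-congˡ (-‿cong e)) q

  small-0 : ∀ {ε} → 0# < ε → Small ε 0#
  small-0 {ε} p = pos-resp (solve 1 (λ ε → ε := ε :+ con (+ 0)) refl ε) p ,
                  pos-resp (solve 1 (λ ε → ε := ε :- con (+ 0)) refl ε) p

  small-neg : ∀ {ε h} → Small ε h → Small ε (- h)
  small-neg {ε} {h} (p , q) = q , pos-resp (solve 2 (λ ε h → ε :+ h := ε :- :- h) refl ε h) p

  small-mono : ∀ {ε δ h} → ε ≤ δ → Small ε h → Small δ h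
  small-mono {ε} {δ} {h} le (p , q) =
    pos-resp (solve 3 (λ ε δ h → (ε :+ h) :+ (δ :- ε) := δ :+ h) refl ε δ h)
      (pos+nonNeg p (≤⇒nonNeg le)) ,
    pos-resp (solve 3 (λ ε δ h → (ε :- h) :+ (δ :- ε) := δ :- h) refl ε δ h)
      (pos+nonNeg q (≤⇒nonNeg le))

  small-+ : ∀ {ε δ h k} → Small ε h → Small δ k → Small (ε + δ) (h + k)
  small-+ {ε} {δ} {h} {k} (p , q) (p′ , q′) =
    pos-resp (solve 4 (λ ε δ h k → (ε :+ h) :+ (δ :+ k) := (ε :+ δ) :+ (h :+ k)) refl ε δ h k)
      (+-pos p p′) ,
    pos-resp (solve 4 (λ ε δ h k → (ε :- h) :+ (δ :- k) := (ε :+ δ) :- (h :+ k)) refl ε δ h k)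
      (+-pos q q′)

  -- Twice εδ + hk is (ε + h)(δ + k) + (ε - h)(δ - k), and similarly for εδ - hk, so no signs have
  -- to be distinguished.
  small-* : ∀ {ε δ h k} → Small ε h → Small δ k → Small (ε * δ) (h * k)
  small-* {ε} {δ} {h} {k} (p , q) (p′ , q′) =
    pos-cancelˡ 2>0 (pos-resp
      (solve 4 (λ ε δ h k → (ε :+ h) :* (δ :+ k) :+ (ε :- h) :* (δ :- k) :=
        con (+ 2) :* (ε :* δ :+ h :* k)) refl ε δ h k)
      (+-pos (*-pos p p′) (*-pos q q′))) ,
    pos-cancelˡ 2>0 (pos-resp
      (solve 4 (λ ε δ h k → (ε :+ h) :* (δ :- k) :+ (ε :- h) :* (δ :+ k) :=
        con (+ 2) :* (ε :* δ :- h :* k)) refl ε δ h k)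
      (+-pos (*-pos p q′) (*-pos q p′)))

  small-pos : ∀ {ε h} → Small ε h → 0# < ε
  small-pos {ε} {h} (p , q) = pos-cancelˡ 2>0 (pos-resp
    (solve 2 (λ ε h → (ε :+ h) :+ (ε :- h) := con (+ 2) :* ε) refl ε h) (+-pos p q))

  -- A polynomial bound in place of |x|: twice 1 + x² ± x is 1 + x² + (1 ± x)².
  bounded : ∀ x → Small (1# + x * x) x
  bounded x =
    pos-cancelˡ 2>0 (pos-resp
      (solve 1 (λ x → con (+ 1) :+ (x :* x :+ (con (+ 1) :+ x) :* (con (+ 1) :+ x)) :=
        con (+ 2) :* ((con (+ 1) :+ x :* x) :+ x)) refl x)
      (pos+nonNeg 1-pos (nonNeg-+ (square-nonNeg x) (square-nonNeg (1# + x))))) ,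
    pos-cancelˡ 2>0 (pos-resp
      (solve 1 (λ x → con (+ 1) :+ (x :* x :+ (con (+ 1) :- x) :* (con (+ 1) :- x)) :=
        con (+ 2) :* ((con (+ 1) :+ x :* x) :- x)) refl x)
      (pos+nonNeg 1-pos (nonNeg-+ (square-nonNeg x) (square-nonNeg (1# - x)))))

  -- The form in which `IsOpenℝ` describes an interval; estimates are done with `Small`.
  Close : Carrier → Carrier → Carrier → Set
  Close ε x y = x - ε < y × y < x + ε

  close⇒small : ∀ {ε x y} → Close ε x y → Small ε (y - x)
  close⇒small {ε} {x} {y} (p , q) =
    pos-resp (solve 3 (λ ε x y → y :- (x :- ε) := ε :+ (y :- x)) refl ε x y) (<⇒pos p) ,
    pos-resp (solve 3 (λ ε x y → (x :+ ε) :- y := ε :- (y :- x)) refl ε x y) (<⇒pos q)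

  small⇒close : ∀ {ε x y} → Small ε (y - x) → Close ε x y
  small⇒close {ε} {x} {y} (p , q) =
    pos⇒< (pos-resp (solve 3 (λ ε x y → ε :+ (y :- x) := y :- (x :- ε)) refl ε x y) p) ,
    pos⇒< (pos-resp (solve 3 (λ ε x y → ε :- (y :- x) := (x :+ ε) :- y) refl ε x y) q)

  close-refl : ∀ {ε x y} → 0# < ε → x ≈ y → Close ε x y
  close-refl {x = x} ε>0 e = small⇒close
    (small-resp (trans (sym (-‿inverseʳ x)) (+-congʳ e)) (small-0 ε>0))

  close-mono : ∀ {ε δ x y} → ε ≤ δ → Close ε x y → Close δ x y
  close-mono le c = small⇒close (small-mono le (close⇒small c))

  close-resp : ∀ {ε x y x′ y′} → x ≈ x′ → y ≈ y′ → Close ε x y → Close ε x′ y′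
  close-resp e f c = small⇒close (small-resp (+-cong f (-‿cong e)) (close⇒small c))

  close-neg : ∀ {ε x y} → Close ε x y → Close ε (- x) (- y)
  close-neg {x = x} {y} c = small⇒close (small-resp
    (solve 2 (λ x y → :- (y :- x) := (:- y) :- (:- x)) refl x y) (small-neg (close⇒small c)))

  -- The radius is the distance from y to the nearer end of the interval.
  close-open : ∀ {ε x y} → Close ε x y → ∃ λ δ → 0# < δ × (∀ {z} → Close δ y z → Close ε x z)
  close-open {ε} {x} {y} c =
    let (p , q) = close⇒small c
        (δ , δ>0 , δ≤p , δ≤q) = minimum p q
    in δ , δ>0 , λ {z} d → let (a , b) = close⇒small d in small⇒close
      ( pos-resp (solve 5 (λ ε x y z δ →
          (δ :+ (z :- y)) :+ ((ε :+ (y :- x)) :- δ) := ε :+ (z :- x)) refl ε x y z δ)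
          (pos+nonNeg a (≤⇒nonNeg δ≤p))
      , pos-resp (solve 5 (λ ε x y z δ →
          (δ :- (z :- y)) :+ ((ε :- (y :- x)) :- δ) := ε :- (z :- x)) refl ε x y z δ)
          (pos+nonNeg b (≤⇒nonNeg δ≤q)))

  -- With the value itself as radius, nearness preserves the sign. Later, signs of polynomial values
  -- are carried to nearby arguments in this way.
  close-pos : ∀ {x y} → Close x x y → 0# < y
  close-pos {x} {y} c = pos-resp (solve 2 (λ x y → x :+ (y :- x) := y) refl x y)
    (proj₁ (close⇒small c))

  close-nonzero : ∀ {x} → x ≉ 0# → ∃ λ δ → 0# < δ × (∀ {y} → Close δ x y → y ≉ 0#)
  close-nonzero {x} x≉0 with compare 0# x
  ... | tri< p _ _ = x , p , λ c → pos⇒nonzero (close-pos c)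
  ... | tri≈ _ e _ = ⊥-elim (x≉0 (sym e))
  ... | tri> _ _ n = - x , neg⇒pos n , λ {y} c y≈0 → pos⇒nonzero (close-pos (close-neg c))
    (trans (-‿cong y≈0) (solve 0 (:- con (+ 0) := con (+ 0)) refl))

  -- Continuity of polynomials and of their quotients.

  CloseVec : ∀ {n} → Carrier → Vec Carrier n → Vec Carrier n → Set
  CloseVec ε ρ ρ′ = ∀ i → Close ε (lookup ρ i) (lookup ρ′ i)

  ContinuousAt : ∀ {n} → (Vec Carrier n → Carrier) → Vec Carrier n → Set
  ContinuousAt F ρ = ∀ {ε} → 0# < ε →
    ∃ λ δ → 0# < δ × (∀ {ρ′} → CloseVec δ ρ ρ′ → Close ε (F ρ) (F ρ′))

  module _ {n : ℕ} {ρ : Vec Carrier n} where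

    const-continuous : ∀ x → ContinuousAt (λ _ → x) ρ
    const-continuous x ε>0 = 1# , 1-pos , λ _ → close-refl ε>0 refl

    +-continuous : ∀ {F G} → ContinuousAt F ρ → ContinuousAt G ρ → ContinuousAt (λ ρ → F ρ + G ρ) ρ
    +-continuous {F} {G} cF cG ε>0 =
      let (h , h>0 , 2h≈ε)        = halve ε>0
          (δ₁ , δ₁>0 , c₁)        = cF h>0
          (δ₂ , δ₂>0 , c₂)        = cG h>0
          (δ , δ>0 , δ≤δ₁ , δ≤δ₂) = minimum δ₁>0 δ₂>0
      in δ , δ>0 , λ {ρ′} c → small⇒close (small-mono (inj₂ 2h≈ε) (small-resp
        (solve 4 (λ a b c d → (c :- a) :+ (d :- b) := (c :+ d) :- (a :+ b)) refl
          (F ρ) (G ρ) (F ρ′) (G ρ′))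
        (small-+ (close⇒small (c₁ λ i → close-mono δ≤δ₁ (c i)))
                 (close⇒small (c₂ λ i → close-mono δ≤δ₂ (c i))))))

    neg-continuous : ∀ {F} → ContinuousAt F ρ → ContinuousAt (λ ρ → - F ρ) ρ
    neg-continuous cF ε>0 = let (δ , δ>0 , c) = cF ε>0 in δ , δ>0 , λ d → close-neg (c d)

    *-continuous : ∀ {F G} → ContinuousAt F ρ → ContinuousAt G ρ → ContinuousAt (λ ρ → F ρ * G ρ) ρ
    *-continuous {F} {G} cF cG {ε} ε>0 =
      -- The error is at most Xη + Yη + η². Since η ≤ 1 gives η² ≤ η, it is at most Mη with M = X +
      -- Y + 1, hence at most ε.
      let (η , η>0 , η≤1 , η≤ε/M)  = minimum 1-pos (*-pos ε>0 M⁻¹>0)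
          (δ₁ , δ₁>0 , c₁)        = cF η>0
          (δ₂ , δ₂>0 , c₂)        = cG η>0
          (δ , δ>0 , δ≤δ₁ , δ≤δ₂) = minimum δ₁>0 δ₂>0
      in δ , δ>0 , λ {ρ′} c →
        let h = close⇒small (c₁ λ i → close-mono δ≤δ₁ (c i))
            k = close⇒small (c₂ λ i → close-mono δ≤δ₂ (c i))
        in small⇒close (small-mono (bound η>0 η≤1 η≤ε/M) (small-resp
          (solve 4 (λ a b c d → a :* (d :- b) :+ (b :* (c :- a) :+ (c :- a) :* (d :- b))
                                  := c :* d :- a :* b) refl (F ρ) (G ρ) (F ρ′) (G ρ′))
          (small-+ (small-* (bounded (F ρ)) k)
            (small-+ (small-* (bounded (G ρ)) h) (small-* h k)))))
      where
      X Y M M⁻¹ : Carrier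
      X = 1# + F ρ * F ρ
      Y = 1# + G ρ * G ρ
      M = X + (Y + 1#)
      M>0 : 0# < M
      M>0 = +-pos (small-pos (bounded (F ρ))) (+-pos (small-pos (bounded (G ρ))) 1-pos)
      M⁻¹ = inv M (pos⇒nonzero M>0)
      MM⁻¹≈1 : M * M⁻¹ ≈ 1#
      MM⁻¹≈1 = *-invʳ M (pos⇒nonzero M>0)
      M⁻¹>0 : 0# < M⁻¹
      M⁻¹>0 = pos-cancelˡ M>0 (pos-resp (sym MM⁻¹≈1) 1-pos)
      bound : ∀ {η} → 0# < η → η ≤ 1# → η ≤ ε * M⁻¹ → X * η + (Y * η + η * η) ≤ ε
      bound {η} η>0 η≤1 η≤ε/M = nonNeg⇒≤ (nonNeg-resp
        (trans (solve 6 (λ e M i X Y η →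
            (X :+ (Y :+ con (+ 1))) :* (e :* i :- η) :+ η :* (con (+ 1) :- η) :=
            e :* ((X :+ (Y :+ con (+ 1))) :* i) :- (X :* η :+ (Y :* η :+ η :* η)))
            refl ε M M⁻¹ X Y η)
          (+-congʳ (trans (*-congˡ MM⁻¹≈1) (*-identityʳ ε))))
        (nonNeg-+ (nonNeg-* (inj₁ M>0) (≤⇒nonNeg η≤ε/M))
                  (nonNeg-* (inj₁ η>0) (≤⇒nonNeg η≤1))))

    ^-continuous : ∀ {F} → ContinuousAt F ρ → ∀ k → ContinuousAt (λ ρ → F ρ ^ k) ρ
    ^-continuous cF zero    = const-continuous 1#
    ^-continuous {F} cF (suc k) = *-continuous {F} {λ ρ → F ρ ^ k} cF (^-continuous cF k)

    opaque
      -- Induction on the syntax of the ring solver. An explicit formula is shown to be continuous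
      -- by exhibiting it as the value of a `Polynomial`.
      polynomial-continuous : ∀ p → ContinuousAt ⟦ p ⟧ₚ ρ
      polynomial-continuous (op [+] p q) =
        +-continuous {⟦ p ⟧ₚ} {⟦ q ⟧ₚ} (polynomial-continuous p) (polynomial-continuous q)
      polynomial-continuous (op [*] p q) =
        *-continuous {⟦ p ⟧ₚ} {⟦ q ⟧ₚ} (polynomial-continuous p) (polynomial-continuous q)
      polynomial-continuous (con c)      = const-continuous _
      polynomial-continuous (var i)      = λ ε>0 → _ , ε>0 , λ c → c i
      polynomial-continuous (p :^ k)     = ^-continuous (polynomial-continuous p) k
      polynomial-continuous (:- p)       = neg-continuous {⟦ p ⟧ₚ} (polynomial-continuous p)

      -- The quotient is given by its equation, so nothing is divided. Nearby, p′ stays above c =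
      -- p/2 and q′ - p′x differs from q - px = 0 by less than cε; the difference is p′(x′ - x), so
      -- |x′ - x| < ε.
      quotient-continuous : ∀ p q {x ε} → 0# < ⟦ p ⟧ₚ ρ → ⟦ p ⟧ₚ ρ * x ≈ ⟦ q ⟧ₚ ρ → 0# < ε →
        ∃ λ δ → 0# < δ × (∀ {ρ′ x′} → CloseVec δ ρ ρ′ → ⟦ p ⟧ₚ ρ′ * x′ ≈ ⟦ q ⟧ₚ ρ′ → Close ε x x′)
      quotient-continuous p q {x} {ε} p>0 px≈q ε>0 =
        let (c , c>0 , 2c≈p)        = halve p>0
            (δ₁ , δ₁>0 , c₁)        = polynomial-continuous p c>0
            (δ₂ , δ₂>0 , c₂)        = remainder-continuous (*-pos c>0 ε>0)
            (δ , δ>0 , δ≤δ₁ , δ≤δ₂) = minimum δ₁>0 δ₂>0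
        in δ , δ>0 , λ {ρ′} {x′} d p′x′≈q′ →
          let p′   = ⟦ p ⟧ₚ ρ′
              p′>c : 0# < p′ - c
              p′>c = pos-resp (trans (+-congˡ (+-congˡ (-‿cong (sym 2c≈p))))
                       (solve 2 (λ c p′ → c :+ (p′ :- (c :+ c)) := p′ :- c) refl c p′))
                     (proj₁ (close⇒small (c₁ λ i → close-mono δ≤δ₁ (d i))))
              p′>0 : 0# < p′
              p′>0 = pos-resp (solve 2 (λ c p′ → (p′ :- c) :+ c := p′) refl c p′) (+-pos p′>c c>0)
              rem≈ : (⟦ q ⟧ₚ ρ′ - p′ * x) - (⟦ q ⟧ₚ ρ - ⟦ p ⟧ₚ ρ * x) ≈ p′ * (x′ - x)
              rem≈ = trans (+-cong (+-congʳ (sym p′x′≈q′)) (-‿cong (+-congʳ (sym px≈q))))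
                (solve 4 (λ p′ p x x′ → (p′ :* x′ :- p′ :* x) :- (p :* x :- p :* x) := p′ :* (x′ :- x))
                  refl p′ (⟦ p ⟧ₚ ρ) x x′)
              (a , b) = small-resp rem≈ (close⇒small (c₂ λ i → close-mono δ≤δ₂ (d i)))
          in small⇒close
            ( pos-cancelˡ p′>0 (pos-resp (solve 4 (λ c e p h →
                (c :* e :+ p :* h) :+ (p :- c) :* e := p :* (e :+ h)) refl c ε p′ (x′ - x))
                (+-pos a (*-pos p′>c ε>0)))
            , pos-cancelˡ p′>0 (pos-resp (solve 4 (λ c e p h →
                (c :* e :- p :* h) :+ (p :- c) :* e := p :* (e :- h)) refl c ε p′ (x′ - x))
                (+-pos b (*-pos p′>c ε>0))))
        where
        remainder-continuous : ContinuousAt (λ ρ → ⟦ q ⟧ₚ ρ - ⟦ p ⟧ₚ ρ * x) ρ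
        remainder-continuous = +-continuous {⟦ q ⟧ₚ} {λ ρ → - (⟦ p ⟧ₚ ρ * x)}
          (polynomial-continuous q)
          (neg-continuous {λ ρ → ⟦ p ⟧ₚ ρ * x}
            (*-continuous {⟦ p ⟧ₚ} {λ _ → x} (polynomial-continuous p) (const-continuous x)))

  -- The hypothesis says (x + y)|y - x| < εx, and εx < ε(x + y). Cancelling x + y needs no lower
  -- bound on y beyond its positivity.
  root-close : ∀ {x y ε} → 0# < x → 0# < y → 0# < ε → Close (ε * x) (x * x) (y * y) → Close ε x y
  root-close {x} {y} {ε} x>0 y>0 ε>0 c = small⇒close (lower , upper)
    where
    a : 0# < ε * x + (y * y - x * x)
    a = proj₁ (close⇒small c)
    b : 0# < ε * x - (y * y - x * x)
    b = proj₂ (close⇒small c)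
    s>0 : 0# < x + y
    s>0 = +-pos x>0 y>0
    εy>0 : 0# < ε * y
    εy>0 = *-pos ε>0 y>0
    lower : 0# < ε + (y - x)
    lower = pos-cancelˡ s>0 (pos-resp (solve 3 (λ ε x y →
      (ε :* x :+ (y :* y :- x :* x)) :+ ε :* y := (x :+ y) :* (ε :+ (y :- x))) refl ε x y)
      (+-pos a εy>0))
    upper : 0# < ε - (y - x)
    upper = pos-cancelˡ s>0 (pos-resp (solve 3 (λ ε x y →
      (ε :* x :- (y :* y :- x :* x)) :+ ε :* y := (x :+ y) :* (ε :- (y :- x))) refl ε x y)
      (+-pos b εy>0))

  -- c is the supremum of the points up to h at which φ is negative. If φ c were negative, c could
  -- be exceeded; if it were positive, c - δ would be a smaller bound. Completeness of ℝ enters the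
  -- proof here, and through this lemma it yields square roots and real roots of cubics.
  intermediate-value : (φ : Carrier → Carrier) →
    (∀ x {ε} → 0# < ε → ∃ λ δ → 0# < δ × (∀ {y} → Close δ x y → Close ε (φ x) (φ y))) →
    ∀ {l h} → l < h → φ l < 0# → 0# < φ h → ∃ λ c → l ≤ c × c ≤ h × φ c ≈ 0#
  intermediate-value φ φ-continuous {l} {h} l<h φl<0 φh>0 = c , l≤c , c≤h , φc≈0
    where
    P : Carrier → Set
    P x = x ≤ h × φ x < 0#
    supremum = complete P (l , inj₁ l<h , φl<0) (h , proj₁)
    c : Carrier
    c = proj₁ supremum
    l≤c : l ≤ c
    l≤c = proj₁ (proj₂ supremum) (inj₁ l<h , φl<0)
    c≤h : c ≤ h
    c≤h = proj₂ (proj₂ supremum) proj₁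

    stays-negative : φ c < 0# → ∃ λ δ → 0# < δ × (∀ {y} → Close δ c y → φ y < 0#)
    stays-negative n = let (δ , δ>0 , k) = φ-continuous c (neg⇒pos n) in
      δ , δ>0 , λ d → <-respʳ-≈ (-‿inverseʳ (φ c)) (proj₂ (k d))

    not-negative : ¬ φ c < 0#
    not-negative n with stays-negative n
    ... | δ , δ>0 , k with halve δ>0
    ... | η , η>0 , 2η≈δ = case-on
      where
      still-negative : φ (c + η) < 0#
      still-negative = k (small⇒close
        ( pos-resp (solve 3 (λ δ c η → δ :+ η := δ :+ ((c :+ η) :- c)) refl δ c η) (+-pos δ>0 η>0)
        , pos-resp (trans (solve 2 (λ c η → η := (η :+ η) :- ((c :+ η) :- c)) refl c η) (+-congʳ 2η≈δ))
            η>0))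
      c+η≰h : ¬ c + η ≤ h
      c+η≰h le = <-irrefl (≤-<-trans (proj₁ (proj₂ supremum) (le , still-negative))
        (pos⇒< (pos-resp (solve 2 (λ c η → η := (c :+ η) :- c) refl c η) η>0)))
      case-on : ⊥
      case-on with compare h (c + η)
      ... | tri≈ _ e _ = c+η≰h (inj₂ (sym e))
      ... | tri> _ _ p = c+η≰h (inj₁ p)
      -- If c + η overshoots h, then h itself lies within δ of c, and φ h would be negative.
      ... | tri< p _ _ = <-irrefl (<-trans φh>0 (k (small⇒close
        ( pos+nonNeg δ>0 (≤⇒nonNeg c≤h)
        , pos-resp (trans (solve 3 (λ c h η → ((c :+ η) :- h) :+ η := (η :+ η) :- (h :- c)) refl c h η)
                     (+-congʳ 2η≈δ)) (+-pos (<⇒pos p) η>0)))))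

    not-positive : ¬ 0# < φ c
    not-positive p with φ-continuous c p
    ... | δ , δ>0 , k = <-irrefl (≤-<-trans (proj₂ (proj₂ supremum) bound)
        (pos⇒< (pos-resp (solve 2 (λ c δ → δ := c :- (c :- δ)) refl c δ) δ>0)))
      where
      bound : ∀ {x} → P x → x ≤ c - δ
      bound {x} Px with compare x (c - δ)
      ... | tri< q _ _ = inj₁ q
      ... | tri≈ _ e _ = inj₂ e
      ... | tri> _ _ q = ⊥-elim (<-irrefl (<-trans (proj₂ Px)
        (<-respˡ-≈ (-‿inverseʳ (φ c)) (proj₁ (k (q , pos⇒< (pos-resp
          (solve 3 (λ c x δ → δ :+ (c :- x) := (c :+ δ) :- x) refl c x δ)
          (pos+nonNeg δ>0 (≤⇒nonNeg (proj₁ (proj₂ supremum) Px))))))))))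

    φc≈0 : φ c ≈ 0#
    φc≈0 with compare (φ c) 0#
    ... | tri< n _ _ = ⊥-elim (not-negative n)
    ... | tri≈ _ e _ = e
    ... | tri> _ _ p = ⊥-elim (not-positive p)

-- Describing topologies by balls.

module Topologies (ℝ : CompleteOrderedField) where
  open CompleteOrderedField ℝ using (Carrier; _<_; _≤_; 0#; 1#)
  open OrderProperties ℝ using (minimum; 1-pos)
  open Analysis ℝ using (Close; close-refl; close-mono; close-open; ≤-trans)

  minimumᵥ : ∀ {n} (ε : Fin n → Carrier) → (∀ i → 0# < ε i) →
    ∃ λ δ → 0# < δ × (∀ i → δ ≤ ε i)
  minimumᵥ {zero}  ε ε>0 = 1# , 1-pos , λ ()
  minimumᵥ {suc n} ε ε>0 =
    let (δ , δ>0 , δ≤) = minimumᵥ (ε ∘ suc) (ε>0 ∘ suc)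
        (η , η>0 , η≤ε , η≤δ) = minimum (ε>0 zero) δ>0
    in η , η>0 , λ { zero → η≤ε ; (suc i) → ≤-trans η≤δ (δ≤ i) }

  -- Near ε x is the ball of radius ε around x; the balls form a basis of the
  -- topology, but they need not come from a metric.
  record Nearness {S : Setoid 0ℓ 0ℓ} (τ : Topology S) : Set₁ where
    open Setoid S using (_≈_) renaming (Carrier to X)
    open Topology τ using (Open)
    field
      Near        : Carrier → X → X → Set
      near-refl   : ∀ {ε x y} → 0# < ε → x ≈ y → Near ε x y
      near-mono   : ∀ {ε δ x y} → ε ≤ δ → Near ε x y → Near δ x y
      near-open   : ∀ {ε x y} → Near ε x y → ∃ λ δ → 0# < δ × (∀ {z} → Near δ y z → Near ε x z)

    IsOpen : Pred X 0ℓ → Set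
    IsOpen U = ∀ {x} → U x → ∃ λ ε → 0# < ε × (∀ {y} → Near ε x y → U y)

    field
      open⇒ : ∀ {U} → Open U → IsOpen U
      open⇐ : ∀ {U} → IsOpen U → Open U

    near-respʳ : ∀ {ε x y z} → y ≈ z → Near ε x y → Near ε x z
    near-respʳ e near = let (_ , δ>0 , i) = near-open near in i (near-refl δ>0 e)

    -- Balls of one radius around equivalent centres need not agree: in a quotient they depend on
    -- the representative. Each still contains a smaller ball around the other centre.
    near-respˡ : ∀ {ε x y} → x ≈ y → 0# < ε → ∃ λ δ → 0# < δ × (∀ {z} → Near δ x z → Near ε y z)
    near-respˡ e ε>0 = near-open (near-refl ε>0 (Setoid.sym S e))

  open Nearness

  ContinuousNear : ∀ {S T} {σ : Topology S} {τ : Topology T} → Nearness σ → Nearness τ →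
    (Setoid.Carrier S → Setoid.Carrier T) → Set
  ContinuousNear M N f = ∀ x {ε} → 0# < ε →
    ∃ λ δ → 0# < δ × (∀ {y} → Near M δ x y → Near N ε (f x) (f y))

  -- Continuity at f x of an inverse of f, in a form that does not mention the inverse.
  InverseContinuousNear : ∀ {S T} {σ : Topology S} {τ : Topology T} → Nearness σ → Nearness τ →
    (Setoid.Carrier S → Setoid.Carrier T) → Set
  InverseContinuousNear M N f = ∀ x {ε} → 0# < ε →
    ∃ λ δ → 0# < δ × (∀ {y} → Near N δ (f x) (f y) → Near M ε x y)

  continuous : ∀ {S T} {σ : Topology S} {τ : Topology T} (M : Nearness σ) (N : Nearness τ) {f} →
    ContinuousNear M N f → Continuous σ τ f
  continuous M N {f} c {V} oV = open⇐ M {V ∘ f} λ {x} v →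
    let (ε , ε>0 , i) = open⇒ N {V} oV v
        (δ , δ>0 , k) = c x ε>0
    in δ , δ>0 , i ∘ k

  inverse-continuous : ∀ {S T} {σ : Topology S} {τ : Topology T}
    (M : Nearness σ) (N : Nearness τ) {f : Setoid.Carrier S → Setoid.Carrier T}
    {g : Setoid.Carrier T → Setoid.Carrier S} → (∀ y → Setoid._≈_ T (f (g y)) y) →
    InverseContinuousNear M N f → Continuous τ σ g
  inverse-continuous {T = T} M N {f} {g} f∘g c {V} oV = open⇐ N {V ∘ g} λ {y} v →
    let (ε , ε>0 , i) = open⇒ M {V} oV v
        (δ , δ>0 , k) = c (g y) ε>0
        (η , η>0 , j) = near-respˡ N (Setoid.sym T (f∘g y)) δ>0
    in η , η>0 , λ {z} near → i (k (near-respʳ N (Setoid.sym T (f∘g z)) (j near)))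

  ℝ-nearness : Nearness (ℝ-topology ℝ)
  ℝ-nearness = record
    { Near      = Close
    ; near-refl = close-refl
    ; near-mono = close-mono
    ; near-open = close-open
    ; open⇒     = λ o u → let (ε , ε>0 , i) = IsOpenℝ.interior o u in
                    ε , ε>0 , λ (p , q) → i p q
    ; open⇐     = λ o → record { interior = λ u → let (ε , ε>0 , i) = o u in
                    ε , ε>0 , λ p q → i (p , q) }
    }

  ×-nearness : ∀ {S T} {σ : Topology S} {τ : Topology T} → Nearness σ → Nearness τ →
    Nearness (productTopology σ τ)
  ×-nearness {S} {T} M N = record
    { Near      = λ ε (x , y) (x′ , y′) → Near M ε x x′ × Near N ε y y′
    ; near-refl = λ ε>0 (e , e′) → near-refl M ε>0 e , near-refl N ε>0 e′
    ; near-mono = λ le (p , q) → near-mono M le p , near-mono N le q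
    ; near-open = λ (p , q) →
        let (δ₁ , δ₁>0 , i₁) = near-open M p
            (δ₂ , δ₂>0 , i₂) = near-open N q
            (δ , δ>0 , δ≤δ₁ , δ≤δ₂) = minimum δ₁>0 δ₂>0
        in δ , δ>0 , λ (a , b) → i₁ (near-mono M δ≤δ₁ a) , i₂ (near-mono N δ≤δ₂ b)
    ; open⇒     = λ o w →
        let (U , V , oU , oV , u , v , i) = o w
            (δ₁ , δ₁>0 , i₁) = open⇒ M oU u
            (δ₂ , δ₂>0 , i₂) = open⇒ N oV v
            (δ , δ>0 , δ≤δ₁ , δ≤δ₂) = minimum δ₁>0 δ₂>0
        in δ , δ>0 , λ (a , b) → i (i₁ (near-mono M δ≤δ₁ a)) (i₂ (near-mono N δ≤δ₂ b))
    ; open⇐     = λ o {x} {y} w → let (ε , ε>0 , i) = o w in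
        Near M ε x , Near N ε y , open⇐ M (near-open M) , open⇐ N (near-open N) ,
        near-refl M ε>0 (Setoid.refl S) , near-refl N ε>0 (Setoid.refl T) , λ a b → i (a , b)
    }

  power-nearness : ∀ {S} {τ : Topology S} → Nearness τ → ∀ n → Nearness (powerTopology τ n)
  power-nearness {S} M n = record
    { Near      = λ ε x y → ∀ i → Near M ε (x i) (y i)
    ; near-refl = λ ε>0 e i → near-refl M ε>0 (e i)
    ; near-mono = λ le p i → near-mono M le (p i)
    ; near-open = λ p →
        let (δ , δ>0 , δ≤) = minimumᵥ (λ i → proj₁ (near-open M (p i)))
                                      (λ i → proj₁ (proj₂ (near-open M (p i))))
        in δ , δ>0 , λ q i → proj₂ (proj₂ (near-open M (p i))) (near-mono M (δ≤ i) (q i))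
    ; open⇒     = λ o w →
        let (U , oU , u , sub) = o w
            ball = λ i → open⇒ M (oU i) (u i)
            (δ , δ>0 , δ≤) = minimumᵥ (proj₁ ∘ ball) (λ i → proj₁ (proj₂ (ball i)))
        in δ , δ>0 , λ q → sub λ i → proj₂ (proj₂ (ball i)) (near-mono M (δ≤ i) (q i))
    ; open⇐     = λ o {x} w → let (ε , ε>0 , i) = o w in
        (λ i → Near M ε (x i)) , (λ i → open⇐ M (near-open M)) ,
        (λ i → near-refl M ε>0 (Setoid.refl S)) , i
    }

  subspace-nearness : ∀ {S} {τ : Topology S} → Nearness τ → (P : Pred (Setoid.Carrier S) 0ℓ) →
    Nearness (subspaceTopology S τ P)
  subspace-nearness {S} M P = record
    { Near      = λ ε x y → Near M ε (proj₁ x) (proj₁ y)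
    ; near-refl = near-refl M
    ; near-mono = near-mono M
    ; near-open = λ p → let (δ , δ>0 , i) = near-open M p in δ , δ>0 , i
    ; open⇒     = λ (V , oV , e) {p} u →
        let (ε , ε>0 , i) = open⇒ M oV (Equivalence.to (e p) u)
        in ε , ε>0 , λ {q} near → Equivalence.from (e q) (i near)
    ; open⇐     = λ {U} o →
        -- The open set of the ambient space is the union of the balls belonging to the points of
        -- `U`.
        (λ y → Σ[ x ∈ Σ[ z ∈ Setoid.Carrier S ] P z ] Σ[ u ∈ U x ] Near M (proj₁ (o u)) (proj₁ x) y) ,
        open⇐ M (λ (x , u , near) → let (δ , δ>0 , i) = near-open M near in
          δ , δ>0 , λ near′ → x , u , i near′) ,
        λ p → mk⇔ (λ u → p , u , near-refl M (proj₁ (proj₂ (o u))) (Setoid.refl S))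
                  (λ (x , u , near) → proj₂ (proj₂ (o u)) near)
    }

  -- Equivalent points have matching neighbourhoods: the projection is open.
  HasOpenProjection : ∀ {S} {τ : Topology S} → Nearness τ → Congruence S → Set
  HasOpenProjection M C = ∀ {x y ε} → x ∼ y → 0# < ε →
    ∃ λ δ → 0# < δ × (∀ {x′} → Near M δ x x′ → ∃ λ y′ → y′ ∼ x′ × Near M ε y y′)
    where open Congruence C

  quotient-nearness : ∀ {S} {τ : Topology S} (M : Nearness τ) (C : Congruence S) →
    HasOpenProjection M C → Nearness (quotientTopology τ C)
  quotient-nearness {S} M C lift = record
    { Near      = λ ε x y → ∃ λ y′ → y′ ∼ y × Near M ε x y′
    ; near-refl = λ {_} {x} ε>0 e → x , e , near-refl M ε>0 (Setoid.refl S)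
    ; near-mono = λ le (y′ , e , near) → y′ , e , near-mono M le near
    ; near-open = λ (y′ , e , near) →
        let (δ , δ>0 , i) = near-open M near
            -- The ball around y′ is needed around the equivalent point y. Openness of the
            -- projection moves points near y to equivalent points near y′.
            (η , η>0 , k) = lift (∼-sym e) δ>0
        in η , η>0 , λ (z′ , z′∼z , near′) → let (z″ , z″∼z′ , near″) = k near′ in
          z″ , ∼-trans z″∼z′ z′∼z , i near″
    ; open⇒     = λ (resp , o) u → let (ε , ε>0 , i) = open⇒ M o u in
        ε , ε>0 , λ (y′ , e , near) → resp e (i near)
    ; open⇐     = λ {U} o →
        (λ {x} {y} x∼y u → let (ε , ε>0 , i) = o u in
          i (x , x∼y , near-refl M ε>0 (Setoid.refl S))) ,
        open⇐ M (λ u → let (ε , ε>0 , i) = o u in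
          ε , ε>0 , λ {y} near → i (y , IsEquivalence.refl isEquivalence , near))
    }
    where
    open Congruence C
    open IsEquivalence isEquivalence using () renaming (sym to ∼-sym; trans to ∼-trans)

-- Symmetry and transitivity of equivariant homeomorphism.

module _ {G : Group 0ℓ 0ℓ} where

  ≅-sym : ∀ {X Y : GSpace G} → X ≅ Y → Y ≅ X
  ≅-sym {X} {Y} e = record
    { bijection       = record
      { to = from ; from = to ; to-cong = from-cong ; from-cong = to-cong
      ; inverse = inverseʳ , inverseˡ }
    ; to-continuous   = from-continuous
    ; from-continuous = to-continuous
    ; to-equivariant  = λ g y → inverseʳ (Y.sym (Y.trans (to-equivariant g (from y))
        (Y.·-cong (Group.refl G) (inverseˡ X.refl))))
    }
    where
    open _≅_ e
    open Inverse bijection using (to-cong; from-cong; inverseˡ; inverseʳ)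
    module X = GSpace X
    module Y = GSpace Y

  ≅-trans : ∀ {X Y Z : GSpace G} → X ≅ Y → Y ≅ Z → X ≅ Z
  ≅-trans {X} {Y} {Z} e f = record
    { bijection       = record
      { to = F.to ∘ E.to ; from = E.from ∘ F.from
      ; to-cong = IF.to-cong ∘ IE.to-cong ; from-cong = IE.from-cong ∘ IF.from-cong
      ; inverse = (λ p → IF.inverseˡ (IE.inverseˡ p)) , (λ p → IE.inverseʳ (IF.inverseʳ p)) }
    ; to-continuous   = E.to-continuous ∘ F.to-continuous
    ; from-continuous = F.from-continuous ∘ E.from-continuous
    ; to-equivariant  = λ g x → Z.trans (IF.to-cong (E.to-equivariant g x))
                                        (F.to-equivariant g (E.to x))
    }
    where
    module E = _≅_ e
    module F = _≅_ f
    module IE = Inverse E.bijection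
    module IF = Inverse F.bijection
    module Z = GSpace Z

-- Balls in projective spaces and symmetric powers.

module ProjectiveSpaces (ℝ : CompleteOrderedField) where
  open CompleteOrderedField ℝ
    using (Carrier; _<_; _≤_; 0#; refl; _*_; fieldStructure; commutativeRing)
  open OrderProperties ℝ using (minimum)
  open IntegerSolver commutativeRing
  open Analysis ℝ
  open Topologies ℝ
  open Nearness

  module _ (F : Field) {τ : Topology (Field.setoid F)} (M : Nearness τ)
    (scale-continuous : ∀ t → ContinuousNear M M (Field._*_ F t)) where
    private module F = Field F
    open FieldProperties F

    -- The projection is open because scaling by a fixed factor is continuous: if y = t x, a
    -- perturbation x′ of x is matched by t x′ near y.
    ℙ-nearness : ∀ n → Nearness (ℙ-topology F n τ)
    ℙ-nearness n = quotient-nearness vectors (scaling F n)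
      λ {x} {y} {ε} x∼y ε>0 →
        let (t , t≉0 , e) = IsEquivalence.sym (Congruence.isEquivalence (scaling F n)) {x} {y} x∼y
            y-near = λ i → near-respˡ M (F.sym (e i)) ε>0
            scaled-near = λ i → scale-continuous t (proj₁ x i) (proj₁ (proj₂ (y-near i)))
            (δ , δ>0 , δ≤) = minimumᵥ (proj₁ ∘ scaled-near) (λ i → proj₁ (proj₂ (scaled-near i)))
        in δ , δ>0 , λ {x′} near →
          ((λ i → t F.* proj₁ x′ i) , λ z → proj₂ x′ λ i →
            *-cancelˡ t≉0 (F.trans (z i) (F.sym (F.zeroʳ t)))) ,
          (t , t≉0 , λ i → F.refl) ,
          λ i → proj₂ (proj₂ (y-near i)) (proj₂ (proj₂ (scaled-near i)) (near-mono M (δ≤ i) (near i)))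
      where
      vectors : Nearness (subspaceTopology _ (powerTopology τ (suc n)) (NonzeroVector F n))
      vectors = subspace-nearness (power-nearness M (suc n)) (NonzeroVector F n)

  -- The projection is open because the permutation that relates x to y also rearranges a
  -- perturbation of x into one of y.
  SP-nearness : ∀ {S} {τ : Topology S} → Nearness τ → ∀ n → Nearness (SP-topology n S τ)
  SP-nearness {S} M n = quotient-nearness (power-nearness M n) (symmetricCongruence S n)
    λ {x} {y} (π , e) ε>0 →
      let y-near = λ j → near-respˡ M {x = x (π Perm.⟨$⟩ˡ j)} {y = y j}
                     (S.trans (e (π Perm.⟨$⟩ˡ j)) (S.reflexive (≡.cong y (Perm.inverseʳ π)))) ε>0
          (δ , δ>0 , δ≤) = minimumᵥ (proj₁ ∘ y-near) (λ j → proj₁ (proj₂ (y-near j)))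
      in δ , δ>0 , λ {x′} near →
        (λ j → x′ (π Perm.⟨$⟩ˡ j)) , (Perm.flip π , λ _ → S.refl) ,
        λ j → proj₂ (proj₂ (y-near j)) (near-mono M (δ≤ j) (near (π Perm.⟨$⟩ˡ j)))
    where module S = Setoid S

  ℝ-scale-continuous : ∀ t → ContinuousNear ℝ-nearness ℝ-nearness (t *_)
  ℝ-scale-continuous t x ε>0 =
    let (δ , δ>0 , c) = polynomial-continuous {ρ = t ∷ᵛ x ∷ᵛ []ᵛ} (var 0F :* var 1F) ε>0
    in δ , δ>0 , λ {y} near → c {t ∷ᵛ y ∷ᵛ []ᵛ}
         λ { 0F → close-refl δ>0 refl ; 1F → near }

  ℂ-nearness : Nearness (ℂ-topology ℝ)
  ℂ-nearness = ×-nearness ℝ-nearness ℝ-nearness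

  ℂ-scale-continuous : ∀ t → ContinuousNear ℂ-nearness ℂ-nearness (Field._*_ (ℂ ℝ) t)
  ℂ-scale-continuous (a , b) (x , y) {ε} ε>0 =
    let (δ₁ , δ₁>0 , c₁) = polynomial-continuous {ρ = ρ x y} re-* ε>0
        (δ₂ , δ₂>0 , c₂) = polynomial-continuous {ρ = ρ x y} im-* ε>0
        (δ , δ>0 , δ≤δ₁ , δ≤δ₂) = minimum δ₁>0 δ₂>0
    in δ , δ>0 , λ {w} near →
      c₁ {ρ (proj₁ w) (proj₂ w)} (close δ₁>0 δ≤δ₁ near) ,
      c₂ {ρ (proj₁ w) (proj₂ w)} (close δ₂>0 δ≤δ₂ near)
    where
    ρ : Carrier → Carrier → Vec Carrier 4
    ρ x y = a ∷ᵛ b ∷ᵛ x ∷ᵛ y ∷ᵛ []ᵛ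
    re-* im-* : Polynomial 4
    re-* = var 0F :* var 2F :- var 1F :* var 3F
    im-* = var 0F :* var 3F :+ var 1F :* var 2F
    close : ∀ {δ η w} → 0# < η → δ ≤ η → Near ℂ-nearness δ (x , y) w →
      CloseVec η (ρ x y) (ρ (proj₁ w) (proj₂ w))
    close η>0 le near = λ
      { 0F → close-refl η>0 refl
      ; 1F → close-refl η>0 refl
      ; 2F → close-mono le (proj₁ near)
      ; 3F → close-mono le (proj₂ near) }

  ℝℙ-nearness : ∀ n → Nearness (ℙ-topology fieldStructure n (ℝ-topology ℝ))
  ℝℙ-nearness = ℙ-nearness fieldStructure ℝ-nearness ℝ-scale-continuous

  ℂℙ-nearness : ∀ n → Nearness (ℙ-topology (ℂ ℝ) n (ℂ-topology ℝ))
  ℂℙ-nearness = ℙ-nearness (ℂ ℝ) ℂ-nearness ℂ-scale-continuous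

-- The model space of pairs of a boundary point and an interior point.

module PointedPlane (ℝ : CompleteOrderedField) where
  open CompleteOrderedField ℝ
  open FieldProperties fieldStructure
  open OrderProperties ℝ
  open IntegerSolver commutativeRing
  open Analysis ℝ
  open Topologies ℝ
  open ProjectiveSpaces ℝ

  module _ {G : Group 0ℓ 0ℓ} {X Y : GSpace G} where
    private
      module X = GSpace X
      module Y = GSpace Y

    -- Of `g` only one inverse law is asked: injectivity of `f` supplies the other one and shows
    -- that `g` respects equality, so `g` may be defined by arbitrary choices.
    nearness-≅ : (M : Nearness X.topology) (N : Nearness Y.topology)
      (f : X.Carrier → Y.Carrier) (g : Y.Carrier → X.Carrier) →
      (∀ {x x′} → x X.≈ x′ → f x Y.≈ f x′) →
      (∀ {x x′} → f x Y.≈ f x′ → x X.≈ x′) →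
      (∀ y → f (g y) Y.≈ y) →
      (∀ h x → f (h X.· x) Y.≈ h Y.· f x) →
      ContinuousNear M N f → InverseContinuousNear M N f → X ≅ Y
    nearness-≅ M N f g f-cong f-injective f∘g f-equivariant f-cont f⁻¹-cont = record
      { bijection       = record
        { to        = f
        ; from      = g
        ; to-cong   = f-cong
        ; from-cong = λ {y} {y′} e → f-injective (Y.trans (f∘g y) (Y.trans e (Y.sym (f∘g y′))))
        ; inverse   = (λ {y} e → Y.trans (f-cong e) (f∘g y))
                    , (λ {x} {y} e → f-injective (Y.trans (f∘g y) e))
        }
      ; to-continuous   = continuous M N {f} f-cont
      ; from-continuous = inverse-continuous M N {f} {g} f∘g f⁻¹-cont
      ; to-equivariant  = f-equivariant
      }

  module ℂ = Field (ℂ ℝ)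
  module ℙ¹ = Setoid (ℙ fieldStructure 1)
  module ℍ² = Setoid (ℍ²-setoid ℝ)

  -- A real root r together with the root in the upper half plane.
  ℙ¹×ℍ² : GSpace (PSL₂ℝ ℝ)
  ℙ¹×ℍ² = record
    { setoid   = ×-setoid (ℙ fieldStructure 1) (ℍ²-setoid ℝ)
    ; topology = productTopology (ℙ-topology fieldStructure 1 (ℝ-topology ℝ)) (ℍ²-topology ℝ)
    ; action   = record
      { _·_        = λ M (r , p) → möbius fieldStructure M r , isometry ℝ M p
      ; ·-cong     = λ {M} {N} {(r , p)} {(s , q)} e (r≈s , p≈q) →
          Action.·-cong (möbius-action fieldStructure) {M} {N} {r} {s} e r≈s ,
          proj₁ (U.·-cong {M} {N} {upward p} {upward q} e (p≈q , refl , proj₂ p≈q))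
      ; ·-identity = λ (r , p) →
          Action.·-identity (möbius-action fieldStructure) r , proj₁ (U.·-identity (upward p))
      ; ·-assoc    = λ M N (r , p) →
          Action.·-assoc (möbius-action fieldStructure) M N r , proj₁ (U.·-assoc M N (upward p))
      }
    }
    where
    module U = GSpace (UTℍ² ℝ)
    -- The vertical unit vector. It embeds ℍ² into UTℍ², from which the action laws for `isometry`
    -- are inherited.
    upward : ℍ².Carrier → U.Carrier
    upward p@((_ , y) , y>0) = (p , (0# , y)) ,
      trans (*-congʳ (solve 1 (λ y → con (+ 0) :* con (+ 0) :+ y :* y := y :* y) refl y))
            (*-invʳ (y * y) (*-nonzero (pos⇒nonzero y>0) (pos⇒nonzero y>0)))

  ℍ²-nearness : Nearness (ℍ²-topology ℝ)
  ℍ²-nearness = subspace-nearness ℂ-nearness (λ z → 0# < im ℝ z)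

  nearness : Nearness (productTopology (ℙ-topology fieldStructure 1 (ℝ-topology ℝ)) (ℍ²-topology ℝ))
  nearness = ×-nearness (ℝℙ-nearness 1) ℍ²-nearness

  nonzero-coordinate : ∀ (r : ℙ¹.Carrier) → proj₁ r 0F ≉ 0# ⊎ proj₁ r 1F ≉ 0#
  nonzero-coordinate (v , v≉0) with compare (v 0F) 0#
  ... | tri< _ n _ = inj₁ n
  ... | tri> _ n _ = inj₁ n
  ... | tri≈ _ e _ = inj₂ λ e′ → v≉0 λ { 0F → e ; 1F → e′ }

  norm-pos : ∀ (r : ℙ¹.Carrier) → 0# < proj₁ r 0F * proj₁ r 0F + proj₁ r 1F * proj₁ r 1F
  norm-pos r@(v , _) with nonzero-coordinate r
  ... | inj₁ n = pos+nonNeg (square-pos n) (square-nonNeg (v 1F))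
  ... | inj₂ n = pos-resp (+-comm _ _) (pos+nonNeg (square-pos n) (square-nonNeg (v 0F)))

  -- The factor is ⟨v, w⟩ / ⟨w, w⟩, as for an orthogonal projection, so it need not be known which
  -- coordinate of w is nonzero.
  parallel⇒≈ : ∀ (r s : ℙ¹.Carrier) →
    proj₁ r 0F * proj₁ s 1F ≈ proj₁ r 1F * proj₁ s 0F → r ℙ¹.≈ s
  parallel⇒≈ r@(v , v≉0) s@(w , _) e = t , t≉0 , v≈tw
    where
    n k t : Carrier
    n = w 0F * w 0F + w 1F * w 1F
    k = inv n (pos⇒nonzero (norm-pos s))
    t = (v 0F * w 0F + v 1F * w 1F) * k
    cancel : ∀ x → n * k * x ≈ x
    cancel x = trans (*-congʳ (*-invʳ n (pos⇒nonzero (norm-pos s)))) (*-identityˡ x)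
    v≈tw : ∀ i → v i ≈ t * w i
    v≈tw 0F = trans (sym (cancel (v 0F))) (trans
      (solve 5 (λ a b c d k → (c :* c :+ d :* d) :* k :* a :=
        (a :* c :* c :+ (a :* d) :* d) :* k) refl (v 0F) (v 1F) (w 0F) (w 1F) k)
      (trans (*-congʳ (+-congˡ (*-congʳ e)))
        (solve 5 (λ a b c d k → (a :* c :* c :+ (b :* c) :* d) :* k :=
          (a :* c :+ b :* d) :* k :* c) refl (v 0F) (v 1F) (w 0F) (w 1F) k)))
    v≈tw 1F = trans (sym (cancel (v 1F))) (trans
      (solve 5 (λ a b c d k → (c :* c :+ d :* d) :* k :* b :=
        ((b :* c) :* c :+ b :* d :* d) :* k) refl (v 0F) (v 1F) (w 0F) (w 1F) k)
      (trans (*-congʳ (+-congʳ (*-congʳ (sym e))))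
        (solve 5 (λ a b c d k → ((a :* d) :* c :+ b :* d :* d) :* k :=
          (a :* c :+ b :* d) :* k :* d) refl (v 0F) (v 1F) (w 0F) (w 1F) k)))
    t≉0 : t ≉ 0#
    t≉0 t≈0 = v≉0 λ i → trans (v≈tw i) (trans (*-congʳ t≈0) (zeroˡ (w i)))

  nonzero-near : ∀ (r : ℙ¹.Carrier) → ∃ λ δ → 0# < δ × (∀ {w : Vector Carrier 2} →
    (∀ i → Close δ (proj₁ r i) (w i)) → NonzeroVector fieldStructure 1 w)
  nonzero-near r with nonzero-coordinate r
  ... | inj₁ n = let (δ , δ>0 , k) = close-nonzero n in δ , δ>0 , λ c w≈0 → k (c 0F) (w≈0 0F)
  ... | inj₂ n = let (δ , δ>0 , k) = close-nonzero n in δ , δ>0 , λ c w≈0 → k (c 1F) (w≈0 1F)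

-- Unit vectors and the end points of their geodesic rays.

module UnitTangents (ℝ : CompleteOrderedField) where
  open CompleteOrderedField ℝ
  open FieldProperties fieldStructure
  open OrderProperties ℝ
  open IntegerSolver commutativeRing
  open Analysis ℝ
  open PointedPlane ℝ

  -- Real and imaginary part of conj ω · v = i y ω for ω = s - t z: the geodesic
  -- ray from z = x + iy in direction v ends at [s : t].
  PointsTo : (s t x y v₁ v₂ : Carrier) → Set
  PointsTo s t x y v₁ v₂ =
    v₁ * (s - t * x) ≈ (y + v₂) * (t * y) × (y - v₂) * (s - t * x) ≈ v₁ * (t * y)

  -- |ω|²
  normω : (s t x y : Carrier) → Carrier
  normω s t x y = (s - t * x) * (s - t * x) + (t * y) * (t * y)

  -- The imaginary part of ω is -ty, so ω can vanish only for t = 0, and then ω = s.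
  normω-pos : ∀ (r : ℙ¹.Carrier) {x y} → 0# < y → 0# < normω (proj₁ r 0F) (proj₁ r 1F) x y
  normω-pos (v , v≉0) {x} {y} y>0 with compare (v 1F) 0#
  ... | tri< _ n _ = pos-resp (+-comm _ _)
    (pos+nonNeg (square-pos (*-nonzero n (pos⇒nonzero y>0))) (square-nonNeg (v 0F - v 1F * x)))
  ... | tri> _ n _ = pos-resp (+-comm _ _)
    (pos+nonNeg (square-pos (*-nonzero n (pos⇒nonzero y>0))) (square-nonNeg (v 0F - v 1F * x)))
  ... | tri≈ _ t≈0 _ = pos+nonNeg (square-pos s-tx≉0) (square-nonNeg (v 1F * y))
    where
    s-tx≉0 : v 0F - v 1F * x ≉ 0#
    s-tx≉0 e = v≉0 λ
      { 0F → trans (solve 3 (λ s t x → s := (s :- t :* x) :+ t :* x) refl (v 0F) (v 1F) x)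
          (trans (+-cong e (trans (*-congʳ t≈0) (zeroˡ x))) (+-identityˡ 0#))
      ; 1F → t≈0 }

  -- Multiplying the condition by ω gives |ω|² v = i y ω²; these are the real and the imaginary
  -- part, with ω = p - iq.
  pointsTo⇒normω : ∀ {s t x y v₁ v₂} → PointsTo s t x y v₁ v₂ →
    normω s t x y * v₁ ≈ (1# + 1#) * y * (s - t * x) * (t * y) ×
    normω s t x y * v₂ ≈ y * ((s - t * x) * (s - t * x) - (t * y) * (t * y))
  pointsTo⇒normω {s} {t} {x} {y} {v₁} {v₂} (e , f) =
    trans (solve 3 (λ p q v → (p :* p :+ q :* q) :* v := p :* (v :* p) :+ q :* (v :* q)) refl p q v₁)
      (trans (+-cong (*-congˡ e) (*-congˡ (sym f)))
        (solve 4 (λ p q y v → p :* ((y :+ v) :* q) :+ q :* ((y :- v) :* p) := con (+ 2) :* y :* p :* q)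
          refl p q y v₂)) ,
    trans (solve 4 (λ p q y v → (p :* p :+ q :* q) :* v :=
             (y :* p :* p :- y :* q :* q) :+ (q :* ((y :+ v) :* q) :- p :* ((y :- v) :* p))) refl p q y v₂)
      (trans (+-congˡ (+-cong (*-congˡ (sym e)) (-‿cong (*-congˡ f))))
        (solve 4 (λ p q y v → (y :* p :* p :- y :* q :* q) :+ (q :* (v :* p) :- p :* (v :* q)) :=
           y :* (p :* p :- q :* q)) refl p q y v₁))
    where
    p q : Carrier
    p = s - t * x
    q = t * y

  pointsTo-resp : ∀ {s t x y v₁ v₂ k s′ t′ x′ y′ v₁′ v₂′} → k ≉ 0# →
    s ≈ k * s′ → t ≈ k * t′ → x ≈ x′ → y ≈ y′ → v₁ ≈ v₁′ → v₂ ≈ v₂′ →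
    PointsTo s t x y v₁ v₂ → PointsTo s′ t′ x′ y′ v₁′ v₂′
  pointsTo-resp {s} {t} {x} {y} {k = k} {s′} {t′} {x′} {y′} k≉0 es et ex ey e₁ e₂ (e , f) =
    *-cancelˡ k≉0 (trans (shuffle _ _) (trans (sym (*-cong e₁ ep)) (trans e
      (trans (*-cong (+-cong ey e₂) eq) (sym (shuffle _ _)))))) ,
    *-cancelˡ k≉0 (trans (shuffle _ _) (trans (sym (*-cong (+-cong ey (-‿cong e₂)) ep)) (trans f
      (trans (*-cong e₁ eq) (sym (shuffle _ _))))))
    where
    shuffle : ∀ a b → k * (a * b) ≈ a * (k * b)
    shuffle a b = solve 3 (λ k a b → k :* (a :* b) := a :* (k :* b)) refl k a b
    ep : s - t * x ≈ k * (s′ - t′ * x′)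
    ep = trans (+-cong es (-‿cong (*-cong et ex)))
      (solve 4 (λ k s t x → k :* s :- k :* t :* x := k :* (s :- t :* x)) refl k s′ t′ x′)
    eq : t * y ≈ k * (t′ * y′)
    eq = trans (*-cong et ey) (*-assoc k t′ y′)

  pointsTo-unique : ∀ (r : ℙ¹.Carrier) {x y v₁ v₂ w₁ w₂} → 0# < y →
    PointsTo (proj₁ r 0F) (proj₁ r 1F) x y v₁ v₂ → PointsTo (proj₁ r 0F) (proj₁ r 1F) x y w₁ w₂ →
    v₁ ≈ w₁ × v₂ ≈ w₂
  pointsTo-unique r y>0 d e =
    let (a , b) = pointsTo⇒normω d ; (a′ , b′) = pointsTo⇒normω e in
    *-cancelˡ n≉0 (trans a (sym a′)) , *-cancelˡ n≉0 (trans b (sym b′))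
    where n≉0 = pos⇒nonzero (normω-pos r y>0)

  -- For fixed z and v the condition is a homogeneous linear system in p = s - tx and q = ty. Its
  -- coefficients y + v₂ and y - v₂ add up to 2y and do not both vanish, so the solutions form at
  -- most a line.
  pointsTo-parallel : ∀ {s t s′ t′ x y v₁ v₂} → 0# < y →
    PointsTo s t x y v₁ v₂ → PointsTo s′ t′ x y v₁ v₂ → s * t′ ≈ t * s′
  pointsTo-parallel {s} {t} {s′} {t′} {x} {y} {v₁} {v₂} y>0 (e , f) (e′ , f′) =
    *-cancelˡ 2yy≉0 (trans
      (solve 7 (λ s t s′ t′ x y v →
          let p = s :- t :* x ; q = t :* y ; p′ = s′ :- t′ :* x ; q′ = t′ :* y in
          con (+ 2) :* (y :* y) :* (s :* t′) :=
          (p :* ((y :+ v) :* q′) :- p′ :* ((y :+ v) :* q) :+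
           (q′ :* ((y :- v) :* p) :- q :* ((y :- v) :* p′)))
          :+ con (+ 2) :* (y :* y) :* (t :* s′)) refl s t s′ t′ x y v₂)
      (trans (+-congʳ (+-cong (+-cong (*-congˡ (sym e′)) (-‿cong (*-congˡ (sym e))))
                              (+-cong (*-congˡ f) (-‿cong (*-congˡ f′)))))
        (solve 7 (λ s t s′ t′ x y v →
          let p = s :- t :* x ; q = t :* y ; p′ = s′ :- t′ :* x ; q′ = t′ :* y in
          (p :* (v :* p′) :- p′ :* (v :* p) :+ (q′ :* (v :* q) :- q :* (v :* q′)))
            :+ con (+ 2) :* (y :* y) :* (t :* s′) := con (+ 2) :* (y :* y) :* (t :* s′))
          refl s t s′ t′ x y v₁)))
    where
    2yy≉0 : (1# + 1#) * (y * y) ≉ 0#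
    2yy≉0 = pos⇒nonzero (*-pos 2>0 (*-pos y>0 y>0))

  -- The orthogonal projection of (p , q) to the line of all solutions of
  -- PointsTo, up to the factor 2y² and in the coordinates s - tx, ty.
  project : (p q x y v₁ v₂ : Carrier) → Carrier × Carrier
  project p q x y v₁ v₂ =
    y * ((y + v₂) * p + v₁ * q) + x * (v₁ * p + (y - v₂) * q) , v₁ * p + (y - v₂) * q

  -- The symmetric matrix with rows (y + v₂, v₁) and (v₁, y - v₂) has trace 2y, and |v| = y makes
  -- its determinant vanish. It is therefore 2y times a projection, and its image solves the system.
  project-pointsTo : ∀ p q {x y v₁ v₂} → v₁ * v₁ + v₂ * v₂ ≈ y * y →
    PointsTo (proj₁ (project p q x y v₁ v₂)) (proj₂ (project p q x y v₁ v₂)) x y v₁ v₂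
  project-pointsTo p q {x} {y} {v₁} {v₂} unit =
    trans (solve 6 (λ p q x y v w →
             v :* ((y :* ((y :+ w) :* p :+ v :* q) :+ x :* (v :* p :+ (y :- w) :* q))
               :- (v :* p :+ (y :- w) :* q) :* x)
             := y :* ((y :+ w) :* v :* p :- w :* w :* q) :+ y :* q :* (v :* v :+ w :* w))
             refl p q x y v₁ v₂)
      (trans (+-congˡ (*-congˡ unit))
        (solve 5 (λ p q y v w →
          y :* ((y :+ w) :* v :* p :- w :* w :* q) :+ y :* q :* (y :* y) :=
          (y :+ w) :* ((v :* p :+ (y :- w) :* q) :* y)) refl p q y v₁ v₂)) ,
    trans (solve 6 (λ p q x y v w →
             (y :- w) :* ((y :* ((y :+ w) :* p :+ v :* q) :+ x :* (v :* p :+ (y :- w) :* q))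
               :- (v :* p :+ (y :- w) :* q) :* x)
             := y :* p :* (y :* y) :+ (y :* v :* (y :- w) :* q :- y :* w :* w :* p))
             refl p q x y v₁ v₂)
      (trans (+-congʳ (*-congˡ (sym unit)))
        (solve 5 (λ p q y v w →
          y :* p :* (v :* v :+ w :* w) :+ (y :* v :* (y :- w) :* q :- y :* w :* w :* p) :=
          v :* ((v :* p :+ (y :- w) :* q) :* y)) refl p q y v₁ v₂))

  project-fixes : ∀ {s t x y v₁ v₂} → PointsTo s t x y v₁ v₂ →
    proj₁ (project (s - t * x) (t * y) x y v₁ v₂) ≈ (1# + 1#) * (y * y) * s ×
    proj₂ (project (s - t * x) (t * y) x y v₁ v₂) ≈ (1# + 1#) * (y * y) * t
  project-fixes {s} {t} {x} {y} {v₁} {v₂} (e , f) =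
    trans (+-cong (*-congˡ (+-congˡ (sym f))) (*-congˡ T≈))
      (solve 5 (λ s t x y w →
        y :* ((y :+ w) :* (s :- t :* x) :+ (y :- w) :* (s :- t :* x)) :+ x :* (con (+ 2) :* (y :* y) :* t)
        := con (+ 2) :* (y :* y) :* s) refl s t x y v₂) ,
    T≈
    where
    T≈ : v₁ * (s - t * x) + (y - v₂) * (t * y) ≈ (1# + 1#) * (y * y) * t
    T≈ = trans (+-congʳ e) (solve 3 (λ t y w →
      (y :+ w) :* (t :* y) :+ (y :- w) :* (t :* y) := con (+ 2) :* (y :* y) :* t) refl t y v₂)

  module UT = GSpace (UTℍ² ℝ) using (Carrier; _≈_; _·_)

  unit-norm : ∀ {x y v₁ v₂} (y>0 : 0# < y) → IsUnit ℝ (((x , y) , y>0) , (v₁ , v₂)) →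
    v₁ * v₁ + v₂ * v₂ ≈ y * y
  unit-norm {x} {y} {v₁} {v₂} y>0 u = trans (sym (*-identityʳ n)) (trans (*-congˡ (sym yyi≈1))
    (trans (solve 3 (λ n s i → n :* (s :* i) := n :* i :* s) refl n (y * y) i)
      (trans (*-congʳ u) (*-identityˡ _))))
    where
    yy≉0 : y * y ≉ 0#
    yy≉0 = *-nonzero (pos⇒nonzero y>0) (pos⇒nonzero y>0)
    n i : Carrier
    n = v₁ * v₁ + v₂ * v₂
    i = inv (y * y) yy≉0
    yyi≈1 : y * y * i ≈ 1#
    yyi≈1 = *-invʳ (y * y) yy≉0

  module _ (r : ℙ¹.Carrier) (z : ℍ².Carrier) where
    private
      s t x y p q n i : Carrier
      s = proj₁ r 0F
      t = proj₁ r 1F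
      x = proj₁ (proj₁ z)
      y = proj₂ (proj₁ z)
      p = s - t * x
      q = t * y
      n = normω s t x y
      n≉0 : n ≉ 0#
      n≉0 = pos⇒nonzero (normω-pos r (proj₂ z))
      i = inv n n≉0
      ni≈1 : n * i ≈ 1#
      ni≈1 = *-invʳ n n≉0

    -- i y ω / conj ω
    direction : C ℝ
    direction = (1# + 1#) * y * p * q * i , y * (p * p - q * q) * i

    direction-pointsTo : PointsTo s t x y (proj₁ direction) (proj₂ direction)
    direction-pointsTo =
      trans (solve 4 (λ p q y i → con (+ 2) :* y :* p :* q :* i :* p :=
               (y :* ((p :* p :+ q :* q) :* i) :+ y :* (p :* p :- q :* q) :* i) :* q) refl p q y i)
        (*-congʳ (+-congʳ (trans (*-congˡ ni≈1) (*-identityʳ y)))) ,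
      trans (*-congʳ (+-congʳ (sym (trans (*-congˡ ni≈1) (*-identityʳ y)))))
        (solve 4 (λ p q y i → (y :* ((p :* p :+ q :* q) :* i) :- y :* (p :* p :- q :* q) :* i) :* p :=
          con (+ 2) :* y :* p :* q :* i :* q) refl p q y i)

    -- (2pq)² + (p² - q²)² = (p² + q²)², that is |ω²| = |ω|².
    direction-unit : IsUnit ℝ (z , direction)
    direction-unit = trans (*-congʳ norm)
      (*-invʳ (y * y) (*-nonzero (nonreal ℝ z) (nonreal ℝ z)))
      where
      norm : (1# + 1#) * y * p * q * i * ((1# + 1#) * y * p * q * i) +
             y * (p * p - q * q) * i * (y * (p * p - q * q) * i) ≈ y * y
      norm = trans (solve 4 (λ p q y i →
        con (+ 2) :* y :* p :* q :* i :* (con (+ 2) :* y :* p :* q :* i) :+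
        y :* (p :* p :- q :* q) :* i :* (y :* (p :* p :- q :* q) :* i) :=
        y :* y :* (((p :* p :+ q :* q) :* i) :* ((p :* p :+ q :* q) :* i))) refl p q y i)
        (trans (*-congˡ (trans (*-cong ni≈1 ni≈1) (*-identityˡ 1#))) (*-identityʳ _))

    tangent : UT.Carrier
    tangent = (z , direction) , direction-unit

-- Equivariance of the tangent vector.

module TangentEquivariance (ℝ : CompleteOrderedField) where
  open CompleteOrderedField ℝ
  open IntegerSolver commutativeRing
  open PointedPlane ℝ
  open UnitTangents ℝ
  private module ℂS = IntegerSolver (ℂ-ring ℝ)

  conj* : ∀ z w → conj ℝ (z ℂ.* w) ℂ.≈ conj ℝ z ℂ.* conj ℝ w
  conj* (a , b) (c , d) =
    solve 4 (λ a b c d → a :* c :- b :* d := a :* c :- (:- b) :* (:- d)) refl a b c d ,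
    solve 4 (λ a b c d → :- (a :* d :+ b :* c) := a :* (:- d) :+ (:- b) :* c) refl a b c d

  conj-resp : ∀ {z w} → z ℂ.≈ w → conj ℝ z ℂ.≈ conj ℝ w
  conj-resp (p , q) = p , -‿cong q

  -- The complex form of `PointsTo`. Here a matrix acts through multiplication by its cocycle; the
  -- real form serves linear algebra and estimates.
  PointsToℂ : (ω : C ℝ) (y : Carrier) (v : C ℝ) → Set
  PointsToℂ ω y v = conj ℝ ω ℂ.* v ℂ.≈ (0# , y) ℂ.* ω

  ω : ℙ¹.Carrier → C ℝ → C ℝ
  ω (v , _) (x , y) = v 0F - v 1F * x , - (v 1F * y)

  pointsTo⇒ℂ : ∀ r x y v → PointsTo (proj₁ r 0F) (proj₁ r 1F) x y (proj₁ v) (proj₂ v) →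
    PointsToℂ (ω r (x , y)) y v
  pointsTo⇒ℂ (r , _) x y (v₁ , v₂) (e , f) =
    trans (solve 4 (λ p q v w → p :* v :- (:- :- q) :* w := v :* p :- q :* w) refl p q v₁ v₂)
      (trans (+-congʳ e)
        (solve 4 (λ p q y w → (y :+ w) :* q :- q :* w := con (+ 0) :* p :- y :* (:- q)) refl p q y v₂)) ,
    trans (solve 4 (λ p q v w → p :* w :+ (:- :- q) :* v := v :* q :+ p :* w) refl p q v₁ v₂)
      (trans (+-congʳ (sym f))
        (solve 4 (λ p q y w → (y :- w) :* p :+ p :* w := con (+ 0) :* (:- q) :+ y :* p) refl p q y v₂))
    where
    p q : Carrier
    p = r 0F - r 1F * x
    q = r 1F * y

  pointsTo⇐ℂ : ∀ r x y v → PointsToℂ (ω r (x , y)) y v →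
    PointsTo (proj₁ r 0F) (proj₁ r 1F) x y (proj₁ v) (proj₂ v)
  pointsTo⇐ℂ (r , _) x y (v₁ , v₂) (e , f) =
    trans (solve 4 (λ p q v w → v :* p := (p :* v :- (:- :- q) :* w) :+ w :* q) refl p q v₁ v₂)
      (trans (+-congʳ e)
        (solve 4 (λ p q y w → (con (+ 0) :* p :- y :* (:- q)) :+ w :* q := (y :+ w) :* q) refl p q y v₂)) ,
    trans (solve 4 (λ p q y w → (y :- w) :* p := (con (+ 0) :* (:- q) :+ y :* p) :- w :* p) refl p q y v₂)
      (trans (+-congʳ (sym f))
        (solve 4 (λ p q v w → (p :* w :+ (:- :- q) :* v) :- w :* p := v :* q) refl p q v₁ v₂))
    where
    p q : Carrier
    p = r 0F - r 1F * x
    q = r 1F * y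

  -- Multiplying s′ - t′w by cz + d clears the denominator of w and leaves (as + bt)(cz + d) - (cs +
  -- dt)(az + b), which is the determinant times s - tz.
  ω-cocycle : ∀ M r z nz →
    denominator (ℂ ℝ) (complexify ℝ M) z ℂ.* ω (möbius fieldStructure M r) (möbiusℂ ℝ M z nz) ℂ.≈ ω r z
  ω-cocycle M (r , _) z@(x , y) nz =
    ℂ.trans (solve 6 (λ j₁ j₂ w₁ w₂ s t →
        j₁ :* (s :- t :* w₁) :- j₂ :* (:- (t :* w₂)) := s :* j₁ :- t :* (j₁ :* w₁ :- j₂ :* w₂))
        refl (proj₁ j) (proj₂ j) (proj₁ w) (proj₂ w) s′ t′ ,
      solve 6 (λ j₁ j₂ w₁ w₂ s t →
        j₁ :* (:- (t :* w₂)) :+ j₂ :* (s :- t :* w₁) := s :* j₂ :- t :* (j₁ :* w₂ :+ j₂ :* w₁))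
        refl (proj₁ j) (proj₂ j) (proj₁ w) (proj₂ w) s′ t′)
    (ℂ.trans (+-congˡ (-‿cong (*-congˡ (proj₁ jw≈n))) , +-congˡ (-‿cong (*-congˡ (proj₂ jw≈n))))
    (ℂ.trans (solve 8 (λ a b c d s t x y →
        (a :* s :+ b :* t) :* ((c :* x :- con (+ 0) :* y) :+ d) :-
        (c :* s :+ d :* t) :* ((a :* x :- con (+ 0) :* y) :+ b) :=
        (a :* d :- b :* c) :* (s :- t :* x)) refl a b c d s t x y ,
      solve 8 (λ a b c d s t x y →
        (a :* s :+ b :* t) :* ((c :* y :+ con (+ 0) :* x) :+ con (+ 0)) :-
        (c :* s :+ d :* t) :* ((a :* y :+ con (+ 0) :* x) :+ con (+ 0)) :=
        (a :* d :- b :* c) :* (:- (t :* y))) refl a b c d s t x y)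
    (trans (*-congʳ det≈1) (*-identityˡ _) , trans (*-congʳ det≈1) (*-identityˡ _))))
    where
    open SL₂ M
    s t s′ t′ : Carrier
    s = r 0F
    t = r 1F
    s′ = a * s + b * t
    t′ = c * s + d * t
    j w : C ℝ
    j = denominator (ℂ ℝ) (complexify ℝ M) z
    w = möbiusℂ ℝ M z nz
    jw≈n : j ℂ.* w ℂ.≈ numerator (ℂ ℝ) (complexify ℝ M) z
    jw≈n = denominator*fractional (ℂ ℝ) (complexify ℝ M) z (denominator-nonzero ℝ M nz)

  -- Here i is the inverse of j. Multiplied by j̄j, the left side becomes ω̄ v i, by hypothesis (0,
  -- y) ω i. Inserting y = y′ j̄ j and ω = jω′ gives j̄j times the right side, and j̄j is cancelled.
  pointsToℂ-transform : ∀ {j i ω ω′ y y′ v} → j ℂ.* i ℂ.≈ ℂ.1# → j ℂ.* ω′ ℂ.≈ ω →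
    y′ * ∣_∣² ℝ j ≈ y → PointsToℂ ω y v → PointsToℂ ω′ y′ (v ℂ.* (i ℂ.* i))
  pointsToℂ-transform {j} {i} {ω} {ω′} {y} {y′} {v} ji≈1 jω′≈ω y′J≈y e =
    FieldProperties.*-cancelˡ (ℂ ℝ) {j̄ ℂ.* j} (FieldProperties.*-nonzero (ℂ ℝ) {j̄} {j} j̄≉0 j≉0)
      (ℂ.trans
        (ℂS.solve 5 (λ j j̄ ω̄ v i →
          (j̄ ℂS.:* j) ℂS.:* (ω̄ ℂS.:* (v ℂS.:* (i ℂS.:* i))) ℂS.:=
          ((j̄ ℂS.:* ω̄) ℂS.:* v) ℂS.:* i ℂS.:* (j ℂS.:* i)) ℂ.refl j j̄ (conj ℝ ω′) v i)
      (ℂ.trans (ℂ.*-cong (ℂ.*-congʳ {i} (ℂ.trans (ℂ.*-congʳ {v} j̄ω̄′≈ω̄) e)) ji≈1)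
      (ℂ.trans (ℂ.*-congʳ {ℂ.1#} (ℂ.*-congʳ {i} (ℂ.*-cong iy≈ (ℂ.sym jω′≈ω))))
      (ℂ.trans
        (ℂS.solve 5 (λ j j̄ ω′ y′ i →
          (y′ ℂS.:* (j̄ ℂS.:* j)) ℂS.:* (j ℂS.:* ω′) ℂS.:* i ℂS.:* ℂS.con (+ 1) ℂS.:=
          (j̄ ℂS.:* j) ℂS.:* (y′ ℂS.:* ω′) ℂS.:* (j ℂS.:* i)) ℂ.refl j j̄ ω′ (0# , y′) i)
      (ℂ.trans (ℂ.*-congˡ {(j̄ ℂ.* j) ℂ.* ((0# , y′) ℂ.* ω′)} ji≈1)
        (ℂ.*-identityʳ ((j̄ ℂ.* j) ℂ.* ((0# , y′) ℂ.* ω′))))))))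
    where
    j̄ : C ℝ
    j̄ = conj ℝ j
    j≉0 : j ℂ.≉ ℂ.0#
    j≉0 = FieldProperties.unit-nonzero (ℂ ℝ) {j} {i} ji≈1
    j̄≉0 : j̄ ℂ.≉ ℂ.0#
    j̄≉0 (p , q) = j≉0 (p , trans (solve 1 (λ x → x := :- :- x) refl (proj₂ j))
      (trans (-‿cong q) (solve 0 (:- con (+ 0) := con (+ 0)) refl)))
    j̄ω̄′≈ω̄ : j̄ ℂ.* conj ℝ ω′ ℂ.≈ conj ℝ ω
    j̄ω̄′≈ω̄ = ℂ.trans (ℂ.sym (conj* j ω′)) (conj-resp {j ℂ.* ω′} {ω} jω′≈ω)
    iy≈ : (0# , y) ℂ.≈ (0# , y′) ℂ.* (j̄ ℂ.* j)
    iy≈ =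
      solve 3 (λ a b y → con (+ 0) := con (+ 0) :* (a :* a :- (:- b) :* b) :- y :* (a :* b :+ (:- b) :* a))
        refl (proj₁ j) (proj₂ j) y′ ,
      trans (sym y′J≈y) (solve 3 (λ a b y → y :* (a :* a :+ b :* b) :=
        con (+ 0) :* (a :* b :+ (:- b) :* a) :+ y :* (a :* a :- (:- b) :* b)) refl (proj₁ j) (proj₂ j) y′)

  -- The image vector satisfies the condition that determines `direction` at the image point, so
  -- uniqueness replaces a computation with quotients.
  tangent-equivariant : ∀ M r z →
    tangent (möbius fieldStructure M r) (isometry ℝ M z) UT.≈ M UT.· tangent r z
  tangent-equivariant M r z@(w , y>0) = ℂ.refl , pointsTo-unique Mr (proj₂ Mz)
    (direction-pointsTo Mr Mz)
    (pointsTo⇐ℂ Mr (proj₁ (proj₁ Mz)) (proj₂ (proj₁ Mz)) (differential ℝ M z (direction r z))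
      (pointsToℂ-transform {j} {i} {ω r w} {ω Mr (proj₁ Mz)} {proj₂ w} {proj₂ (proj₁ Mz)} {direction r z}
        (ℂ.*-invʳ j j≉0) (ω-cocycle M r w (nonreal ℝ z)) (im-möbiusℂ ℝ M w (nonreal ℝ z))
        (pointsTo⇒ℂ r (proj₁ w) (proj₂ w) (direction r z) (direction-pointsTo r z))))
    where
    Mr : ℙ¹.Carrier
    Mr = möbius fieldStructure M r
    Mz : ℍ².Carrier
    Mz = isometry ℝ M z
    j i : C ℝ
    j = denominator (ℂ ℝ) (complexify ℝ M) w
    j≉0 : j ℂ.≉ ℂ.0#
    j≉0 = denominator-nonzero ℝ M (nonreal ℝ z)
    i = ℂ.inv j j≉0

-- The homeomorphism with the unit tangent bundle.

module TangentIso (ℝ : CompleteOrderedField) where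
  open CompleteOrderedField ℝ
  open FieldProperties fieldStructure
  open OrderProperties ℝ
  open IntegerSolver commutativeRing
  open Analysis ℝ
  open Topologies ℝ
  open ProjectiveSpaces ℝ
  open PointedPlane ℝ
  open UnitTangents ℝ
  open TangentEquivariance ℝ
  open Nearness

  Tℍ²-nearness : Nearness (productTopology (ℍ²-topology ℝ) (ℂ-topology ℝ))
  Tℍ²-nearness = ×-nearness ℍ²-nearness ℂ-nearness

  UTℍ²-nearness : Nearness (GSpace.topology (UTℍ² ℝ))
  UTℍ²-nearness = subspace-nearness {S = Tℍ²-setoid ℝ} Tℍ²-nearness (IsUnit ℝ)

  -- The projection of (1, 0). It is nonzero because s - tx equals y(y + v₂) for it.
  leading : ∀ {x y v₁ v₂} → 0# < y → 0# < y + v₂ → ℙ¹.Carrier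
  leading {x} {y} {v₁} {v₂} y>0 y+v₂>0 = (proj₁ r ∷ proj₂ r ∷ []) , λ e →
    *-nonzero (pos⇒nonzero y>0) (pos⇒nonzero y+v₂>0) (trans
      (solve 4 (λ x y v w → y :* (y :+ w) :=
        (y :* ((y :+ w) :* con (+ 1) :+ v :* con (+ 0)) :+ x :* (v :* con (+ 1) :+ (y :- w) :* con (+ 0)))
          :- x :* (v :* con (+ 1) :+ (y :- w) :* con (+ 0))) refl x y v₁ v₂)
      (trans (+-cong (e 0F) (-‿cong (*-congˡ (e 1F))))
        (solve 1 (λ x → con (+ 0) :- x :* con (+ 0) := con (+ 0)) refl x)))
    where
    r : Carrier × Carrier
    r = project 1# 0# x y v₁ v₂

  -- The projection of (0, 1), whose second coordinate is y - v₂.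
  trailing : ∀ {x y v₁ v₂} → 0# < y - v₂ → ℙ¹.Carrier
  trailing {x} {y} {v₁} {v₂} y-v₂>0 = (proj₁ r ∷ proj₂ r ∷ []) , λ e → pos⇒nonzero y-v₂>0
    (trans (solve 3 (λ y v w → y :- w := v :* con (+ 0) :+ (y :- w) :* con (+ 1)) refl y v₁ v₂) (e 1F))
    where
    r : Carrier × Carrier
    r = project 0# 1# x y v₁ v₂

  -- The sign of v₂ tells which of y + v₂ and y - v₂ is certainly positive. The representative jumps
  -- where the case changes.
  ray : ∀ {x y v₁ v₂} → 0# < y → v₁ * v₁ + v₂ * v₂ ≈ y * y →
    Σ[ r ∈ ℙ¹.Carrier ] PointsTo (proj₁ r 0F) (proj₁ r 1F) x y v₁ v₂
  ray {x} {y} {v₁} {v₂} y>0 unit with compare v₂ 0#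
  ... | tri< v₂<0 _ _ = trailing {x} {y} {v₁} {v₂} (+-pos y>0 (neg⇒pos v₂<0)) ,
                        project-pointsTo 0# 1# unit
  ... | tri≈ _ v₂≈0 _ = leading {x} {y} {v₁} {v₂} y>0 (pos+nonNeg y>0 (inj₂ (sym v₂≈0))) ,
                        project-pointsTo 1# 0# unit
  ... | tri> _ _ v₂>0 = leading {x} {y} {v₁} {v₂} y>0 (+-pos y>0 v₂>0) ,
                        project-pointsTo 1# 0# unit

  tangent-cong : ∀ r r′ z z′ → r ℙ¹.≈ r′ → z ℍ².≈ z′ → tangent r z UT.≈ tangent r′ z′
  tangent-cong r r′ z z′ (k , k≉0 , e) z≈z′ = z≈z′ , pointsTo-unique r′ (proj₂ z′)
    (pointsTo-resp k≉0 (e 0F) (e 1F) (proj₁ z≈z′) (proj₂ z≈z′) refl refl (direction-pointsTo r z))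
    (direction-pointsTo r′ z′)

  tangent-injective : ∀ r r′ z z′ → tangent r z UT.≈ tangent r′ z′ → r ℙ¹.≈ r′ × z ℍ².≈ z′
  tangent-injective r r′ z z′ (z≈z′ , v≈v′) = parallel⇒≈ r r′ (pointsTo-parallel (proj₂ z′)
    (pointsTo-resp 1≉0 1* 1* (proj₁ z≈z′) (proj₂ z≈z′) (proj₁ v≈v′) (proj₂ v≈v′) (direction-pointsTo r z))
    (direction-pointsTo r′ z′)) , z≈z′
    where
    1* : ∀ {x} → x ≈ 1# * x
    1* = sym (*-identityˡ _)

  rayAt : UT.Carrier → ℙ¹.Carrier × ℍ².Carrier
  rayAt ((z@((x , y) , y>0) , (v₁ , v₂)) , u) = proj₁ (ray {x} {y} {v₁} {v₂} y>0 (unit-norm {x} {y} {v₁} {v₂} y>0 u)) , z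

  tangent-rayAt : ∀ u → tangent (proj₁ (rayAt u)) (proj₂ (rayAt u)) UT.≈ u
  tangent-rayAt ((z@((x , y) , y>0) , (v₁ , v₂)) , u) =
    let (r , d) = ray {x} {y} {v₁} {v₂} y>0 (unit-norm {x} {y} {v₁} {v₂} y>0 u) in
    ℍ².refl {z} , pointsTo-unique r y>0 (direction-pointsTo r z) d

  direction-normω : ∀ (r : ℙ¹.Carrier) (z : ℍ².Carrier) → let s = proj₁ r 0F ; t = proj₁ r 1F ; x = re ℝ (proj₁ z) ; y = im ℝ (proj₁ z) in
    normω s t x y * proj₁ (direction r z) ≈ (1# + 1#) * y * (s - t * x) * (t * y) ×
    normω s t x y * proj₂ (direction r z) ≈ y * ((s - t * x) * (s - t * x) - (t * y) * (t * y))
  direction-normω r z = pointsTo⇒normω (direction-pointsTo r z)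

  private
    s̲ t̲ x̲ y̲ p̲ q̲ n̲ : Polynomial 4
    s̲ = var 0F
    t̲ = var 1F
    x̲ = var 2F
    y̲ = var 3F
    p̲ = s̲ :- t̲ :* x̲
    q̲ = t̲ :* y̲
    n̲ = p̲ :* p̲ :+ q̲ :* q̲

  tangent-continuous : ∀ r z {ε} → 0# < ε → ∃ λ δ → 0# < δ × (∀ r′ z′ →
    Near nearness δ (r , z) (r′ , z′) → Near UTℍ²-nearness ε (tangent r z) (tangent r′ z′))
  tangent-continuous r z@((x , y) , y>0) {ε} ε>0 =
    let (δ₁ , δ₁>0 , c₁) = quotient-continuous {ρ = ρ r z} n̲ (con (+ 2) :* y̲ :* p̲ :* q̲)
                             {proj₁ (direction r z)} (normω-pos r y>0) (proj₁ (direction-normω r z)) ε>0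
        (δ₂ , δ₂>0 , c₂) = quotient-continuous {ρ = ρ r z} n̲ (y̲ :* (p̲ :* p̲ :- q̲ :* q̲))
                             {proj₂ (direction r z)} (normω-pos r y>0) (proj₂ (direction-normω r z)) ε>0
        (δ₃ , δ₃>0 , δ₃≤δ₁ , δ₃≤δ₂) = minimum δ₁>0 δ₂>0
        (δ , δ>0 , δ≤δ₃ , δ≤ε) = minimum δ₃>0 ε>0
    in δ , δ>0 , λ r′ z′ near →
      -- The estimates hold for the representative r″ of r′ that witnesses nearness, and pass to r′
      -- because the vector does not depend on the representative.
      let r″ = proj₁ (proj₁ near)
          d  = tangent-cong r″ r′ z′ z′ (proj₁ (proj₂ (proj₁ near))) (ℍ².refl {z′})
      in (close-mono δ≤ε (proj₁ (proj₂ near)) , close-mono δ≤ε (proj₂ (proj₂ near))) ,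
         close-resp refl (proj₁ (proj₂ d)) (c₁ {ρ r″ z′} {proj₁ (direction r″ z′)}
           (close δ r′ z′ near (≤-trans δ≤δ₃ δ₃≤δ₁)) (proj₁ (direction-normω r″ z′))) ,
         close-resp refl (proj₂ (proj₂ d)) (c₂ {ρ r″ z′} {proj₂ (direction r″ z′)}
           (close δ r′ z′ near (≤-trans δ≤δ₃ δ₃≤δ₂)) (proj₂ (direction-normω r″ z′)))
    where
    ρ : ℙ¹.Carrier → ℍ².Carrier → Vec Carrier 4
    ρ r ((x , y) , _) = proj₁ r 0F ∷ᵛ proj₁ r 1F ∷ᵛ x ∷ᵛ y ∷ᵛ []ᵛ
    close : ∀ δ {η} r′ z′ (near : Near nearness δ (r , z) (r′ , z′)) → δ ≤ η →
      CloseVec η (ρ r z) (ρ (proj₁ (proj₁ near)) z′)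
    close δ r′ z′ ((_ , _ , near) , cx , cy) le = λ
      { 0F → close-mono le (near 0F)
      ; 1F → close-mono le (near 1F)
      ; 2F → close-mono le cx
      ; 3F → close-mono le cy }

  private
    -- The two components of `project`, times a scaling factor, in the variables x, y, v₁, v₂, p, q
    -- and that factor.
    S̲ T̲ : Polynomial 7
    T̲ = var 6F :* (var 2F :* var 4F :+ (var 1F :- var 3F) :* var 5F)
    S̲ = var 6F :* (var 1F :* ((var 1F :+ var 3F) :* var 4F :+ var 2F :* var 5F) :+
                   var 0F :* (var 2F :* var 4F :+ (var 1F :- var 3F) :* var 5F))

  -- The representative found by `ray` is not continuous in v. Instead the fixed coordinates p, q of
  -- r are projected to the solution line of the nearby vector and divided by the fixed 2y². The
  -- result is polynomial in the nearby data and gives (s, t) back at the centre, so it is near r;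
  -- it represents r′ because both solve the same system.
  tangent-inverse-continuous : ∀ r z {ε} → 0# < ε → ∃ λ δ → 0# < δ × (∀ r′ z′ →
    Near UTℍ²-nearness δ (tangent r z) (tangent r′ z′) → Near nearness ε (r , z) (r′ , z′))
  tangent-inverse-continuous r z@((x , y) , y>0) {ε} ε>0 =
    let (ε₀ , ε₀>0 , nonzero) = nonzero-near r
        (η , η>0 , η≤ε₀ , η≤ε) = minimum ε₀>0 ε>0
        (δ₁ , δ₁>0 , c₁) = polynomial-continuous {ρ = ρ x y v} S̲ η>0
        (δ₂ , δ₂>0 , c₂) = polynomial-continuous {ρ = ρ x y v} T̲ η>0
        (δ₃ , δ₃>0 , δ₃≤δ₁ , δ₃≤δ₂) = minimum δ₁>0 δ₂>0
        (δ , δ>0 , δ≤δ₃ , δ≤η) = minimum δ₃>0 η>0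
    in δ , δ>0 , λ { r′ z′@((x′ , y′) , y′>0) ((cx , cy) , cv₁ , cv₂) →
      let v′ = direction r′ z′
          close : ∀ {θ} → δ ≤ θ → CloseVec θ (ρ x y v) (ρ x′ y′ v′)
          close le = λ { 0F → close-mono le cx ; 1F → close-mono le cy
                       ; 2F → close-mono le cv₁ ; 3F → close-mono le cv₂
                       ; 4F → close-refl (small-pos (small-mono le (small-0 δ>0))) refl
                       ; 5F → close-refl (small-pos (small-mono le (small-0 δ>0))) refl
                       ; 6F → close-refl (small-pos (small-mono le (small-0 δ>0))) refl }
          near : ∀ j → Close η (proj₁ r j) (projected x′ y′ v′ j)
          near = λ { 0F → close-resp S≈s refl (c₁ {ρ x′ y′ v′} (close (≤-trans δ≤δ₃ δ₃≤δ₁)))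
                   ; 1F → close-resp T≈t refl (c₂ {ρ x′ y′ v′} (close (≤-trans δ≤δ₃ δ₃≤δ₂))) }
          r″ : ℙ¹.Carrier
          r″ = projected x′ y′ v′ , nonzero λ j → close-mono η≤ε₀ (near j)
          d″ : PointsTo (proj₁ r″ 0F) (proj₁ r″ 1F) x′ y′ (proj₁ v′) (proj₂ v′)
          d″ = pointsTo-resp i⁻¹≉0 (rescale _) (rescale _) refl refl refl refl
                 (project-pointsTo p q (unit-norm {x′} {y′} {proj₁ v′} {proj₂ v′} y′>0 (direction-unit r′ z′)))
      in (r″ , parallel⇒≈ r″ r′ (pointsTo-parallel y′>0 d″ (direction-pointsTo r′ z′)) ,
           λ j → close-mono η≤ε (near j)) ,
         close-mono (≤-trans δ≤η η≤ε) cx , close-mono (≤-trans δ≤η η≤ε) cy }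
    where
    v : C ℝ
    v = direction r z
    p q i⁻¹ i : Carrier
    p = proj₁ r 0F - proj₁ r 1F * x
    q = proj₁ r 1F * y
    i⁻¹ = (1# + 1#) * (y * y)
    i⁻¹≉0 : i⁻¹ ≉ 0#
    i⁻¹≉0 = pos⇒nonzero (*-pos 2>0 (*-pos y>0 y>0))
    i = inv i⁻¹ i⁻¹≉0
    i⁻¹i≈1 : i⁻¹ * i ≈ 1#
    i⁻¹i≈1 = *-invʳ i⁻¹ i⁻¹≉0
    rescale : ∀ a → a ≈ i⁻¹ * (i * a)
    rescale a = sym (trans (sym (*-assoc _ _ _)) (trans (*-congʳ i⁻¹i≈1) (*-identityˡ a)))
    ρ : Carrier → Carrier → C ℝ → Vec Carrier 7
    ρ x y v = x ∷ᵛ y ∷ᵛ proj₁ v ∷ᵛ proj₂ v ∷ᵛ p ∷ᵛ q ∷ᵛ i ∷ᵛ []ᵛ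
    projected : Carrier → Carrier → C ℝ → Vector Carrier 2
    projected x y v = i * proj₁ (project p q x y (proj₁ v) (proj₂ v)) ∷
                      i * proj₂ (project p q x y (proj₁ v) (proj₂ v)) ∷ []
    unscale : ∀ {a b} → a ≈ i⁻¹ * b → i * a ≈ b
    unscale {a} {b} e = *-cancelˡ i⁻¹≉0 (trans (sym (rescale a)) e)
    S≈s : projected x y v 0F ≈ proj₁ r 0F
    S≈s = unscale (proj₁ (project-fixes (direction-pointsTo r z)))
    T≈t : projected x y v 1F ≈ proj₁ r 1F
    T≈t = unscale (proj₂ (project-fixes (direction-pointsTo r z)))

  ℙ¹×ℍ²≅UTℍ² : ℙ¹×ℍ² ≅ UTℍ² ℝ
  ℙ¹×ℍ²≅UTℍ² = nearness-≅ {X = ℙ¹×ℍ²} {UTℍ² ℝ} nearness UTℍ²-nearness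
    (λ (r , z) → tangent r z) rayAt
    (λ {(r , z)} {(r′ , z′)} (e , f) → tangent-cong r r′ z z′ e f)
    (λ {(r , z)} {(r′ , z′)} → tangent-injective r r′ z z′)
    tangent-rayAt
    (λ M (r , z) → tangent-equivariant M r z)
    (λ (r , z) ε>0 → let (δ , δ>0 , k) = tangent-continuous r z ε>0 in
      δ , δ>0 , λ {(r′ , z′)} → k r′ z′)
    (λ (r , z) ε>0 → let (δ , δ>0 , k) = tangent-inverse-continuous r z ε>0 in
      δ , δ>0 , λ {(r′ , z′)} → k r′ z′)

-- Cubic forms with a known real root.

module CubicForms (ℝ : CompleteOrderedField) where
  open CompleteOrderedField ℝ
  open FieldProperties fieldStructure
  open OrderProperties ℝ
  open IntegerSolver commutativeRing
  open import Algebra.Properties.Semiring.Exp semiring using (^-congˡ)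
  open Analysis ℝ
  open PointedPlane ℝ
  open UnitTangents ℝ using (normω; normω-pos)

  polynomial-cong : ∀ {n} (p : Polynomial n) {ρ ρ′ : Vec Carrier n} →
    (∀ i → lookup ρ i ≈ lookup ρ′ i) → ⟦ p ⟧ₚ ρ ≈ ⟦ p ⟧ₚ ρ′
  polynomial-cong (op [+] p q) e = +-cong (polynomial-cong p e) (polynomial-cong q e)
  polynomial-cong (op [*] p q) e = *-cong (polynomial-cong p e) (polynomial-cong q e)
  polynomial-cong (con c)      e = refl
  polynomial-cong (var i)      e = e i
  polynomial-cong (p :^ k)     e = ^-congˡ k (polynomial-cong p e)
  polynomial-cong (:- p)       e = -‿cong (polynomial-cong p e)

  square-root : ∀ {a} → 0# < a → ∃ λ x → 0# < x × x * x ≈ a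
  square-root {a} a>0 =
    -- The upper end 1 + a serves small and large a alike, since (1 + a)² - a = 1 + a + a².
    let (x , 0≤x , _ , φx≈0) = intermediate-value φ φ-continuous (+-pos 1-pos a>0) φ0<0 φ1+a>0
        x²≈a = trans (solve 2 (λ x a → x :* x := (x :* x :- a) :+ a) refl x a)
                     (trans (+-congʳ φx≈0) (+-identityˡ a))
    in x , nonzero⇒pos 0≤x x²≈a , x²≈a
    where
    φ : Carrier → Carrier
    φ x = x * x - a
    φ-continuous : ∀ x {ε} → 0# < ε → ∃ λ δ → 0# < δ × (∀ {y} → Close δ x y → Close ε (φ x) (φ y))
    φ-continuous x ε>0 =
      let (δ , δ>0 , c) = polynomial-continuous {ρ = x ∷ᵛ a ∷ᵛ []ᵛ} (var 0F :* var 0F :- var 1F) ε>0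
      in δ , δ>0 , λ {y} near → c {y ∷ᵛ a ∷ᵛ []ᵛ} λ { 0F → near ; 1F → close-refl δ>0 refl }
    φ0<0 : φ 0# < 0#
    φ0<0 = pos⇒neg (pos-resp (solve 1 (λ a → a := :- (con (+ 0) :* con (+ 0) :- a)) refl a) a>0)
    φ1+a>0 : 0# < φ (1# + a)
    φ1+a>0 = pos-resp (solve 1 (λ a → con (+ 1) :+ (a :+ a :* a) :=
      (con (+ 1) :+ a) :* (con (+ 1) :+ a) :- a) refl a) (+-pos 1-pos (+-pos a>0 (*-pos a>0 a>0)))
    nonzero⇒pos : ∀ {x} → 0# ≤ x → x * x ≈ a → 0# < x
    nonzero⇒pos (inj₁ p) _ = p
    nonzero⇒pos {x} (inj₂ 0≈x) e = ⊥-elim (pos⇒nonzero a>0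
      (trans (sym e) (trans (*-congʳ (sym 0≈x)) (zeroˡ x))))

  square-injective : ∀ {x y} → 0# < x → 0# < y → x * x ≈ y * y → x ≈ y
  square-injective {x} {y} x>0 y>0 e = *-cancelˡ (pos⇒nonzero (+-pos x>0 y>0)) (trans
    (solve 2 (λ x y → (x :+ y) :* x := x :* x :+ x :* y) refl x y)
    (trans (+-congʳ e) (solve 2 (λ x y → y :* y :+ x :* y := (x :+ y) :* y) refl x y)))

  -- (tX - sY)(AX² + BXY + CY²)
  multiply : (s t A B C : Carrier) → Cubic ℝ
  multiply s t A B C = t * A ∷ t * B - s * A ∷ t * C - s * B ∷ - (s * C) ∷ []

  multiply-cong : ∀ {s t A B C s′ t′ A′ B′ C′} → s ≈ s′ → t ≈ t′ → A ≈ A′ → B ≈ B′ → C ≈ C′ →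
    ∀ i → multiply s t A B C i ≈ multiply s′ t′ A′ B′ C′ i
  multiply-cong es et eA eB eC = λ
    { 0F → *-cong et eA
    ; 1F → +-cong (*-cong et eB) (-‿cong (*-cong es eA))
    ; 2F → +-cong (*-cong et eC) (-‿cong (*-cong es eB))
    ; 3F → -‿cong (*-cong es eC) }

  multiply-scale : ∀ k l s t A B C i →
    multiply (k * s) (k * t) (l * A) (l * B) (l * C) i ≈ k * l * multiply s t A B C i
  multiply-scale k l s t A B C = λ
    { 0F → solve 4 (λ k l t A → k :* t :* (l :* A) := k :* l :* (t :* A)) refl k l t A
    ; 1F → solve 6 (λ k l s t A B → k :* t :* (l :* B) :- k :* s :* (l :* A) :=
                                    k :* l :* (t :* B :- s :* A)) refl k l s t A B
    ; 2F → solve 6 (λ k l s t A B → k :* t :* (l :* B) :- k :* s :* (l :* A) :=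
                                    k :* l :* (t :* B :- s :* A)) refl k l s t B C
    ; 3F → solve 4 (λ k l s C → :- (k :* s :* (l :* C)) := k :* l :* (:- (s :* C))) refl k l s C }

  evaluate̲ : ∀ {n} (a b c d s t : Polynomial n) → Polynomial n
  evaluate̲ a b c d s t = a :* s :^ 3 :+ b :* (s :^ 2 :* t) :+ c :* (s :* t :^ 2) :+ d :* t :^ 3

  evaluate-cong : ∀ {f g : Cubic ℝ} {k s t} → (∀ i → f i ≈ k * g i) →
    evaluate ℝ f s t ≈ k * evaluate ℝ g s t
  evaluate-cong {f} {g} {k} {s} {t} e = trans
    (+-cong (+-cong (+-cong (*-congʳ (e 0F)) (*-congʳ (e 1F))) (*-congʳ (e 2F))) (*-congʳ (e 3F)))
    (solve 7 (λ k a b c d s t →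
      evaluate̲ (k :* a) (k :* b) (k :* c) (k :* d) s t := k :* evaluate̲ a b c d s t)
      refl k (g 0F) (g 1F) (g 2F) (g 3F) s t)

  evaluate-multiply : ∀ s t A B C u v → evaluate ℝ (multiply s t A B C) u v ≈
    (t * u - s * v) * (A * (u * u) + B * (u * v) + C * (v * v))
  evaluate-multiply = solve 7 (λ s t A B C u v →
    evaluate̲ (t :* A) (t :* B :- s :* A) (t :* C :- s :* B) (:- (s :* C)) u v :=
    (t :* u :- s :* v) :* (A :* (u :* u) :+ B :* (u :* v) :+ C :* (v :* v))) refl

  private
    Δ̲ : ∀ {n} (a b c d : Polynomial n) → Polynomial n
    Δ̲ a b c d = b :^ 2 :* c :^ 2 :- 4 :× (a :* c :^ 3) :- 4 :× (b :^ 3 :* d)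
      :- 27 :× (a :^ 2 :* d :^ 2) :+ 18 :× (a :* b :* c :* d)

  discriminant-scale : ∀ {f g : Cubic ℝ} {k} → (∀ i → f i ≈ k * g i) →
    discriminant ℝ f ≈ (k * k) * (k * k) * discriminant ℝ g
  discriminant-scale {f} {g} {k} e = trans
    (polynomial-cong (Δ̲ (var 0F) (var 1F) (var 2F) (var 3F))
      {f 0F ∷ᵛ f 1F ∷ᵛ f 2F ∷ᵛ f 3F ∷ᵛ []ᵛ}
      {k * g 0F ∷ᵛ k * g 1F ∷ᵛ k * g 2F ∷ᵛ k * g 3F ∷ᵛ []ᵛ}
      λ { 0F → e 0F ; 1F → e 1F ; 2F → e 2F ; 3F → e 3F })
    (solve 5 (λ k a b c d → Δ̲ (k :* a) (k :* b) (k :* c) (k :* d) :=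
      (k :* k) :* (k :* k) :* Δ̲ a b c d) refl k (g 0F) (g 1F) (g 2F) (g 3F))

  -- The discriminant of a product is the product of the discriminants times the squared resultant.
  -- The resultant of tX - sY with the quadratic form is, up to sign, the value of that form at (s,
  -- t).
  discriminant-multiply : ∀ s t A B C → - discriminant ℝ (multiply s t A B C) ≈
    (A * (s * s) + B * (s * t) + C * (t * t)) * (A * (s * s) + B * (s * t) + C * (t * t)) *
    ((1# + 1#) * (1# + 1#) * (A * C) - B * B)
  discriminant-multiply = solve 5 (λ s t A B C →
    let Q = A :* (s :* s) :+ B :* (s :* t) :+ C :* (t :* t) in
    :- Δ̲ (t :* A) (t :* B :- s :* A) (t :* C :- s :* B) (:- (s :* C)) :=
    Q :* Q :* (con (+ 2) :* con (+ 2) :* (A :* C) :- B :* B)) refl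

  -- If [s : t] is a root of f then (s⁴ + t⁴) f is the product of tX - sY and the
  -- quadratic form with coefficients factorA, factorB, factorC; in contrast to
  -- a division by s or t this works for every root.
  module _ {n : ℕ} (a b c d s t : Polynomial n) where
    factorA̲ factorB̲ factorC̲ : Polynomial n
    factorA̲ = a :* (t :* t :* t) :- s :* (b :* (s :* s) :+ c :* (s :* t) :+ d :* (t :* t))
    factorB̲ = t :* t :* (a :* s :+ b :* t) :- s :* s :* (c :* s :+ d :* t)
    factorC̲ = t :* (a :* (s :* s) :+ b :* (s :* t) :+ c :* (t :* t)) :- d :* (s :* s :* s)

  -- Kept as syntax in six fixed variables, so that the continuity lemmas apply to the factors.
  A̲ B̲ C̲ E̲ : Polynomial 6
  A̲ = factorA̲ (var 0F) (var 1F) (var 2F) (var 3F) (var 4F) (var 5F)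
  B̲ = factorB̲ (var 0F) (var 1F) (var 2F) (var 3F) (var 4F) (var 5F)
  C̲ = factorC̲ (var 0F) (var 1F) (var 2F) (var 3F) (var 4F) (var 5F)
  E̲ = evaluate̲ (var 0F) (var 1F) (var 2F) (var 3F) (var 4F) (var 5F)

  variables : Cubic ℝ → Carrier → Carrier → Vec Carrier 6
  variables f s t = f 0F ∷ᵛ f 1F ∷ᵛ f 2F ∷ᵛ f 3F ∷ᵛ s ∷ᵛ t ∷ᵛ []ᵛ

  factorA factorB factorC : Cubic ℝ → Carrier → Carrier → Carrier
  factorA f s t = ⟦ A̲ ⟧ₚ (variables f s t)
  factorB f s t = ⟦ B̲ ⟧ₚ (variables f s t)
  factorC f s t = ⟦ C̲ ⟧ₚ (variables f s t)

  quartic : Carrier → Carrier → Carrier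
  quartic s t = s * s * (s * s) + t * t * (t * t)

  quartic̲ : ∀ {n} (s t : Polynomial n) → Polynomial n
  quartic̲ s t = s :* s :* (s :* s) :+ t :* t :* (t :* t)

  quartic-pos : ∀ (r : ℙ¹.Carrier) → 0# < quartic (proj₁ r 0F) (proj₁ r 1F)
  quartic-pos r@(v , _) with nonzero-coordinate r
  ... | inj₁ n = pos+nonNeg (square-pos (*-nonzero n n)) (square-nonNeg (v 1F * v 1F))
  ... | inj₂ n = pos-resp (+-comm _ _)
    (pos+nonNeg (square-pos (*-nonzero n n)) (square-nonNeg (v 0F * v 0F)))

  -- The middle coefficients agree identically. The outer ones are off by s f(s, t) and t f(s, t),
  -- which vanish at a root.
  factorization : ∀ f s t → evaluate ℝ f s t ≈ 0# → ∀ i →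
    quartic s t * f i ≈ multiply s t (factorA f s t) (factorB f s t) (factorC f s t) i
  factorization f s t e = λ
    { 0F → trans (solve 6 (λ a b c d s t →
        quartic̲ s t :* a := t :* factorA̲ a b c d s t :+ s :* evaluate̲ a b c d s t) refl a b c d s t)
        (trans (+-congˡ (trans (*-congˡ e) (zeroʳ s))) (+-identityʳ _))
    ; 1F → solve 6 (λ a b c d s t →
        quartic̲ s t :* b := t :* factorB̲ a b c d s t :- s :* factorA̲ a b c d s t) refl a b c d s t
    ; 2F → solve 6 (λ a b c d s t →
        quartic̲ s t :* c := t :* factorC̲ a b c d s t :- s :* factorB̲ a b c d s t) refl a b c d s t
    ; 3F → trans (solve 6 (λ a b c d s t →
        quartic̲ s t :* d := :- (s :* factorC̲ a b c d s t) :+ t :* evaluate̲ a b c d s t) refl a b c d s t)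
        (trans (+-congˡ (trans (*-congˡ e) (zeroʳ t))) (+-identityʳ _)) }
    where
    a b c d : Carrier
    a = f 0F
    b = f 1F
    c = f 2F
    d = f 3F

  factors-multiply : ∀ {f s t A B C} → (∀ i → f i ≈ multiply s t A B C i) →
    factorA f s t ≈ quartic s t * A × factorB f s t ≈ quartic s t * B × factorC f s t ≈ quartic s t * C
  factors-multiply {f} {s} {t} {A} {B} {C} e =
    trans (cong-f A̲) (solve 5 (λ s t A B C → factorA̲ (t :* A) (t :* B :- s :* A) (t :* C :- s :* B)
      (:- (s :* C)) s t := quartic̲ s t :* A) refl s t A B C) ,
    trans (cong-f B̲) (solve 5 (λ s t A B C → factorB̲ (t :* A) (t :* B :- s :* A) (t :* C :- s :* B)
      (:- (s :* C)) s t := quartic̲ s t :* B) refl s t A B C) ,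
    trans (cong-f C̲) (solve 5 (λ s t A B C → factorC̲ (t :* A) (t :* B :- s :* A) (t :* C :- s :* B)
      (:- (s :* C)) s t := quartic̲ s t :* C) refl s t A B C)
    where
    cong-f : ∀ p → ⟦ p ⟧ₚ (variables f s t) ≈ ⟦ p ⟧ₚ (variables (multiply s t A B C) s t)
    cong-f p = polynomial-cong p λ
      { 0F → e 0F ; 1F → e 1F ; 2F → e 2F ; 3F → e 3F ; 4F → refl ; 5F → refl }

  cubic : (s t x y : Carrier) → Cubic ℝ
  cubic s t x y = multiply s t 1# (- ((1# + 1#) * x)) (x * x + y * y)

  cubic-cong : ∀ {k s t s′ t′ x y x′ y′} → s ≈ k * s′ → t ≈ k * t′ → x ≈ x′ → y ≈ y′ →
    ∀ i → cubic s t x y i ≈ k * cubic s′ t′ x′ y′ i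
  cubic-cong {k} es et ex ey i = trans
    (multiply-cong es et (1* 1#) (trans (-‿cong (*-congˡ ex)) (1* _))
      (trans (+-cong (*-cong ex ex) (*-cong ey ey)) (1* _)) i)
    (trans (multiply-scale k 1# _ _ _ _ _ i) (*-congʳ (*-identityʳ k)))
    where
    1* : ∀ x → x ≈ 1# * x
    1* x = sym (*-identityˡ x)

  -- A real root of f = m (tX - sY)(X - zY)(X - z̄Y) is [s : t], and the roots z, z̄
  -- are read off the quadratic factor.
  module _ {f : Cubic ℝ} {m s t x y : Carrier} (m≉0 : m ≉ 0#) (f≈ : ∀ i → f i ≈ m * cubic s t x y i) where

    -- At a real vector (u, v) the quadratic factor is |u - vz|² > 0, so only the linear factor can
    -- vanish.
    cubic-root : 0# < y → ∀ (r : ℙ¹.Carrier) → evaluate ℝ f (proj₁ r 0F) (proj₁ r 1F) ≈ 0# →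
      proj₁ r 0F * t ≈ proj₁ r 1F * s
    cubic-root y>0 r@(v , _) e = *-cancelˡ (*-nonzero m≉0 (pos⇒nonzero (normω-pos r y>0))) (trans
      (solve 8 (λ m s t x y u v n → (m :* n) :* (u :* t) :=
        m :* ((t :* u :- s :* v) :* n) :+ (m :* n) :* (v :* s)) refl m s t x y (v 0F) (v 1F) n)
      (trans (+-congʳ m*cubic≈0) (+-identityˡ _)))
      where
      n : Carrier
      n = normω (v 0F) (v 1F) x y
      m*cubic≈0 : m * ((t * v 0F - s * v 1F) * n) ≈ 0#
      m*cubic≈0 = trans (*-congˡ (trans
        (solve 6 (λ s t x y u v →
          (t :* u :- s :* v) :* ((u :- v :* x) :* (u :- v :* x) :+ (v :* y) :* (v :* y)) :=
          (t :* u :- s :* v) :* (con (+ 1) :* (u :* u) :+ (:- (con (+ 2) :* x)) :* (u :* v)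
            :+ (x :* x :+ y :* y) :* (v :* v))) refl s t x y (v 0F) (v 1F))
        (sym (evaluate-multiply s t 1# (- ((1# + 1#) * x)) (x * x + y * y) (v 0F) (v 1F)))))
        (trans (sym (evaluate-cong {f} {cubic s t x y} {m} f≈)) e)

    factorA-cubic : factorA f s t ≈ quartic s t * m
    -- This and `factorA-im` are the quadratic formula for x ± iy with denominators cleared, the
    -- form that `quotient-continuous` accepts.
    factorA-re : (1# + 1#) * factorA f s t * x ≈ - factorB f s t
    factorA-im : (1# + 1#) * (1# + 1#) * (factorA f s t * factorA f s t) * (y * y) ≈
      (1# + 1#) * (1# + 1#) * (factorA f s t * factorC f s t) - factorB f s t * factorB f s t

    private
      factors : factorA f s t ≈ quartic s t * (m * 1#) ×
        factorB f s t ≈ quartic s t * (m * (- ((1# + 1#) * x))) ×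
        factorC f s t ≈ quartic s t * (m * (x * x + y * y))
      factors = factors-multiply λ i → trans (f≈ i) (sym (trans
        (multiply-cong (1* s) (1* t) refl refl refl i)
        (trans (multiply-scale 1# m s t _ _ _ i) (*-congʳ (*-identityˡ m)))))
        where
        1* : ∀ x → x ≈ 1# * x
        1* x = sym (*-identityˡ x)

    factorA-cubic = trans (proj₁ factors) (*-congˡ (*-identityʳ m))
    factorA-re = trans (*-congʳ (*-congˡ (proj₁ factors))) (trans
      (solve 3 (λ k m x → con (+ 2) :* (k :* (m :* con (+ 1))) :* x := :- (k :* (m :* (:- (con (+ 2) :* x)))))
        refl (quartic s t) m x)
      (-‿cong (sym (proj₁ (proj₂ factors)))))
    factorA-im = trans (*-congʳ (*-congˡ (*-cong (proj₁ factors) (proj₁ factors)))) (trans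
      (solve 4 (λ k m x y → let A = k :* (m :* con (+ 1)) ; B = k :* (m :* (:- (con (+ 2) :* x))) in
        con (+ 2) :* con (+ 2) :* (A :* A) :* (y :* y) :=
        con (+ 2) :* con (+ 2) :* (A :* (k :* (m :* (x :* x :+ y :* y)))) :- B :* B)
        refl (quartic s t) m x y)
      (sym (+-cong (*-congˡ (*-cong (proj₁ factors) (proj₂ (proj₂ factors))))
        (-‿cong (*-cong (proj₁ (proj₂ factors)) (proj₁ (proj₂ factors)))))))

-- Existence of real roots, and the cubic with given roots.

module CubicRoots (ℝ : CompleteOrderedField) where
  open CompleteOrderedField ℝ
  open FieldProperties fieldStructure
  open OrderProperties ℝ
  open IntegerSolver commutativeRing
  open Analysis ℝ
  open PointedPlane ℝ
  open UnitTangents ℝ using (normω; normω-pos)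
  open CubicForms ℝ

  module Δ⁻ = GSpace (Δ⁻ ℝ) using (Carrier; _≈_; _·_)

  module _ (f : Cubic ℝ) (u₀ u₁ v₀ v₁ : Carrier) where
    segment₀ segment₁ : Carrier → Carrier
    segment₀ h = (1# - h) * u₀ + h * v₀
    segment₁ h = (1# - h) * u₁ + h * v₁

    opaque
      -- Linear independence keeps the segment from u to v away from the origin, so the zero found
      -- on it is a projective point.
      root-between : u₀ * v₁ ≉ u₁ * v₀ → evaluate ℝ f u₀ u₁ < 0# → 0# < evaluate ℝ f v₀ v₁ →
        ∃ λ h → 0# ≤ h × h ≤ 1# × NonzeroVector fieldStructure 1 (segment₀ h ∷ segment₁ h ∷ []) ×
          evaluate ℝ f (segment₀ h) (segment₁ h) ≈ 0#
      root-between independent fu<0 fv>0 =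
        let (h , 0≤h , h≤1 , e) = intermediate-value φ φ-continuous 1-pos
                                    (<-respˡ-≈ (sym φ0≈fu) fu<0) (pos-resp (sym φ1≈fv) fv>0)
        in h , 0≤h , h≤1 , nonzero h , e
        where
        φ : Carrier → Carrier
        φ h = evaluate ℝ f (segment₀ h) (segment₁ h)
        φ-continuous : ∀ h {ε} → 0# < ε → ∃ λ δ → 0# < δ × (∀ {k} → Close δ h k → Close ε (φ h) (φ k))
        φ-continuous h ε>0 =
          let (δ , δ>0 , c) = polynomial-continuous {ρ = ρ h} (evaluate̲ (var 0F) (var 1F) (var 2F) (var 3F)
                ((con (+ 1) :- var 8F) :* var 4F :+ var 8F :* var 6F)
                ((con (+ 1) :- var 8F) :* var 5F :+ var 8F :* var 7F)) ε>0
          in δ , δ>0 , λ {k} near → c {ρ k} λ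
            { 0F → close-refl δ>0 refl ; 1F → close-refl δ>0 refl ; 2F → close-refl δ>0 refl
            ; 3F → close-refl δ>0 refl ; 4F → close-refl δ>0 refl ; 5F → close-refl δ>0 refl
            ; 6F → close-refl δ>0 refl ; 7F → close-refl δ>0 refl ; 8F → near }
          where
          ρ : Carrier → Vec Carrier 9
          ρ h = f 0F ∷ᵛ f 1F ∷ᵛ f 2F ∷ᵛ f 3F ∷ᵛ u₀ ∷ᵛ u₁ ∷ᵛ v₀ ∷ᵛ v₁ ∷ᵛ h ∷ᵛ []ᵛ
        φ0≈fu : φ 0# ≈ evaluate ℝ f u₀ u₁
        φ0≈fu = solve 8 (λ a b c d u₀ u₁ v₀ v₁ →
          evaluate̲ a b c d ((con (+ 1) :- con (+ 0)) :* u₀ :+ con (+ 0) :* v₀)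
                     ((con (+ 1) :- con (+ 0)) :* u₁ :+ con (+ 0) :* v₁) := evaluate̲ a b c d u₀ u₁)
          refl (f 0F) (f 1F) (f 2F) (f 3F) u₀ u₁ v₀ v₁
        φ1≈fv : φ 1# ≈ evaluate ℝ f v₀ v₁
        φ1≈fv = solve 8 (λ a b c d u₀ u₁ v₀ v₁ →
          evaluate̲ a b c d ((con (+ 1) :- con (+ 1)) :* u₀ :+ con (+ 1) :* v₀)
                     ((con (+ 1) :- con (+ 1)) :* u₁ :+ con (+ 1) :* v₁) := evaluate̲ a b c d v₀ v₁)
          refl (f 0F) (f 1F) (f 2F) (f 3F) u₀ u₁ v₀ v₁
        nonzero : ∀ h → NonzeroVector fieldStructure 1 (segment₀ h ∷ segment₁ h ∷ [])
        nonzero h e = independent (trans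
          (solve 5 (λ h u₀ u₁ v₀ v₁ → let s = (con (+ 1) :- h) :* u₀ :+ h :* v₀
                                          t = (con (+ 1) :- h) :* u₁ :+ h :* v₁ in
            u₀ :* v₁ := (s :* v₁ :- t :* v₀) :+ (u₀ :* t :- u₁ :* s) :+ u₁ :* v₀) refl h u₀ u₁ v₀ v₁)
          (trans (+-congʳ (+-cong
              (+-cong (*-congʳ (e 0F)) (-‿cong (*-congʳ (e 1F))))
              (+-cong (*-congˡ (e 1F)) (-‿cong (*-congˡ (e 0F))))))
            (solve 4 (λ u₀ u₁ v₀ v₁ →
              (con (+ 0) :* v₁ :- con (+ 0) :* v₀) :+ (u₀ :* con (+ 0) :- u₁ :* con (+ 0)) :+ u₁ :* v₀
              := u₁ :* v₀) refl u₀ u₁ v₀ v₁)))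

  segment-close : ∀ {ε x a b h} → 0# ≤ h → h ≤ 1# → Close ε x a → Close ε x b →
    Close ε x ((1# - h) * a + h * b)
  segment-close {ε} {x} {a} {b} {h} 0≤h h≤1 ca cb = small⇒close
    ( pos-resp (solve 5 (λ ε x a b h →
        (con (+ 1) :- h) :* (ε :+ (a :- x)) :+ h :* (ε :+ (b :- x)) :=
        ε :+ (((con (+ 1) :- h) :* a :+ h :* b) :- x)) refl ε x a b h)
        (convex (proj₁ (close⇒small ca)) (proj₁ (close⇒small cb)))
    , pos-resp (solve 5 (λ ε x a b h →
        (con (+ 1) :- h) :* (ε :- (a :- x)) :+ h :* (ε :- (b :- x)) :=
        ε :- (((con (+ 1) :- h) :* a :+ h :* b) :- x)) refl ε x a b h)
        (convex (proj₂ (close⇒small ca)) (proj₂ (close⇒small cb))))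
    where
    convex : ∀ {p q} → 0# < p → 0# < q → 0# < (1# - h) * p + h * q
    convex {p} {q} p>0 q>0 with compare h 1#
    ... | tri< h<1 _ _ = pos+nonNeg (*-pos (<⇒pos h<1) p>0) (nonNeg-* 0≤h (inj₁ q>0))
    ... | tri≈ _ h≈1 _ = pos-resp (trans
          (solve 2 (λ p q → q := (con (+ 1) :- con (+ 1)) :* p :+ con (+ 1) :* q) refl p q)
          (sym (+-cong (*-congʳ (+-congˡ (-‿cong h≈1))) (*-congʳ h≈1)))) q>0
    ... | tri> _ _ 1<h = ⊥-elim (<-irrefl (≤-<-trans h≤1 1<h))

  module _ (f : Cubic ℝ) where
    private
      value-10 : evaluate ℝ f 1# 0# ≈ f 0F
      value-10 = solve 4 (λ a b c d → evaluate̲ a b c d (con (+ 1)) (con (+ 0)) := a) refl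
        (f 0F) (f 1F) (f 2F) (f 3F)

      value-01 : evaluate ℝ f 0# 1# ≈ f 3F
      value-01 = solve 4 (λ a b c d → evaluate̲ a b c d (con (+ 0)) (con (+ 1)) := d) refl
        (f 0F) (f 1F) (f 2F) (f 3F)

      value-neg : ∀ u v → evaluate ℝ f (- u) (- v) ≈ - evaluate ℝ f u v
      value-neg = solve 6 (λ a b c d u v →
        evaluate̲ a b c d (:- u) (:- v) := :- evaluate̲ a b c d u v) refl (f 0F) (f 1F) (f 2F) (f 3F)

    RealRoot : Set
    RealRoot = ∃ λ (r : ℙ¹.Carrier) → evaluate ℝ f (proj₁ r 0F) (proj₁ r 1F) ≈ 0#

    private
      from-segment : ∀ {u₀ u₁ v₀ v₁} → u₀ * v₁ - u₁ * v₀ ≉ 0# →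
        evaluate ℝ f u₀ u₁ < 0# → 0# < evaluate ℝ f v₀ v₁ → RealRoot
      from-segment {u₀} {u₁} {v₀} {v₁} n p q =
        let (h , _ , _ , w≉0 , e) = root-between f u₀ u₁ v₀ v₁
              (λ e → n (trans (+-congʳ e) (-‿inverseʳ _))) p q
        in (_ , w≉0) , e

    -- f is odd, so it changes sign between (1, 0) and (0, 1) or between (0, 1)
    -- and (-1, 0).
    real-root : RealRoot
    real-root with compare (f 0F) 0# | compare (f 3F) 0#
    ... | tri≈ _ a≈0 _ | _            = ((1# ∷ 0# ∷ []) , λ e → 1≉0 (e 0F)) , trans value-10 a≈0
    ... | _            | tri≈ _ d≈0 _ = ((0# ∷ 1# ∷ []) , λ e → 1≉0 (e 1F)) , trans value-01 d≈0
    ... | tri< a<0 _ _ | tri> _ _ d>0 = from-segment {1#} {0#} {0#} {1#}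
      (λ e → 1≉0 (trans (solve 0 (con (+ 1) := con (+ 1) :* con (+ 1) :- con (+ 0) :* con (+ 0)) refl) e))
      (<-respˡ-≈ (sym value-10) a<0) (pos-resp (sym value-01) d>0)
    ... | tri> _ _ a>0 | tri< d<0 _ _ = from-segment {0#} {1#} {1#} {0#}
      (λ e → 1≉0 (trans (solve 0 (con (+ 1) :=
        :- (con (+ 0) :* con (+ 0) :- con (+ 1) :* con (+ 1))) refl)
        (trans (-‿cong e) (solve 0 (:- con (+ 0) := con (+ 0)) refl))))
      (<-respˡ-≈ (sym value-01) d<0) (pos-resp (sym value-10) a>0)
    ... | tri< a<0 _ _ | tri< d<0 _ _ = from-segment {0#} {1#} { - 1# } { - 0# }
      (λ e → 1≉0 (trans (solve 0 (con (+ 1) :=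
        con (+ 0) :* (:- con (+ 0)) :- con (+ 1) :* (:- con (+ 1))) refl) e))
      (<-respˡ-≈ (sym value-01) d<0)
      (pos-resp (sym (trans (value-neg 1# 0#) (-‿cong value-10))) (neg⇒pos a<0))
    ... | tri> _ _ a>0 | tri> _ _ d>0 = from-segment { - 1# } { - 0# } {0#} {1#}
      (λ e → 1≉0 (trans (solve 0 (con (+ 1) :=
        :- ((:- con (+ 1)) :* con (+ 1) :- (:- con (+ 0)) :* con (+ 0))) refl)
        (trans (-‿cong e) (solve 0 (:- con (+ 0) := con (+ 0)) refl))))
      (<-respˡ-≈ (sym (trans (value-neg 1# 0#) (-‿cong value-10)))
        (pos⇒neg (pos-resp (solve 1 (λ a → a := :- :- a) refl (f 0F)) a>0)))
      (pos-resp (sym value-01) d>0)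

  cubicOf : ℙ¹.Carrier → ℍ².Carrier → Δ⁻.Carrier
  cubicOf r@(v , v≉0) ((x , y) , y>0) =
    (cubic s t x y , λ e → v≉0 λ { 0F → s≈0 (e 0F) (e 1F) ; 1F → t≈0 (e 0F) }) ,
    -- Minus the discriminant is N² (2y)² with N = |s - tz|².
    pos⇒neg (pos-resp (sym (trans (discriminant-multiply s t 1# (- ((1# + 1#) * x)) (x * x + y * y))
        (solve 4 (λ s t x y →
          let Q = con (+ 1) :* (s :* s) :+ (:- (con (+ 2) :* x)) :* (s :* t) :+ (x :* x :+ y :* y) :* (t :* t)
              N = (s :- t :* x) :* (s :- t :* x) :+ (t :* y) :* (t :* y) in
          Q :* Q :* (con (+ 2) :* con (+ 2) :* (con (+ 1) :* (x :* x :+ y :* y)) :-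
            (:- (con (+ 2) :* x)) :* (:- (con (+ 2) :* x))) :=
          (N :* N) :* ((con (+ 2) :* y) :* (con (+ 2) :* y))) refl s t x y)))
      (*-pos (*-pos N>0 N>0) (*-pos (*-pos 2>0 y>0) (*-pos 2>0 y>0))))
    where
    s t : Carrier
    s = v 0F
    t = v 1F
    N>0 : 0# < normω s t x y
    N>0 = normω-pos r y>0
    t≈0 : t * 1# ≈ 0# → t ≈ 0#
    t≈0 e = trans (sym (*-identityʳ t)) e
    s≈0 : t * 1# ≈ 0# → t * (- ((1# + 1#) * x)) - s * 1# ≈ 0# → s ≈ 0#
    s≈0 e e′ = trans
      (solve 3 (λ s t x → s := (t :* con (+ 1)) :* (:- (con (+ 2) :* x)) :-
        (t :* (:- (con (+ 2) :* x)) :- s :* con (+ 1))) refl s t x)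
      (trans (+-cong (*-congʳ e) (-‿cong e′))
        (solve 1 (λ x → con (+ 0) :* (:- (con (+ 2) :* x)) :- con (+ 0) := con (+ 0)) refl x))

  cubicOf-cong : ∀ r r′ z z′ → r ℙ¹.≈ r′ → z ℍ².≈ z′ → cubicOf r z Δ⁻.≈ cubicOf r′ z′
  cubicOf-cong r r′ z z′ (k , k≉0 , e) z≈z′ =
    k , k≉0 , cubic-cong (e 0F) (e 1F) (proj₁ z≈z′) (proj₂ z≈z′)

  -- The only real root determines r. Replacing r′ by r then lets both cubics be factored at the
  -- same (s, t), so that the quadratic formulas for z and z′ have the same coefficients.
  cubicOf-injective : ∀ r r′ z z′ → cubicOf r z Δ⁻.≈ cubicOf r′ z′ → r ℙ¹.≈ r′ × z ℍ².≈ z′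
  cubicOf-injective r r′ z@((x , y) , y>0) z′@((x′ , y′) , y′>0) (m , m≉0 , e) = r≈r′ ,
    *-cancelˡ (*-nonzero (pos⇒nonzero 2>0) A≉0)
      (trans (factorA-re 1≉0 e₁) (sym (factorA-re k≉0 e₂))) ,
    square-injective y>0 y′>0 (*-cancelˡ (*-nonzero (*-nonzero 2≉0 2≉0) (*-nonzero A≉0 A≉0))
      (trans (factorA-im 1≉0 e₁) (sym (factorA-im k≉0 e₂))))
    where
    s t : Carrier
    s = proj₁ r 0F
    t = proj₁ r 1F
    f : Cubic ℝ
    f = cubic s t x y
    2≉0 : 1# + 1# ≉ 0#
    2≉0 = pos⇒nonzero 2>0
    e₁ : ∀ i → f i ≈ 1# * cubic s t x y i
    e₁ i = sym (*-identityˡ _)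
    fr≈0 : evaluate ℝ f s t ≈ 0#
    fr≈0 = trans (evaluate-multiply s t 1# (- ((1# + 1#) * x)) (x * x + y * y) s t)
      (trans (*-congʳ (solve 2 (λ s t → t :* s :- s :* t := con (+ 0)) refl s t)) (zeroˡ _))
    r≈r′ : r ℙ¹.≈ r′
    r≈r′ = parallel⇒≈ r r′ (cubic-root {f} m≉0 e y′>0 r fr≈0)
    fz′ : cubicOf r z Δ⁻.≈ cubicOf r z′
    fz′ = GSpace.trans (Δ⁻ ℝ) {cubicOf r z} {cubicOf r′ z′} {cubicOf r z′} (m , m≉0 , e)
      (cubicOf-cong r′ r z′ z′ (ℙ¹.sym {r} {r′} r≈r′) (ℍ².refl {z′}))
    k : Carrier
    k = proj₁ fz′
    k≉0 : k ≉ 0#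
    k≉0 = proj₁ (proj₂ fz′)
    e₂ : ∀ i → f i ≈ k * cubic s t x′ y′ i
    e₂ = proj₂ (proj₂ fz′)
    A≉0 : factorA f s t ≉ 0#
    A≉0 A≈0 = *-nonzero (pos⇒nonzero (quartic-pos r)) 1≉0 (trans (sym (factorA-cubic 1≉0 e₁)) A≈0)

-- Recovering the roots, and equivariance of the cubic.

module CubicIso (ℝ : CompleteOrderedField) where
  open CompleteOrderedField ℝ
  open FieldProperties fieldStructure
  open OrderProperties ℝ
  open IntegerSolver commutativeRing
  open Analysis ℝ
  open PointedPlane ℝ
  open CubicForms ℝ
  open CubicRoots ℝ

  module _ (φ : Δ⁻.Carrier) where
    private
      f : Cubic ℝ
      f = proj₁ (proj₁ φ)
      r : ℙ¹.Carrier
      r = proj₁ (real-root f)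
      s t K A B C′ : Carrier
      s = proj₁ r 0F
      t = proj₁ r 1F
      K = quartic s t
      A = factorA f s t
      B = factorB f s t
      C′ = factorC f s t
      Kf≈ : ∀ i → multiply s t A B C′ i ≈ K * f i
      Kf≈ i = sym (factorization f s t (proj₂ (real-root f)) i)
      K≉0 : K ≉ 0#
      K≉0 = pos⇒nonzero (quartic-pos r)
      2ℝ Q D : Carrier
      2ℝ = 1# + 1#
      Q = A * (s * s) + B * (s * t) + C′ * (t * t)
      D = 2ℝ * 2ℝ * (A * C′) - B * B
      2≉0 : 2ℝ ≉ 0#
      2≉0 = pos⇒nonzero 2>0

      QQD>0 : 0# < (Q * Q) * D
      QQD>0 = pos-resp (trans
        (solve 2 (λ k d → k :* k :* (k :* k) :* (:- d) := :- (k :* k :* (k :* k) :* d)) refl K (discriminant ℝ f))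
        (trans (-‿cong (sym (discriminant-scale Kf≈))) (discriminant-multiply s t A B C′)))
        (*-pos (*-pos (square-pos K≉0) (square-pos K≉0)) (neg⇒pos (proj₂ φ)))

      -- Minus the discriminant of f times K⁴ is Q²D. As it is positive, the discriminant -D of the
      -- quadratic factor is negative and the other two roots are not real.
      D>0 : 0# < D
      D>0 with square-nonNeg Q
      ... | inj₁ p = pos-cancelˡ p QQD>0
      ... | inj₂ e = ⊥-elim (pos⇒nonzero QQD>0 (trans (*-congʳ (sym e)) (zeroˡ D)))

      -- For A = 0 one would have D = -B² ≤ 0.
      A≉0 : A ≉ 0#
      A≉0 A≈0 = <-irrefl (pos-resp (trans
        (+-congʳ (+-congʳ (*-congˡ (*-congʳ A≈0))))
        (solve 3 (λ k b c → k :* (con (+ 0) :* c) :- b :+ b := con (+ 0)) refl (2ℝ * 2ℝ) (B * B) C′))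
        (pos+nonNeg D>0 (square-nonNeg B)))

      2A≉0 : 2ℝ * A ≉ 0#
      2A≉0 = *-nonzero 2≉0 A≉0
      i x : Carrier
      i = inv (2ℝ * A) 2A≉0
      x = - B * i
      2Ai≈1 : 2ℝ * A * i ≈ 1#
      2Ai≈1 = *-invʳ (2ℝ * A) 2A≉0
      i≉0 : i ≉ 0#
      i≉0 = unit-nonzero (trans (*-comm i (2ℝ * A)) 2Ai≈1)

      root : ∃ λ y → 0# < y × y * y ≈ D * (i * i)
      root = square-root (*-pos D>0 (square-pos i≉0))
      y : Carrier
      y = proj₁ root

      B≈ : B ≈ A * (- (2ℝ * x))
      B≈ = trans (sym (trans (*-congˡ 2Ai≈1) (*-identityʳ B)))
        (solve 3 (λ a b i → b :* (con (+ 2) :* a :* i) := a :* (:- (con (+ 2) :* ((:- b) :* i)))) refl A B i)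

      C≈ : C′ ≈ A * (x * x + y * y)
      C≈ = trans (sym (trans (*-congˡ (trans (*-cong 2Ai≈1 2Ai≈1) (*-identityʳ 1#))) (*-identityʳ C′)))
        (trans (solve 4 (λ a b c i → c :* ((con (+ 2) :* a :* i) :* (con (+ 2) :* a :* i)) :=
          a :* (((:- b) :* i) :* ((:- b) :* i) :+ (con (+ 2) :* con (+ 2) :* (a :* c) :- b :* b) :* (i :* i)))
          refl A B C′ i)
        (*-congˡ (+-congˡ (sym (proj₂ (proj₂ root))))))

    roots : ℙ¹.Carrier × ℍ².Carrier
    roots = r , ((x , y) , proj₁ (proj₂ root))

    cubicOf-roots : cubicOf (proj₁ roots) (proj₂ roots) Δ⁻.≈ φ
    cubicOf-roots = GSpace.sym (Δ⁻ ℝ) {φ} {cubicOf (proj₁ roots) (proj₂ roots)}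
      (inv K K≉0 * A , *-nonzero K⁻¹≉0 A≉0 , λ j → *-cancelˡ K≉0 (begin
        K * f j                             ≈⟨ Kf≈ j ⟨
        multiply s t A B C′ j               ≈⟨ multiply-cong (1* s) (1* t) (sym (*-identityʳ A)) B≈ C≈ j ⟩
        multiply (1# * s) (1# * t) (A * 1#) (A * (- (2ℝ * x))) (A * (x * x + y * y)) j
                                            ≈⟨ multiply-scale 1# A s t _ _ _ j ⟩
        1# * A * cubic s t x y j            ≈⟨ *-congʳ (*-congʳ (*-invʳ K K≉0)) ⟨
        K * inv K K≉0 * A * cubic s t x y j ≈⟨ solve 4 (λ k l a c → k :* l :* a :* c := k :* (l :* a :* c))
                                                 refl K (inv K K≉0) A (cubic s t x y j) ⟩
        K * (inv K K≉0 * A * cubic s t x y j) ∎))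
      where
      open import Relation.Binary.Reasoning.Setoid setoid
      1* : ∀ x → x ≈ 1# * x
      1* x = sym (*-identityˡ x)
      K⁻¹≉0 : inv K K≉0 ≉ 0#
      K⁻¹≉0 = unit-nonzero (trans (*-comm _ _) (*-invʳ K K≉0))

  -- Substituting the inverse matrix turns tX - sY into t′X - s′Y, and X - zY into jX - nY with j =
  -- cz + d and n = az + b. As n is j times the image of z, the forms differ by the factor J = |j|².
  -- Once multiplied by J, the coefficients are polynomials in the entries, and the claim is the
  -- ring identity `transformed`.
  cubicOf-equivariant : ∀ M r z →
    cubicOf (möbius fieldStructure M r) (isometry ℝ M z) Δ⁻.≈ M Δ⁻.· cubicOf r z
  cubicOf-equivariant M r z@((x , y) , y>0) =
    J⁻¹ , J⁻¹≉0 , λ i → *-cancelˡ J≉0 (trans (J*cubic i) (sym (trans (sym (*-assoc _ _ _))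
      (trans (*-congʳ (*-invʳ J J≉0)) (*-identityˡ _)))))
    where
    open SL₂ M
    s t s′ t′ u v j₁ j₂ n₁ n₂ J J⁻¹ : Carrier
    s = proj₁ r 0F
    t = proj₁ r 1F
    s′ = a * s + b * t
    t′ = c * s + d * t
    u = proj₁ (proj₁ (isometry ℝ M z))
    v = proj₂ (proj₁ (isometry ℝ M z))
    j₁ = (c * x - 0# * y) + d
    j₂ = (c * y + 0# * x) + 0#
    n₁ = (a * x - 0# * y) + b
    n₂ = (a * y + 0# * x) + 0#
    jw≈n : (j₁ * u - j₂ * v ≈ n₁) × (j₁ * v + j₂ * u ≈ n₂)
    jw≈n = denominator*fractional (ℂ ℝ) (complexify ℝ M) (x , y) (denominator-nonzero ℝ M (nonreal ℝ z))
    J = j₁ * j₁ + j₂ * j₂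
    J≉0 : J ≉ 0#
    J≉0 = pos⇒nonzero (∣∣²-pos ℝ (denominator-nonzero ℝ M (nonreal ℝ z)))
    J⁻¹ = inv J J≉0
    J⁻¹≉0 : J⁻¹ ≉ 0#
    J⁻¹≉0 = unit-nonzero (trans (*-comm _ _) (*-invʳ J J≉0))
    Ju≈ : J * u ≈ n₁ * j₁ + n₂ * j₂
    Ju≈ = trans (solve 4 (λ p q u v → (p :* p :+ q :* q) :* u :=
      (p :* u :- q :* v) :* p :+ (p :* v :+ q :* u) :* q) refl j₁ j₂ u v)
      (+-cong (*-congʳ (proj₁ jw≈n)) (*-congʳ (proj₂ jw≈n)))
    Jn≈ : J * (u * u + v * v) ≈ n₁ * n₁ + n₂ * n₂
    Jn≈ = trans (solve 4 (λ p q u v → (p :* p :+ q :* q) :* (u :* u :+ v :* v) :=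
      (p :* u :- q :* v) :* (p :* u :- q :* v) :+ (p :* v :+ q :* u) :* (p :* v :+ q :* u)) refl j₁ j₂ u v)
      (+-cong (*-cong (proj₁ jw≈n) (proj₁ jw≈n)) (*-cong (proj₂ jw≈n) (proj₂ jw≈n)))
    transformed : ∀ i → multiply s′ t′ J (- ((1# + 1#) * (n₁ * j₁ + n₂ * j₂))) (n₁ * n₁ + n₂ * n₂) i ≈
      coefficient ℝ (t * 1#) (t * (- ((1# + 1#) * x)) - s * 1#)
        (t * (x * x + y * y) - s * (- ((1# + 1#) * x))) (- (s * (x * x + y * y))) d (- b) (- c) a i
    transformed = λ
      { 0F → solve 8 (λ a b c d s t x y → m₀ a b c d s t x y :=
               k₀ (t :* con (+ 1)) (f₁ s t x) (f₂ s t x y) (f₃ s x y) d (:- b) (:- c) a) refl a b c d s t x y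
      ; 1F → solve 8 (λ a b c d s t x y → m₁ a b c d s t x y :=
               k₁ (t :* con (+ 1)) (f₁ s t x) (f₂ s t x y) (f₃ s x y) d (:- b) (:- c) a) refl a b c d s t x y
      ; 2F → solve 8 (λ a b c d s t x y → m₂ a b c d s t x y :=
               k₂ (t :* con (+ 1)) (f₁ s t x) (f₂ s t x y) (f₃ s x y) d (:- b) (:- c) a) refl a b c d s t x y
      ; 3F → solve 8 (λ a b c d s t x y → m₃ a b c d s t x y :=
               k₃ (t :* con (+ 1)) (f₁ s t x) (f₂ s t x y) (f₃ s x y) d (:- b) (:- c) a) refl a b c d s t x y }
      where
      module _ {n : ℕ} where
        P : Set
        P = Polynomial n
        k₀ k₁ k₂ k₃ m₀ m₁ m₂ m₃ J̲ U̲ N̲ : P → P → P → P → P → P → P → P → P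
        k₀ a b c d α β γ δ = a :* α :^ 3 :+ b :* (α :^ 2 :* γ) :+ c :* (α :* γ :^ 2) :+ d :* γ :^ 3
        k₁ a b c d α β γ δ =
          3 :× (a :* (α :^ 2 :* β)) :+ b :* (α :^ 2 :* δ :+ 2 :× (α :* β :* γ))
            :+ c :* (β :* γ :^ 2 :+ 2 :× (α :* γ :* δ)) :+ 3 :× (d :* (γ :^ 2 :* δ))
        k₂ a b c d α β γ δ =
          3 :× (a :* (α :* β :^ 2)) :+ b :* (β :^ 2 :* γ :+ 2 :× (α :* β :* δ))
            :+ c :* (α :* δ :^ 2 :+ 2 :× (β :* γ :* δ)) :+ 3 :× (d :* (γ :* δ :^ 2))
        k₃ a b c d α β γ δ = a :* β :^ 3 :+ b :* (β :^ 2 :* δ) :+ c :* (β :* δ :^ 2) :+ d :* δ :^ 3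
        f₁ : P → P → P → P
        f₁ s t x = t :* (:- (con (+ 2) :* x)) :- s :* con (+ 1)
        f₂ : P → P → P → P → P
        f₂ s t x y = t :* (x :* x :+ y :* y) :- s :* (:- (con (+ 2) :* x))
        f₃ : P → P → P → P
        f₃ s x y = :- (s :* (x :* x :+ y :* y))
        lin lin′ : P → P → P → P → P
        lin  a b x y = (a :* x :- con (+ 0) :* y) :+ b
        lin′ a b x y = (a :* y :+ con (+ 0) :* x) :+ con (+ 0)
        J̲ a b c d s t x y = lin c d x y :* lin c d x y :+ lin′ c d x y :* lin′ c d x y
        U̲ a b c d s t x y = :- (con (+ 2) :* (lin a b x y :* lin c d x y :+ lin′ a b x y :* lin′ c d x y))
        N̲ a b c d s t x y = lin a b x y :* lin a b x y :+ lin′ a b x y :* lin′ a b x y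
        m₀ a b c d s t x y = (c :* s :+ d :* t) :* J̲ a b c d s t x y
        m₁ a b c d s t x y = (c :* s :+ d :* t) :* U̲ a b c d s t x y :- (a :* s :+ b :* t) :* J̲ a b c d s t x y
        m₂ a b c d s t x y = (c :* s :+ d :* t) :* N̲ a b c d s t x y :- (a :* s :+ b :* t) :* U̲ a b c d s t x y
        m₃ a b c d s t x y = :- ((a :* s :+ b :* t) :* N̲ a b c d s t x y)
    J*cubic : ∀ i → J * cubic s′ t′ u v i ≈
      coefficient ℝ (t * 1#) (t * (- ((1# + 1#) * x)) - s * 1#)
        (t * (x * x + y * y) - s * (- ((1# + 1#) * x))) (- (s * (x * x + y * y))) d (- b) (- c) a i
    J*cubic i = trans (sym (trans (multiply-scale 1# J s′ t′ _ _ _ i) (*-congʳ (*-identityˡ J))))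
      (trans (multiply-cong (*-identityˡ s′) (*-identityˡ t′) (*-identityʳ J)
        (trans (solve 2 (λ k u → k :* (:- (con (+ 2) :* u)) := :- (con (+ 2) :* (k :* u))) refl J u)
          (-‿cong (*-congˡ Ju≈))) Jn≈ i)
      (transformed i))

-- Continuous dependence between cubics and roots.

module CubicContinuity (ℝ : CompleteOrderedField) where
  open CompleteOrderedField ℝ
  open FieldProperties fieldStructure
  open OrderProperties ℝ
  open IntegerSolver commutativeRing
  open Analysis ℝ
  open Topologies ℝ
  open ProjectiveSpaces ℝ
  open PointedPlane ℝ
  open UnitTangents ℝ using (normω; normω-pos)
  open CubicForms ℝ
  open CubicRoots ℝ
  open CubicIso ℝ
  open Nearness

  Δ⁻-nearness : Nearness (GSpace.topology (Δ⁻ ℝ))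
  Δ⁻-nearness = subspace-nearness {S = ℝℙ³ ℝ} (ℝℙ-nearness 3) (IsNegative ℝ)

  private
    c̲ : Fin 4 → Polynomial 4
    c̲ = λ
      { 0F → var 1F :* con (+ 1)
      ; 1F → var 1F :* (:- (con (+ 2) :* var 2F)) :- var 0F :* con (+ 1)
      ; 2F → var 1F :* (var 2F :* var 2F :+ var 3F :* var 3F) :- var 0F :* (:- (con (+ 2) :* var 2F))
      ; 3F → :- (var 0F :* (var 2F :* var 2F :+ var 3F :* var 3F)) }

    ρ : ℙ¹.Carrier → ℍ².Carrier → Vec Carrier 4
    ρ r ((x , y) , _) = proj₁ r 0F ∷ᵛ proj₁ r 1F ∷ᵛ x ∷ᵛ y ∷ᵛ []ᵛ

    c̲≈cubic : ∀ r z i → ⟦ c̲ i ⟧ₚ (ρ r z) ≈ proj₁ (proj₁ (cubicOf r z)) i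
    c̲≈cubic r z = λ { 0F → refl ; 1F → refl ; 2F → refl ; 3F → refl }

  cubicOf-continuous : ∀ r z {ε} → 0# < ε → ∃ λ δ → 0# < δ × (∀ r′ z′ →
    Near nearness δ (r , z) (r′ , z′) → Near Δ⁻-nearness ε (cubicOf r z) (cubicOf r′ z′))
  cubicOf-continuous r z {ε} ε>0 =
    let c = λ i → polynomial-continuous {ρ = ρ r z} (c̲ i) ε>0
        (δ , δ>0 , δ≤) = minimumᵥ (λ i → proj₁ (c i)) (λ i → proj₁ (proj₂ (c i)))
    in δ , δ>0 , λ r′ z′ near →
      let r″ = proj₁ (proj₁ near) in
      proj₁ (cubicOf r″ z′) ,
      cubicOf-cong r″ r′ z′ z′ (proj₁ (proj₂ (proj₁ near))) (ℍ².refl {z′}) ,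
      λ i → close-resp (c̲≈cubic r z i) (c̲≈cubic r″ z′ i)
        (proj₂ (proj₂ (c i)) {ρ r″ z′} (close r′ z′ (δ≤ i) near))
    where
    close : ∀ {δ η} r′ z′ → δ ≤ η → (near : Near nearness δ (r , z) (r′ , z′)) →
      CloseVec η (ρ r z) (ρ (proj₁ (proj₁ near)) z′)
    close r′ z′ le ((_ , _ , near) , cx , cy) = λ
      { 0F → close-mono le (near 0F)
      ; 1F → close-mono le (near 1F)
      ; 2F → close-mono le cx
      ; 3F → close-mono le cy }

  module _ (r : ℙ¹.Carrier) (z : ℍ².Carrier) where
    private
      s t x y : Carrier
      s = proj₁ r 0F
      t = proj₁ r 1F
      x = proj₁ (proj₁ z)
      y = proj₂ (proj₁ z)
      y>0 : 0# < y
      y>0 = proj₂ z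
      f : Cubic ℝ
      f = cubic s t x y
      f≈1f : ∀ i → f i ≈ 1# * cubic s t x y i
      f≈1f i = sym (*-identityˡ _)
      A>0 : 0# < factorA f s t
      A>0 = pos-resp (trans (sym (*-identityʳ _)) (sym (factorA-cubic 1≉0 f≈1f))) (quartic-pos r)
      4A²>0 : 0# < (1# + 1#) * (1# + 1#) * (factorA f s t * factorA f s t)
      4A²>0 = *-pos (*-pos 2>0 2>0) (*-pos A>0 A>0)

    opaque
      -- Once the real root is known to be close, the quadratic formula controls the others: x is a
      -- quotient, and y is reached through y², for which `root-close` asks the accuracy εy.
      roots-close : ∀ {ε} → 0# < ε → ∃ λ δ → 0# < δ × (∀ {g m s′ t′ x′ y′} → 0# < y′ → m ≉ 0# →
        (∀ i → g i ≈ m * cubic s′ t′ x′ y′ i) → CloseVec δ (variables f s t) (variables g s′ t′) →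
        Close ε x x′ × Close ε y y′)
      roots-close {ε} ε>0 =
        let (δ₁ , δ₁>0 , c₁) = quotient-continuous {ρ = variables f s t}
                                 (con (+ 2) :* A̲) (:- B̲) {x} (*-pos 2>0 A>0) (factorA-re 1≉0 f≈1f) ε>0
            (δ₂ , δ₂>0 , c₂) = quotient-continuous {ρ = variables f s t}
                                 (con (+ 2) :* con (+ 2) :* (A̲ :* A̲))
                                 (con (+ 2) :* con (+ 2) :* (A̲ :* C̲) :- B̲ :* B̲) {y * y}
                                 4A²>0 (factorA-im 1≉0 f≈1f) (*-pos ε>0 y>0)
            (δ , δ>0 , δ≤δ₁ , δ≤δ₂) = minimum δ₁>0 δ₂>0
        in δ , δ>0 , λ {g} {m} {s′} {t′} {x′} {y′} y′>0 m≉0 e c →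
          c₁ {variables g s′ t′} {x′} (λ i → close-mono δ≤δ₁ (c i)) (factorA-re m≉0 e) ,
          root-close y>0 y′>0 ε>0 (c₂ {variables g s′ t′} {y′ * y′} (λ i → close-mono δ≤δ₂ (c i))
            (factorA-im m≉0 e))

    private
      n : Carrier
      n = s * s + t * t

      -- The vector (s, t) moved by h in the orthogonal direction (-t, s). There tX - sY takes the
      -- value -h(s² + t²), so the cubic has the sign opposite to h.
      aside₀ aside₁ : Carrier → Carrier
      aside₀ h = s - h * t
      aside₁ h = t + h * s

      aside-value : ∀ h → evaluate ℝ f (aside₀ h) (aside₁ h) ≈ - h * n * normω (aside₀ h) (aside₁ h) x y
      aside-value h = trans (evaluate-multiply s t 1# (- ((1# + 1#) * x)) (x * x + y * y) (aside₀ h) (aside₁ h))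
        (solve 5 (λ s t x y h → let u = s :- h :* t ; v = t :+ h :* s in
          (t :* u :- s :* v) :* (con (+ 1) :* (u :* u) :+ (:- (con (+ 2) :* x)) :* (u :* v)
            :+ (x :* x :+ y :* y) :* (v :* v)) :=
          (:- h) :* (s :* s :+ t :* t) :*
          ((u :- v :* x) :* (u :- v :* x) :+ (v :* y) :* (v :* y))) refl s t x y h)

      aside : ∀ h → h ≉ 0# → ℙ¹.Carrier
      aside h h≉0 = (aside₀ h ∷ aside₁ h ∷ []) , λ e →
        *-nonzero h≉0 (pos⇒nonzero (norm-pos r)) (trans
          (solve 3 (λ s t h → h :* (s :* s :+ t :* t) := s :* (t :+ h :* s) :- t :* (s :- h :* t)) refl s t h)
          (trans (+-cong (*-congˡ (e 1F)) (-‿cong (*-congˡ (e 0F))))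
            (solve 2 (λ s t → s :* con (+ 0) :- t :* con (+ 0) := con (+ 0)) refl s t)))

      aside-close : ∀ {δ} → 0# < δ → ∃ λ η → 0# < η ×
        (∀ {h} → Small η h → Close δ s (aside₀ h) × Close δ t (aside₁ h))
      aside-close δ>0 =
        let (η₁ , η₁>0 , c₁) = polynomial-continuous {ρ = 0# ∷ᵛ s ∷ᵛ t ∷ᵛ []ᵛ}
                                 (var 1F :- var 0F :* var 2F) δ>0
            (η₂ , η₂>0 , c₂) = polynomial-continuous {ρ = 0# ∷ᵛ s ∷ᵛ t ∷ᵛ []ᵛ}
                                 (var 2F :+ var 0F :* var 1F) δ>0
            (η , η>0 , η≤η₁ , η≤η₂) = minimum η₁>0 η₂>0
            close = λ h (small : Small η h) → small⇒close {η} {0#} {h}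
                      (small-resp (solve 1 (λ h → h := h :- con (+ 0)) refl h) small)
        in η , η>0 , λ {h} small →
          close-resp (solve 2 (λ s t → s :- con (+ 0) :* t := s) refl s t) refl
            (c₁ {h ∷ᵛ s ∷ᵛ t ∷ᵛ []ᵛ} λ { 0F → close-mono η≤η₁ (close h small)
                                      ; 1F → close-refl η₁>0 refl ; 2F → close-refl η₁>0 refl }) ,
          close-resp (solve 2 (λ s t → t :+ con (+ 0) :* s := t) refl s t) refl
            (c₂ {h ∷ᵛ s ∷ᵛ t ∷ᵛ []ᵛ} λ { 0F → close-mono η≤η₂ (close h small)
                                      ; 1F → close-refl η₂>0 refl ; 2F → close-refl η₂>0 refl })

    opaque
      evaluate-near : ∀ (f : Cubic ℝ) u v {ε} → 0# < ε → ∃ λ δ → 0# < δ × (∀ {g} →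
        (∀ i → Close δ (f i) (g i)) → Close ε (evaluate ℝ f u v) (evaluate ℝ g u v))
      evaluate-near f u v ε>0 =
        let (δ , δ>0 , c) = polynomial-continuous {ρ = variables f u v} E̲ ε>0
        in δ , δ>0 , λ {g} k → c {variables g u v} λ
          { 0F → k 0F ; 1F → k 1F ; 2F → k 2F ; 3F → k 3F
          ; 4F → close-refl δ>0 refl ; 5F → close-refl δ>0 refl }

    opaque
      -- The factor tX - sY changes sign at [s : t], so nearby cubics have a root nearby.
      root-near : ∀ {ε η} → 0# < η →
        Close ε s (aside₀ η) × Close ε t (aside₁ η) → Close ε s (aside₀ (- η)) × Close ε t (aside₁ (- η)) →
        ∃ λ δ → 0# < δ × (∀ g → (∀ i → Close δ (f i) (g i)) →
          ∃ λ (r′ : ℙ¹.Carrier) → (∀ i → Close ε (proj₁ r i) (proj₁ r′ i)) ×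
            evaluate ℝ g (proj₁ r′ 0F) (proj₁ r′ 1F) ≈ 0#)
      root-near {ε} {η} η>0 cu cv =
        let (δ₁ , δ₁>0 , c₁) = evaluate-near f u₀ u₁ (neg⇒pos fu<0)
            (δ₂ , δ₂>0 , c₂) = evaluate-near f v₀ v₁ fv>0
            (δ , δ>0 , δ≤δ₁ , δ≤δ₂) = minimum δ₁>0 δ₂>0
        in δ , δ>0 , λ g near → root g
          (pos⇒neg (close-pos (close-neg (c₁ {g} (λ i → close-mono δ≤δ₁ (near i))))))
          (close-pos (c₂ {g} (λ i → close-mono δ≤δ₂ (near i))))
        where
        u₀ u₁ v₀ v₁ : Carrier
        u₀ = aside₀ η
        u₁ = aside₁ η
        v₀ = aside₀ (- η)
        v₁ = aside₁ (- η)
        n>0 : 0# < n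
        n>0 = norm-pos r
        η≉0 : η ≉ 0#
        η≉0 = pos⇒nonzero η>0
        -η≉0 : - η ≉ 0#
        -η≉0 e = η≉0 (trans (solve 1 (λ η → η := :- :- η) refl η)
          (trans (-‿cong e) (solve 0 (:- con (+ 0) := con (+ 0)) refl)))
        fu<0 : evaluate ℝ f u₀ u₁ < 0#
        fu<0 = pos⇒neg (pos-resp (trans
          (solve 3 (λ η n q → η :* n :* q := :- ((:- η) :* n :* q)) refl η n (normω u₀ u₁ x y))
          (-‿cong (sym (aside-value η))))
          (*-pos (*-pos η>0 n>0) (normω-pos (aside η η≉0) y>0)))
        fv>0 : 0# < evaluate ℝ f v₀ v₁
        fv>0 = pos-resp (trans
          (solve 3 (λ η n q → η :* n :* q := (:- :- η) :* n :* q) refl η n (normω v₀ v₁ x y))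
          (sym (aside-value (- η))))
          (*-pos (*-pos η>0 n>0) (normω-pos (aside (- η) -η≉0) y>0))
        independent : u₀ * v₁ ≉ u₁ * v₀
        independent e = *-nonzero (*-nonzero (pos⇒nonzero 2>0) η≉0) (pos⇒nonzero n>0) (trans
          (solve 3 (λ s t η → con (+ 2) :* η :* (s :* s :+ t :* t) :=
            (t :+ η :* s) :* (s :- (:- η) :* t) :- (s :- η :* t) :* (t :+ (:- η) :* s)) refl s t η)
          (trans (+-congˡ (-‿cong e)) (-‿inverseʳ _)))
        root : ∀ g → evaluate ℝ g u₀ u₁ < 0# → 0# < evaluate ℝ g v₀ v₁ →
          ∃ λ (r′ : ℙ¹.Carrier) → (∀ i → Close ε (proj₁ r i) (proj₁ r′ i)) ×
            evaluate ℝ g (proj₁ r′ 0F) (proj₁ r′ 1F) ≈ 0#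
        root g gu<0 gv>0 =
          let (h , 0≤h , h≤1 , w≉0 , e) = root-between g u₀ u₁ v₀ v₁ independent gu<0 gv>0
          in ((segment₀ g u₀ u₁ v₀ v₁ h ∷ segment₁ g u₀ u₁ v₀ v₁ h ∷ []) , w≉0) ,
             (λ { 0F → segment-close 0≤h h≤1 (proj₁ cu) (proj₁ cv)
                ; 1F → segment-close 0≤h h≤1 (proj₂ cu) (proj₂ cv) }) ,
             e

      root-persists : ∀ {ε} → 0# < ε → ∃ λ δ → 0# < δ × (∀ g → (∀ i → Close δ (f i) (g i)) →
        ∃ λ (r′ : ℙ¹.Carrier) → (∀ i → Close ε (proj₁ r i) (proj₁ r′ i)) ×
          evaluate ℝ g (proj₁ r′ 0F) (proj₁ r′ 1F) ≈ 0#)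
      root-persists ε>0 =
        let (θ , θ>0 , close) = aside-close ε>0
            (η , η>0 , 2η≈θ)  = halve θ>0
            small : Small θ η
            small = pos-resp (+-congʳ 2η≈θ) (+-pos (+-pos η>0 η>0) η>0) ,
                    pos-resp (trans (solve 1 (λ η → η := (η :+ η) :- η) refl η) (+-congʳ 2η≈θ)) η>0
        in root-near η>0 (close small) (close (small-neg small))

    -- The form g near f has a real root r″ near r. As g has only one real root, r″ represents r′,
    -- and factoring g at r″ puts z′ near z.
    cubicOf-inverse-continuous : ∀ {ε} → 0# < ε → ∃ λ δ → 0# < δ × (∀ r′ z′ →
      Near Δ⁻-nearness δ (cubicOf r z) (cubicOf r′ z′) → Near nearness ε (r , z) (r′ , z′))
    cubicOf-inverse-continuous {ε} ε>0 =
      let (δ₁ , δ₁>0 , c₁) = roots-close ε>0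
          (δ₂ , δ₂>0 , δ₂≤δ₁ , δ₂≤ε) = minimum δ₁>0 ε>0
          (δ₃ , δ₃>0 , c₃) = root-persists δ₂>0
          (δ , δ>0 , δ≤δ₁ , δ≤δ₃) = minimum δ₁>0 δ₃>0
      in δ , δ>0 , λ { r′ z′@((x′ , y′) , y′>0) ((g , _) , (m , m≉0 , e) , near) →
        let (r″ , near″ , gr″≈0) = c₃ g (λ i → close-mono δ≤δ₃ (near i))
            r″≈r′ = parallel⇒≈ r″ r′ (cubic-root {g} m≉0 e y′>0 r″ gr″≈0)
            (k , k≉0 , e′) = cubicOf-cong r′ r″ z′ z′ (ℙ¹.sym {r″} {r′} r″≈r′) (ℍ².refl {z′})
            close : CloseVec δ₁ (variables f s t) (variables g (proj₁ r″ 0F) (proj₁ r″ 1F))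
            close = λ { 0F → close-mono δ≤δ₁ (near 0F) ; 1F → close-mono δ≤δ₁ (near 1F)
                      ; 2F → close-mono δ≤δ₁ (near 2F) ; 3F → close-mono δ≤δ₁ (near 3F)
                      ; 4F → close-mono δ₂≤δ₁ (near″ 0F) ; 5F → close-mono δ₂≤δ₁ (near″ 1F) }
        in (r″ , r″≈r′ , λ i → close-mono δ₂≤ε (near″ i)) ,
           c₁ {g} {m * k} {proj₁ r″ 0F} {proj₁ r″ 1F} {x′} {y′} y′>0 (*-nonzero m≉0 k≉0)
             (λ i → trans (e i) (trans (*-congˡ (e′ i)) (sym (*-assoc m k _)))) close }

  ℙ¹×ℍ²≅Δ⁻ : ℙ¹×ℍ² ≅ Δ⁻ ℝ
  ℙ¹×ℍ²≅Δ⁻ = nearness-≅ {X = ℙ¹×ℍ²} {Δ⁻ ℝ} nearness Δ⁻-nearness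
    (λ (r , z) → cubicOf r z) roots
    (λ {(r , z)} {(r′ , z′)} (e , f) → cubicOf-cong r r′ z z′ e f)
    (λ {(r , z)} {(r′ , z′)} → cubicOf-injective r r′ z z′)
    cubicOf-roots
    (λ M (r , z) → cubicOf-equivariant M r z)
    (λ (r , z) ε>0 → let (δ , δ>0 , k) = cubicOf-continuous r z ε>0 in
      δ , δ>0 , λ {(r′ , z′)} → k r′ z′)
    (λ (r , z) ε>0 → let (δ , δ>0 , k) = cubicOf-inverse-continuous r z ε>0 in
      δ , δ>0 , λ {(r′ , z′)} → k r′ z′)

-- Root sets as unordered triples.

module RootSets (ℝ : CompleteOrderedField) where
  open CompleteOrderedField ℝ
  open OrderProperties ℝ
  open IntegerSolver commutativeRing
  open Analysis ℝ
  open Topologies ℝ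
  open ProjectiveSpaces ℝ
  open PointedPlane ℝ
  open TangentEquivariance ℝ using (conj-resp)

  module ℛ = GSpace (ℛ[Δ⁻] ℝ) using (Carrier; _≈_; _·_)
  module ℂℙ¹ = Setoid (ℂℙ¹ ℝ) using (Carrier; _≈_; refl; sym; trans)
  module SP³ = Setoid (SP³ℂℙ¹ ℝ) using (Carrier; _≈_; refl; sym; trans)

  SP³-nearness : Nearness (SP-topology 3 (ℂℙ¹ ℝ) (ℙ-topology (ℂ ℝ) 1 (ℂ-topology ℝ)))
  SP³-nearness = SP-nearness {S = ℂℙ¹ ℝ} (ℂℙ-nearness 1) 3

  ℛ-nearness : Nearness (GSpace.topology (ℛ[Δ⁻] ℝ))
  ℛ-nearness = subspace-nearness {S = SP³ℂℙ¹ ℝ} SP³-nearness (IsRootSet ℝ)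

  rootSet : ℙ¹.Carrier → ℍ².Carrier → ℛ.Carrier
  rootSet r z = rootTriple ℝ r (proj₁ z) , r , proj₁ z , nonreal ℝ z ,
                SP³.refl {rootTriple ℝ r (proj₁ z)}

  affine-cong : ∀ {z w} → z ℂ.≈ w → affine (ℂ ℝ) z ℂℙ¹.≈ affine (ℂ ℝ) w
  affine-cong {z} {w} e = ℂ.1# , ℂ.1≉0 , λ
    { 0F → ℂ.trans e (ℂ.sym (ℂ.*-identityˡ w))
    ; 1F → ℂ.sym (ℂ.*-identityˡ ℂ.1#) }

  ιℙ-cong : ∀ r r′ → r ℙ¹.≈ r′ → ιℙ ℝ r ℂℙ¹.≈ ιℙ ℝ r′
  ιℙ-cong (v , _) (w , _) (k , k≉0 , e) = ι ℝ k , (λ (p , _) → k≉0 p) , λ i →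
    trans (e i) (solve 2 (λ k w → k :* w := k :* w :- con (+ 0) :* con (+ 0)) refl k (w i)) ,
    solve 2 (λ k w → con (+ 0) := k :* con (+ 0) :+ con (+ 0) :* w) refl k (w i)

  rootSet-cong : ∀ r r′ z z′ → r ℙ¹.≈ r′ → z ℍ².≈ z′ → rootSet r z ℛ.≈ rootSet r′ z′
  rootSet-cong r r′ z z′ r≈r′ z≈z′ = Perm.id , λ
    { 0F → ιℙ-cong r r′ r≈r′
    ; 1F → affine-cong {proj₁ z} {proj₁ z′} z≈z′
    ; 2F → affine-cong {conj ℝ (proj₁ z)} {conj ℝ (proj₁ z′)} (conj-resp {proj₁ z} {proj₁ z′} z≈z′) }

  -- im (u₀ · conj u₁), whose sign distinguishes the two half planes and the real
  -- line in homogeneous coordinates.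
  side : Vector (C ℝ) 2 → Carrier
  side u = im ℝ (u 0F) * re ℝ (u 1F) - re ℝ (u 0F) * im ℝ (u 1F)

  -- Scaling u by k multiplies u₀ ū₁ by k k̄, so the sign of `side` depends only on the projective
  -- point.
  side-scale : ∀ {u w : Vector (C ℝ) 2} {k} → (∀ i → u i ℂ.≈ k ℂ.* w i) →
    side u ≈ ∣_∣² ℝ k * side w
  side-scale {u} {w} {k₁ , k₂} e = trans
    (+-cong (*-cong (proj₂ (e 0F)) (proj₁ (e 1F))) (-‿cong (*-cong (proj₁ (e 0F)) (proj₂ (e 1F)))))
    (solve 6 (λ k l a b c d →
      (k :* b :+ l :* a) :* (k :* c :- l :* d) :- (k :* a :- l :* b) :* (k :* d :+ l :* c) :=
      (k :* k :+ l :* l) :* (b :* c :- a :* d)) refl k₁ k₂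
      (re ℝ (w 0F)) (im ℝ (w 0F)) (re ℝ (w 1F)) (im ℝ (w 1F)))

  side-real : ∀ (u : ℂℙ¹.Carrier) r → u ℂℙ¹.≈ ιℙ ℝ r → side (proj₁ u) ≈ 0#
  side-real u r (k , _ , e) = trans (side-scale {proj₁ u} {proj₁ (ιℙ ℝ r)} {k} e)
    (solve 3 (λ k a c → k :* (con (+ 0) :* c :- a :* con (+ 0)) := con (+ 0)) refl
      (∣_∣² ℝ k) (proj₁ r 0F) (proj₁ r 1F))

  side-affine : ∀ (u : ℂℙ¹.Carrier) z → u ℂℙ¹.≈ affine (ℂ ℝ) z →
    ∃ λ k → 0# < k × side (proj₁ u) ≈ k * im ℝ z
  side-affine u z (k , k≉0 , e) = ∣_∣² ℝ k , ∣∣²-pos ℝ k≉0 ,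
    trans (side-scale {proj₁ u} {proj₁ (affine (ℂ ℝ) z)} {k} e) (*-congˡ
      (solve 2 (λ x y → y :* con (+ 1) :- x :* con (+ 0) := y) refl (re ℝ z) (im ℝ z)))

  module _ (r : ℙ¹.Carrier) (z : ℍ².Carrier) where

    -- `side` is zero at r, positive at z and negative at z̄, so its sign tells the roots apart.
    index-upper : ∀ j (u : ℂℙ¹.Carrier) → u ℂℙ¹.≈ rootTriple ℝ r (proj₁ z) j → 0# < side (proj₁ u) →
      j ≡.≡ 1F
    index-upper 0F u e p = ⊥-elim (irrefl (sym (side-real u r e)) p)
    index-upper 1F u e p = ≡.refl
    index-upper 2F u e p = let (k , k>0 , e′) = side-affine u (conj ℝ (proj₁ z)) e in
      ⊥-elim (<-irrefl (pos-resp (trans (+-congʳ e′)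
        (solve 2 (λ k y → k :* (:- y) :+ k :* y := con (+ 0)) refl k (im ℝ (proj₁ z))))
        (+-pos p (*-pos k>0 (proj₂ z)))))

    index-lower : ∀ j (u : ℂℙ¹.Carrier) → u ℂℙ¹.≈ rootTriple ℝ r (proj₁ z) j → side (proj₁ u) < 0# →
      j ≡.≡ 2F
    index-lower 0F u e p = ⊥-elim (irrefl (side-real u r e) p)
    index-lower 1F u e p = let (k , k>0 , e′) = side-affine u (proj₁ z) e in
      ⊥-elim (<-irrefl (<-trans (pos-resp (sym e′) (*-pos k>0 (proj₂ z))) p))
    index-lower 2F u e p = ≡.refl

    -- The signs fix π at the two nonreal roots, and injectivity leaves only the real root for the
    -- remaining index. `u` is an arbitrary triple because the continuity proof applies this to
    -- representatives that are merely near a root triple.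
    match : ∀ (π : Perm.Permutation′ 3) (u : Vector ℂℙ¹.Carrier 3) →
      (∀ i → u i ℂℙ¹.≈ rootTriple ℝ r (proj₁ z) (π Perm.⟨$⟩ʳ i)) →
      0# < side (proj₁ (u 1F)) → side (proj₁ (u 2F)) < 0# →
      u 0F ℂℙ¹.≈ ιℙ ℝ r × u 1F ℂℙ¹.≈ affine (ℂ ℝ) (proj₁ z)
    match π u e upper lower =
      real-case (π Perm.⟨$⟩ʳ 0F) ≡.refl (e 0F) ,
      ≡.subst (λ j → u 1F ℂℙ¹.≈ rootTriple ℝ r (proj₁ z) j) π1≡1 (e 1F)
      where
      π1≡1 : π Perm.⟨$⟩ʳ 1F ≡.≡ 1F
      π1≡1 = index-upper (π Perm.⟨$⟩ʳ 1F) (u 1F) (e 1F) upper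
      π2≡2 : π Perm.⟨$⟩ʳ 2F ≡.≡ 2F
      π2≡2 = index-lower (π Perm.⟨$⟩ʳ 2F) (u 2F) (e 2F) lower
      injective : ∀ {i j} → π Perm.⟨$⟩ʳ i ≡.≡ π Perm.⟨$⟩ʳ j → i ≡.≡ j
      injective p = ≡.trans (≡.sym (Perm.inverseˡ π)) (≡.trans (≡.cong (π Perm.⟨$⟩ˡ_) p) (Perm.inverseˡ π))
      real-case : ∀ j → π Perm.⟨$⟩ʳ 0F ≡.≡ j → u 0F ℂℙ¹.≈ rootTriple ℝ r (proj₁ z) j →
        u 0F ℂℙ¹.≈ ιℙ ℝ r
      real-case 0F _ e₀ = e₀
      real-case 1F p _ with injective (≡.trans p (≡.sym π1≡1))
      ... | ()
      real-case 2F p _ with injective (≡.trans p (≡.sym π2≡2))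
      ... | ()

  -- Real and imaginary part of |u₁|² z = u₀ ū₁, that is of z = u₀ / u₁ without a division.
  affine-coordinates : ∀ (u : ℂℙ¹.Carrier) z → u ℂℙ¹.≈ affine (ℂ ℝ) z →
    let a = re ℝ (proj₁ u 0F) ; b = im ℝ (proj₁ u 0F) ; c = re ℝ (proj₁ u 1F) ; d = im ℝ (proj₁ u 1F) in
    (c * c + d * d) * re ℝ z ≈ a * c + b * d × (c * c + d * d) * im ℝ z ≈ b * c - a * d
  affine-coordinates u (x , y) ((k , l) , _ , e) =
    trans (*-congʳ (+-cong (*-cong c≈ c≈) (*-cong d≈ d≈))) (trans
      (solve 4 (λ k l x y → (k :* k :+ l :* l) :* x :=
        (k :* x :- l :* y) :* k :+ (k :* y :+ l :* x) :* l) refl k l x y)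
      (sym (+-cong (*-cong a≈ c≈) (*-cong b≈ d≈)))) ,
    trans (*-congʳ (+-cong (*-cong c≈ c≈) (*-cong d≈ d≈))) (trans
      (solve 4 (λ k l x y → (k :* k :+ l :* l) :* y :=
        (k :* y :+ l :* x) :* k :- (k :* x :- l :* y) :* l) refl k l x y)
      (sym (+-cong (*-cong b≈ c≈) (-‿cong (*-cong a≈ d≈)))))
    where
    a≈ = proj₁ (e 0F)
    b≈ = proj₂ (e 0F)
    c≈ : re ℝ (proj₁ u 1F) ≈ k
    c≈ = trans (proj₁ (e 1F)) (solve 2 (λ k l → k :* con (+ 1) :- l :* con (+ 0) := k) refl k l)
    d≈ : im ℝ (proj₁ u 1F) ≈ l
    d≈ = trans (proj₂ (e 1F)) (solve 2 (λ k l → k :* con (+ 0) :+ l :* con (+ 1) := l) refl k l)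

  -- If u is k times a real vector, its real part is Re k times that vector, hence parallel to it
  -- even for Re k = 0.
  real-part-parallel : ∀ (u : ℂℙ¹.Carrier) r → u ℂℙ¹.≈ ιℙ ℝ r →
    re ℝ (proj₁ u 0F) * proj₁ r 1F ≈ re ℝ (proj₁ u 1F) * proj₁ r 0F
  real-part-parallel u (v , _) ((k , l) , _ , e) =
    trans (*-congʳ (proj₁ (e 0F))) (trans
      (solve 4 (λ k l v w → (k :* v :- l :* con (+ 0)) :* w := (k :* w :- l :* con (+ 0)) :* v)
        refl k l (v 0F) (v 1F))
      (*-congʳ (sym (proj₁ (e 1F)))))

  affine-upper : ∀ (z : ℍ².Carrier) → 0# < side (proj₁ (affine (ℂ ℝ) (proj₁ z)))
  affine-upper ((x , y) , y>0) =
    pos-resp (solve 2 (λ x y → y := y :* con (+ 1) :- x :* con (+ 0)) refl x y) y>0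

  affine-lower : ∀ (z : ℍ².Carrier) → side (proj₁ (affine (ℂ ℝ) (conj ℝ (proj₁ z)))) < 0#
  affine-lower ((x , y) , y>0) = pos⇒neg
    (pos-resp (solve 2 (λ x y → y := :- ((:- y) :* con (+ 1) :- x :* con (+ 0))) refl x y) y>0)

  rootSet-injective : ∀ r r′ z z′ → rootSet r z ℛ.≈ rootSet r′ z′ → r ℙ¹.≈ r′ × z ℍ².≈ z′
  rootSet-injective r r′ z@((x , y) , _) z′@((x′ , y′) , _) (π , e) =
    let (e₀ , e₁) = match r′ z′ π (rootTriple ℝ r (proj₁ z)) e (affine-upper z) (affine-lower z)
        (ex , ey) = affine-coordinates (affine (ℂ ℝ) (x , y)) (x′ , y′) e₁
    in parallel⇒≈ r r′ (real-part-parallel (ιℙ ℝ r) r′ e₀) ,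
       trans (solve 2 (λ x y → x := x :* con (+ 1) :+ y :* con (+ 0)) refl x y)
         (trans (sym ex) (one x′)) ,
       trans (solve 2 (λ x y → y := y :* con (+ 1) :- x :* con (+ 0)) refl x y)
         (trans (sym ey) (one y′))
    where
    one : ∀ x → (1# * 1# + 0# * 0#) * x ≈ x
    one x = solve 1 (λ x → (con (+ 1) :* con (+ 1) :+ con (+ 0) :* con (+ 0)) :* x := x) refl x

  -- The z supplied by `IsRootSet` may lie in either half plane.
  upperRoot : ℛ.Carrier → ℙ¹.Carrier × ℍ².Carrier
  upperRoot (_ , r , z , nz , _) with compare (im ℝ z) 0#
  ... | tri< y<0 _ _ = r , (conj ℝ z , neg⇒pos y<0)
  ... | tri≈ _ y≈0 _ = ⊥-elim (nz y≈0)
  ... | tri> _ _ y>0 = r , (z , y>0)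

  rootSet-upperRoot : ∀ s → rootSet (proj₁ (upperRoot s)) (proj₂ (upperRoot s)) ℛ.≈ s
  rootSet-upperRoot (s , r , z , nz , e) with compare (im ℝ z) 0#
  ... | tri≈ _ y≈0 _ = ⊥-elim (nz y≈0)
  ... | tri> _ _ y>0 = SP³.sym {s} {rootTriple ℝ r z} e
  ... | tri< y<0 _ _ = SP³.trans {rootTriple ℝ r (conj ℝ z)} {rootTriple ℝ r z} {s}
    (Perm.transpose 1F 2F , λ
      { 0F → ℂℙ¹.refl {ιℙ ℝ r}
      ; 1F → ℂℙ¹.refl {affine (ℂ ℝ) (conj ℝ z)}
      ; 2F → affine-cong {conj ℝ (conj ℝ z)} {z} (refl , solve 1 (λ y → :- :- y := y) refl (im ℝ z)) })
    (SP³.sym {s} {rootTriple ℝ r z} e)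

-- The homeomorphism with the space of root sets.

module RootSetIso (ℝ : CompleteOrderedField) where
  open CompleteOrderedField ℝ
  open OrderProperties ℝ
  open IntegerSolver commutativeRing
  open Analysis ℝ
  open Topologies ℝ
  open ProjectiveSpaces ℝ
  open PointedPlane ℝ
  open TangentEquivariance ℝ using (conj*; conj-resp)
  open RootSets ℝ
  open Nearness

  conj-linear : ∀ a b z → ι ℝ a ℂ.* conj ℝ z ℂ.+ ι ℝ b ℂ.≈ conj ℝ (ι ℝ a ℂ.* z ℂ.+ ι ℝ b)
  conj-linear a b (x , y) =
    solve 4 (λ a b x y → (a :* x :- con (+ 0) :* (:- y)) :+ b := (a :* x :- con (+ 0) :* y) :+ b)
      refl a b x y ,
    solve 3 (λ a x y → (a :* (:- y) :+ con (+ 0) :* x) :+ con (+ 0) :=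
      :- ((a :* y :+ con (+ 0) :* x) :+ con (+ 0))) refl a x y

  -- For the third root the reason is that a real matrix commutes with conjugation.
  rootSet-equivariant : ∀ M r z →
    rootSet (möbius fieldStructure M r) (isometry ℝ M z) ℛ.≈ M ℛ.· rootSet r z
  rootSet-equivariant M r@(v , _) z@(w , y>0) = Perm.id , λ
    { 0F → ιℙ-möbius
    ; 1F → ℂℙ¹.sym {möbius (ℂ ℝ) M′ (affine (ℂ ℝ) w)} {affine (ℂ ℝ) Mw}
        (affine-möbius (ℂ ℝ) M′ {w} {Mw} (denominator-nonzero ℝ M y≉0) jMw≈n)
    ; 2F → ℂℙ¹.sym {möbius (ℂ ℝ) M′ (affine (ℂ ℝ) (conj ℝ w))} {affine (ℂ ℝ) (conj ℝ Mw)}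
        (affine-möbius (ℂ ℝ) M′ {conj ℝ w} {conj ℝ Mw} (denominator-nonzero ℝ M -y≉0)
          (ℂ.trans (ℂ.*-congʳ {conj ℝ Mw} (conj-linear c d w))
          (ℂ.trans (ℂ.sym (conj* (denominator (ℂ ℝ) M′ w) Mw))
          (ℂ.trans (conj-resp {denominator (ℂ ℝ) M′ w ℂ.* Mw} {numerator (ℂ ℝ) M′ w} jMw≈n)
                   (ℂ.sym (conj-linear a b w)))))) }
    where
    open SL₂ M
    M′ : SL₂ (ℂ ℝ)
    M′ = complexify ℝ M
    y≉0 : im ℝ w ≉ 0#
    y≉0 = nonreal ℝ z
    -y≉0 : im ℝ (conj ℝ w) ≉ 0#
    -y≉0 e = y≉0 (trans (solve 1 (λ y → y := :- :- y) refl (im ℝ w))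
      (trans (-‿cong e) (solve 0 (:- con (+ 0) := con (+ 0)) refl)))
    Mw : C ℝ
    Mw = möbiusℂ ℝ M w y≉0
    jMw≈n : denominator (ℂ ℝ) M′ w ℂ.* Mw ℂ.≈ numerator (ℂ ℝ) M′ w
    jMw≈n = denominator*fractional (ℂ ℝ) M′ w (denominator-nonzero ℝ M y≉0)
    ιℙ-möbius : ιℙ ℝ (möbius fieldStructure M r) ℂℙ¹.≈ möbius (ℂ ℝ) M′ (ιℙ ℝ r)
    ιℙ-möbius = ℂ.1# , ℂ.1≉0 , λ { 0F → ι-linear a b ; 1F → ι-linear c d }
      where
      ι-linear : ∀ p q → ι ℝ (p * v 0F + q * v 1F) ℂ.≈
        ℂ.1# ℂ.* (ι ℝ p ℂ.* ι ℝ (v 0F) ℂ.+ ι ℝ q ℂ.* ι ℝ (v 1F))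
      ι-linear p q =
        solve 4 (λ p q s t → let 0̲ = con (+ 0) ; 1̲ = con (+ 1) in
          p :* s :+ q :* t :=
          1̲ :* ((p :* s :- 0̲ :* 0̲) :+ (q :* t :- 0̲ :* 0̲)) :-
          0̲ :* ((p :* 0̲ :+ 0̲ :* s) :+ (q :* 0̲ :+ 0̲ :* t))) refl p q (v 0F) (v 1F) ,
        solve 4 (λ p q s t → let 0̲ = con (+ 0) ; 1̲ = con (+ 1) in
          0̲ :=
          1̲ :* ((p :* 0̲ :+ 0̲ :* s) :+ (q :* 0̲ :+ 0̲ :* t)) :+
          0̲ :* ((p :* s :- 0̲ :* 0̲) :+ (q :* t :- 0̲ :* 0̲))) refl p q (v 0F) (v 1F)

  rootSet-continuous : ∀ r z {ε} → 0# < ε → ∃ λ δ → 0# < δ × (∀ r′ z′ →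
    Near nearness δ (r , z) (r′ , z′) → Near ℛ-nearness ε (rootSet r z) (rootSet r′ z′))
  -- δ = ε suffices: up to sign, the homogeneous coordinates of the three roots are those of r and z
  -- or the constants 0 and 1.
  rootSet-continuous r z {ε} ε>0 = ε , ε>0 , λ r′ z′ near →
    rootTriple ℝ r′ (proj₁ z′) , SP³.refl {rootTriple ℝ r′ (proj₁ z′)} , close r′ z′ near
    where
    close : ∀ r′ z′ → Near nearness ε (r , z) (r′ , z′) →
      ∀ i → Near (ℂℙ-nearness 1) ε (rootTriple ℝ r (proj₁ z) i) (rootTriple ℝ r′ (proj₁ z′) i)
    close r′ z′ ((r″ , r″≈r′ , near) , cx , cy) = λ
      { 0F → ιℙ ℝ r″ , ιℙ-cong r″ r′ r″≈r′ , λ i → near i , close-refl ε>0 refl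
      ; 1F → affine (ℂ ℝ) (proj₁ z′) , ℂℙ¹.refl {affine (ℂ ℝ) (proj₁ z′)} , λ
          { 0F → cx , cy
          ; 1F → close-refl ε>0 refl , close-refl ε>0 refl }
      ; 2F → affine (ℂ ℝ) (conj ℝ (proj₁ z′)) , ℂℙ¹.refl {affine (ℂ ℝ) (conj ℝ (proj₁ z′))} , λ
          { 0F → cx , close-neg cy
          ; 1F → close-refl ε>0 refl , close-refl ε>0 refl } }

  private
    coordinates : (u : Vector (C ℝ) 2) → Vec Carrier 4
    coordinates u = re ℝ (u 0F) ∷ᵛ im ℝ (u 0F) ∷ᵛ re ℝ (u 1F) ∷ᵛ im ℝ (u 1F) ∷ᵛ []ᵛ

    coordinates-close : ∀ {ε} {u w : Vector (C ℝ) 2} →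
      (∀ i → Close ε (re ℝ (u i)) (re ℝ (w i)) × Close ε (im ℝ (u i)) (im ℝ (w i))) →
      CloseVec ε (coordinates u) (coordinates w)
    coordinates-close c = λ
      { 0F → proj₁ (c 0F) ; 1F → proj₂ (c 0F) ; 2F → proj₁ (c 1F) ; 3F → proj₂ (c 1F) }

  side-near : ∀ u {ε} → 0# < ε → ∃ λ δ → 0# < δ × (∀ {w} →
    CloseVec δ (coordinates u) (coordinates w) → Close ε (side u) (side w))
  side-near u ε>0 =
    let (δ , δ>0 , c) = polynomial-continuous {ρ = coordinates u}
                          (var 1F :* var 2F :- var 0F :* var 3F) ε>0
    in δ , δ>0 , λ {w} near → c {coordinates w} near

  affine-near : ∀ z {ε} → 0# < ε → ∃ λ δ → 0# < δ × (∀ (w : ℂℙ¹.Carrier) z′ →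
    w ℂℙ¹.≈ affine (ℂ ℝ) z′ →
    CloseVec δ (coordinates (proj₁ (affine (ℂ ℝ) z))) (coordinates (proj₁ w)) →
    Close ε (re ℝ z) (re ℝ z′) × Close ε (im ℝ z) (im ℝ z′))
  affine-near z {ε} ε>0 =
    let (ex , ey) = affine-coordinates (affine (ℂ ℝ) z) z (ℂℙ¹.refl {affine (ℂ ℝ) z})
        (δ₁ , δ₁>0 , c₁) = quotient-continuous {ρ = coordinates (proj₁ (affine (ℂ ℝ) z))} p
          (var 0F :* var 2F :+ var 1F :* var 3F) {re ℝ z} p>0 ex ε>0
        (δ₂ , δ₂>0 , c₂) = quotient-continuous {ρ = coordinates (proj₁ (affine (ℂ ℝ) z))} p
          (var 1F :* var 2F :- var 0F :* var 3F) {im ℝ z} p>0 ey ε>0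
        (δ , δ>0 , δ≤δ₁ , δ≤δ₂) = minimum δ₁>0 δ₂>0
    in δ , δ>0 , λ w z′ e near →
      let (ex′ , ey′) = affine-coordinates w z′ e in
      c₁ {coordinates (proj₁ w)} {re ℝ z′} (λ i → close-mono δ≤δ₁ (near i)) ex′ ,
      c₂ {coordinates (proj₁ w)} {im ℝ z′} (λ i → close-mono δ≤δ₂ (near i)) ey′
    where
    p : Polynomial 4
    p = var 2F :* var 2F :+ var 3F :* var 3F
    p>0 : 0# < 1# * 1# + 0# * 0#
    p>0 = pos-resp (solve 0 (con (+ 1) := con (+ 1) :* con (+ 1) :+ con (+ 0) :* con (+ 0)) refl) 1-pos

  -- Nearness supplies complex representatives u of the nearby roots in unknown order. For small δ,
  -- `side` keeps its sign on the last two of them, so `match` applies. The real part of the first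
  -- is then a real representative of r′ near r, and z′ is a quotient of the coordinates of the
  -- second.
  rootSet-inverse-continuous : ∀ r z {ε} → 0# < ε → ∃ λ δ → 0# < δ × (∀ r′ z′ →
    Near ℛ-nearness δ (rootSet r z) (rootSet r′ z′) → Near nearness ε (r , z) (r′ , z′))
  rootSet-inverse-continuous r z {ε} ε>0 =
    let (δ₀ , δ₀>0 , nonzero) = nonzero-near r
        (δ₁ , δ₁>0 , c₁) = side-near (proj₁ (affine (ℂ ℝ) (proj₁ z))) (affine-upper z)
        (δ₂ , δ₂>0 , c₂) = side-near (proj₁ (affine (ℂ ℝ) (conj ℝ (proj₁ z)))) (neg⇒pos (affine-lower z))
        (δ₃ , δ₃>0 , c₃) = affine-near (proj₁ z) ε>0
        (δ , δ>0 , δ≤) = minimumᵥ {5}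
          (λ { 0F → δ₀ ; 1F → δ₁ ; 2F → δ₂ ; 3F → δ₃ ; 4F → ε })
          (λ { 0F → δ₀>0 ; 1F → δ₁>0 ; 2F → δ₂>0 ; 3F → δ₃>0 ; 4F → ε>0 })
    in δ , δ>0 , λ { r′ z′ (s , (π , e) , near) →
      let u = λ i → proj₁ (near i)
          close = λ i {η} (le : δ ≤ η) → coordinates-close {η} {proj₁ (rootTriple ℝ r (proj₁ z) i)} {proj₁ (u i)}
                    λ j → close-mono le (proj₁ (proj₂ (proj₂ (near i)) j)) ,
                          close-mono le (proj₂ (proj₂ (proj₂ (near i)) j))
          (e₀ , e₁) = match r′ z′ π u
            (λ i → ℂℙ¹.trans {u i} {s i} {rootTriple ℝ r′ (proj₁ z′) (π Perm.⟨$⟩ʳ i)}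
                     (proj₁ (proj₂ (near i))) (e i))
            (close-pos (c₁ {proj₁ (u 1F)} (close 1F (δ≤ 1F))))
            (pos⇒neg (close-pos (close-neg (c₂ {proj₁ (u 2F)} (close 2F (δ≤ 2F))))))
          r″ : ℙ¹.Carrier
          r″ = (λ j → re ℝ (proj₁ (u 0F) j)) ,
               nonzero λ j → close-mono (δ≤ 0F) (proj₁ (proj₂ (proj₂ (near 0F)) j))
      in (r″ , parallel⇒≈ r″ r′ (real-part-parallel (u 0F) r′ e₀) ,
           λ j → close-mono (δ≤ 4F) (proj₁ (proj₂ (proj₂ (near 0F)) j))) ,
         c₃ (u 1F) (proj₁ z′) e₁ (close 1F (δ≤ 3F)) }

  ℙ¹×ℍ²≅ℛ[Δ⁻] : ℙ¹×ℍ² ≅ ℛ[Δ⁻] ℝ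
  ℙ¹×ℍ²≅ℛ[Δ⁻] = nearness-≅ {X = ℙ¹×ℍ²} {ℛ[Δ⁻] ℝ} nearness ℛ-nearness
    (λ (r , z) → rootSet r z) upperRoot
    (λ {(r , z)} {(r′ , z′)} (e , f) → rootSet-cong r r′ z z′ e f)
    (λ {(r , z)} {(r′ , z′)} → rootSet-injective r r′ z z′)
    rootSet-upperRoot
    (λ M (r , z) → rootSet-equivariant M r z)
    (λ (r , z) ε>0 → let (δ , δ>0 , k) = rootSet-continuous r z ε>0 in
      δ , δ>0 , λ {(r′ , z′)} → k r′ z′)
    (λ (r , z) ε>0 → let (δ , δ>0 , k) = rootSet-inverse-continuous r z ε>0 in
      δ , δ>0 , λ {(r′ , z′)} → k r′ z′)

theorem4p13 : (∀ {ℓ} → ExcludedMiddle ℓ) → (ℝ : CompleteOrderedField) →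
    (Δ⁻ ℝ ≅ UTℍ² ℝ) × (ℛ[Δ⁻] ℝ ≅ UTℍ² ℝ)
theorem4p13 _ ℝ = ≅-trans (≅-sym ℙ¹×ℍ²≅Δ⁻) ℙ¹×ℍ²≅UTℍ² , ≅-trans (≅-sym ℙ¹×ℍ²≅ℛ[Δ⁻]) ℙ¹×ℍ²≅UTℍ²
  where
  open TangentIso ℝ
  open CubicContinuity ℝ
  open RootSetIso ℝ
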